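{- Let $d>1$ be a square-free integer and let $\mathcal{O}$ be the ring of integers of $\mathbb{Q}(\sqrt{d})$. Then the set $\{\pi_1/\pi_2 : \pi_1,\pi_2 \text{ are prime elements of } \mathcal{O}\}$ is dense in $\mathbb{R}$.
   Context: The ring of integers of $\mathbb{Q}(\sqrt d)$ is $\mathcal{O}=\mathbb{Z}[\sqrt d]$ if $d\not\equiv 1\pmod 4$ and $\mathcal{O}=\mathbb{Z}[\tfrac{1+\sqrt d}{2}]$ if $d\equiv 1\pmod 4$; for $d>0$ it is a subring of $\mathbb{R}$ (with $\sqrt d$ the positive square root). A prime element of $\mathcal{O}$ is a nonzero nonunit $\pi\in\mathcal{O}$ such that whenever $\pi\mid\alpha\beta$ with $\alpha,\beta\in\mathcal{O}$, then $\pi\mid\alpha$ or $\pi\mid\beta$. -}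

module Defs where

open import Data.Nat as ℕ using (ℕ; _%_; _/_; _≡ᵇ_; _∸_)
open import Data.Nat.Divisibility as ℕD using ()
open import Data.Integer as ℤ using (ℤ; +_; 0ℤ; 1ℤ)
open import Data.Rational as ℚ using (ℚ; ↥_; ↧_)
open import Data.Bool using (if_then_else_)
open import Data.Product using (_×_; _,_; Σ; ∃)
open import Data.Sum using (_⊎_)
open import Relation.Nullary using (¬_)
open import Relation.Binary.PropositionalEquality using (_≡_)

SquareFree : ℕ → Set
SquareFree d = ∀ (k : ℕ) → (k ℕ.* k) ℕD.∣ d → k ≡ 1

-- O = ℤ[ω] with ω = √d (d ≢ 1 mod 4) or ω = (1+√d)/2 (d ≡ 1 mod 4).
-- ω satisfies ω² = tr d · ω + nm d.
tr : ℕ → ℤ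
tr d = if (d % 4) ≡ᵇ 1 then 1ℤ else 0ℤ

nm : ℕ → ℤ
nm d = if (d % 4) ≡ᵇ 1 then + ((d ∸ 1) / 4) else + d

-- element (a , b) represents a + b ω
O : Set
O = ℤ × ℤ

oneO : O
oneO = (1ℤ , 0ℤ)

zeroO : O
zeroO = (0ℤ , 0ℤ)

mulO : ℕ → O → O → O
mulO d (a , b) (c , e) =
  (a ℤ.* c ℤ.+ nm d ℤ.* (b ℤ.* e)) , (a ℤ.* e ℤ.+ b ℤ.* c ℤ.+ tr d ℤ.* (b ℤ.* e))

subO : O → O → O
subO (a , b) (c , e) = (a ℤ.- c , b ℤ.- e)

scaleO : ℤ → O → O
scaleO k (a , b) = (k ℤ.* a , k ℤ.* b)

DividesO : ℕ → O → O → Set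
DividesO d α β = Σ O (λ γ → β ≡ mulO d α γ)

UnitO : ℕ → O → Set
UnitO d α = Σ O (λ γ → mulO d α γ ≡ oneO)

PrimeO : ℕ → O → Set
PrimeO d π =
  (¬ (π ≡ zeroO)) × (¬ UnitO d π) ×
  (∀ (α β : O) → DividesO d π (mulO d α β) → DividesO d π α ⊎ DividesO d π β)

-- u + v √d > 0 as a real number (valid for d > 0 not a perfect square)
PosSqrt : ℕ → ℤ → ℤ → Set
PosSqrt d u v =
  (ℤ.0ℤ ℤ.≤ u × ℤ.0ℤ ℤ.≤ v × ¬ (u ≡ 0ℤ × v ≡ 0ℤ))
  ⊎ (ℤ.0ℤ ℤ.< u × v ℤ.< ℤ.0ℤ × v ℤ.* v ℤ.* + d ℤ.< u ℤ.* u)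
  ⊎ (u ℤ.< ℤ.0ℤ × ℤ.0ℤ ℤ.< v × u ℤ.* u ℤ.< v ℤ.* v ℤ.* + d)

-- the real embedding: 2·(a + bω) = (2a + tr·b) + (2 − tr)·b·√d
PosO : ℕ → O → Set
PosO d (a , b) = PosSqrt d (+ 2 ℤ.* a ℤ.+ tr d ℤ.* b) ((+ 2 ℤ.- tr d) ℤ.* b)

-- r < α/β  (β ≠ 0) as real numbers, r = m/n with n > 0:
-- α/β − m/n has the sign of (nα − mβ)·β.
RatLtQuot : ℕ → ℚ → O → O → Set
RatLtQuot d r α β = PosO d (mulO d (subO (scaleO (↧ r) α) (scaleO (↥ r) β)) β)

QuotLtRat : ℕ → O → O → ℚ → Set
QuotLtRat d α β r = PosO d (mulO d (subO (scaleO (↥ r) β) (scaleO (↧ r) α)) β)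

{-# OPTIONS --safe #-}
-- A rational prime that is inert in O is a prime element, so it suffices to find inert primes P and Q with P / Q in a given interval
-- (a, b) with a > 1; the other intervals follow by inverting or negating the quotient.  Cut the half line into cells [ρ^i, ρ^(i+1))
-- and group these into blocks.  If no quotient lies in (a, b), then blocks at distance M or M + 1 do not both contain inert primes,
-- and since these distances form an odd cycle on 2M + 1 consecutive blocks, at most M of the 2M + 1 blocks contain inert primes.
-- Two estimates rule this out for large X.
--
-- (1) The inert P ≤ X have Σ log P / P ≥ (1/2 − ε) log X.  By Mertens, all primes together have log X, so the split primes must be
-- bounded by half of this.  Take the product of |x² − dy²| over all differences (x, y) of points of a square with n points.  For a split
-- p both linear factors of x² − dy² modulo p occur, and by the Cauchy–Schwarz inequality each is divisible by p for at least n²/p − n of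
-- the ordered pairs of distinct points.  Comparing with the size of the product gives the bound when n is a large multiple of X.
--
-- (2) A cell contributes at most (1 + ε) log ρ to this sum.  Euler's form of quadratic reciprocity (Gauss's lemma and a lattice point
-- count) confines inert primes to at most half of the unit classes modulo 4d, and Selberg's upper bound sieve applied to each class
-- bounds the number of primes in it by twice the expected number.
module Submission where

open import Data.Nat
open import Data.Nat.Properties
open import Data.Nat.DivMod
open import Data.Nat.Divisibility
open import Data.Nat.Primality
open import Data.Nat.Primality.Factorisation using (PrimeFactorisation; factorise)
open import Data.Nat.Coprimality using (Coprime)
import Data.Nat.Coprimality as Coprimality
open import Data.Nat.ListAction using (product)
open import Data.Nat.GCD using (gcd; gcd[m,n]≢0; gcd[m,n]∣m; gcd[m,n]∣n; module Bézout)
open import Data.Nat.Tactic.RingSolver using (solve-∀)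
open import Data.Integer using (ℤ)
import Data.Integer as ℤ
import Data.Integer.Properties as ℤₚ
open import Data.Integer.Divisibility.Signed using () renaming (_∣_ to _∣ℤ_)
import Data.Integer.Divisibility.Signed as ℤ∣
import Data.Integer.Tactic.RingSolver as ℤ-solver
open import Data.Rational as ℚ using (ℚ; ↥_; ↧_; ↧ₙ_)
open import Data.Product using (_×_; _,_; Σ; ∃; proj₁; proj₂)
open import Data.Sum using (_⊎_; inj₁; inj₂; [_,_]′)
open import Data.Empty using (⊥-elim)
open import Data.Unit using (tt)
open import Data.Bool using (true; false; if_then_else_)
import Data.Bool as Bool
open import Data.List using (List; []; _∷_)
open import Data.List.Relation.Unary.All using (All; []; _∷_)
import Data.List.Relation.Unary.All as All
open import Data.List.Relation.Unary.Any using (Any; here; there; any?)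
open import Relation.Nullary using (¬_; Dec; yes; no)
open import Relation.Nullary.Decidable using (_×-dec_; _→-dec_; ¬?; decidable-stable)
open import Relation.Binary.Definitions using (tri<; tri≈; tri>)
open import Relation.Binary.PropositionalEquality hiding (J)
open import Function using (_∘_; id)
open import Defs

-- Finite sums and indicators

-- The constants leave no room. The sieve loses a factor 2, which the restriction to half of the
-- classes compensates exactly; so with logarithms to the base ρ a cell carries mass about 1 at
-- most, while the inert primes up to X have mass about half of the number `ι X` of cells. Hence
-- about half of the cells, or more, are occupied. A single forbidden distance would still permit
-- exactly half. The odd cycle permits only M / (2M + 1), which is smaller by a fixed amount; the
-- interval determines M, and all errors are made small against 1 / (4M + 2) afterwards. The bound
-- 1/2 for the split primes arises because each of them is counted twice, once for each square root
-- of d, whereas the norms have size about n, a bounded multiple of X. Real numbers do not occur: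
-- logarithms are integers, inequalities are cleared of denominators, and each ε is some 1 / u or 1
-- / v. For a given X a finite search decides whether a suitable pair of primes up to X exists, so a
-- contradiction from its absence yields the pair constructively.

∑ : ℕ → (ℕ → ℕ) → ℕ
∑ zero    f = 0
∑ (suc n) f = ∑ n f + f n

⟦_⟧ : {P : Set} → Dec P → ℕ
⟦ yes _ ⟧ = 1
⟦ no  _ ⟧ = 0

⟦⟧-yes : {P : Set} (p? : Dec P) → P → ⟦ p? ⟧ ≡ 1
⟦⟧-yes (yes _) _ = refl
⟦⟧-yes (no ¬p) p = ⊥-elim (¬p p)

⟦⟧-no : {P : Set} (p? : Dec P) → ¬ P → ⟦ p? ⟧ ≡ 0
⟦⟧-no (no _)  _  = refl
⟦⟧-no (yes p) ¬p = ⊥-elim (¬p p)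

⟦⟧-mono : {P Q : Set} (p? : Dec P) (q? : Dec Q) → (P → Q) → ⟦ p? ⟧ ≤ ⟦ q? ⟧
⟦⟧-mono (no _)  q? f = z≤n
⟦⟧-mono (yes p) q? f = ≤-reflexive (sym (⟦⟧-yes q? (f p)))

⟦⟧-cong : {P Q : Set} (p? : Dec P) (q? : Dec Q) → (P → Q) → (Q → P) → ⟦ p? ⟧ ≡ ⟦ q? ⟧
⟦⟧-cong p? q? f g = ≤-antisym (⟦⟧-mono p? q? f) (⟦⟧-mono q? p? g)

⟦⟧≤1 : {P : Set} (p? : Dec P) → ⟦ p? ⟧ ≤ 1
⟦⟧≤1 (yes _) = ≤-refl
⟦⟧≤1 (no _)  = z≤n

∑-cong : ∀ n {f g} → (∀ i → i < n → f i ≡ g i) → ∑ n f ≡ ∑ n g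
∑-cong zero    h = refl
∑-cong (suc n) h = cong₂ _+_ (∑-cong n λ i i<n → h i (m<n⇒m<1+n i<n)) (h n ≤-refl)

∑-mono : ∀ n {f g} → (∀ i → i < n → f i ≤ g i) → ∑ n f ≤ ∑ n g
∑-mono zero    h = z≤n
∑-mono (suc n) h = +-mono-≤ (∑-mono n λ i i<n → h i (m<n⇒m<1+n i<n)) (h n ≤-refl)

∑-+ : ∀ n f g → ∑ n (λ i → f i + g i) ≡ ∑ n f + ∑ n g
∑-+ zero    f g = refl
∑-+ (suc n) f g = trans (cong (_+ (f n + g n)) (∑-+ n f g)) (shuffle (∑ n f) (∑ n g) (f n) (g n))
  where
  shuffle : ∀ a b c e → a + b + (c + e) ≡ a + c + (b + e)
  shuffle = solve-∀

∑-*ˡ : ∀ n c f → ∑ n (λ i → c * f i) ≡ c * ∑ n f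
∑-*ˡ zero    c f = sym (*-zeroʳ c)
∑-*ˡ (suc n) c f = trans (cong (_+ c * f n) (∑-*ˡ n c f)) (sym (*-distribˡ-+ c (∑ n f) (f n)))

∑-*ʳ : ∀ n c f → ∑ n (λ i → f i * c) ≡ ∑ n f * c
∑-*ʳ n c f = trans (∑-cong n λ i _ → *-comm (f i) c) (trans (∑-*ˡ n c f) (*-comm c (∑ n f)))

∑-const : ∀ n c → ∑ n (λ _ → c) ≡ n * c
∑-const zero    c = refl
∑-const (suc n) c = trans (cong (_+ c) (∑-const n c)) (+-comm (n * c) c)

∑-zero : ∀ n {f} → (∀ i → i < n → f i ≡ 0) → ∑ n f ≡ 0
∑-zero n h = trans (∑-cong n h) (trans (∑-const n 0) (*-zeroʳ n))

∑-swap : ∀ m n (f : ℕ → ℕ → ℕ) → ∑ m (λ i → ∑ n (f i)) ≡ ∑ n (λ j → ∑ m (λ i → f i j))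
∑-swap zero    n f = sym (∑-zero n λ _ _ → refl)
∑-swap (suc m) n f = trans (cong (_+ ∑ n (f m)) (∑-swap m n f)) (sym (∑-+ n _ (f m)))

∑-split : ∀ m n f → ∑ (m + n) f ≡ ∑ m f + ∑ n (λ i → f (m + i))
∑-split m zero    f = trans (cong (λ k → ∑ k f) (+-identityʳ m)) (sym (+-identityʳ _))
∑-split m (suc n) f = trans (cong (λ k → ∑ k f) (+-suc m n))
  (trans (cong (_+ f (m + n)) (∑-split m n f)) (+-assoc (∑ m f) _ _))

∑-extend : ∀ {m n} f → m ≤ n → ∑ m f ≤ ∑ n f
∑-extend {m} {n} f m≤n = subst (λ k → ∑ m f ≤ ∑ k f) (m+[n∸m]≡n m≤n)
  (≤-trans (m≤m+n _ _) (≤-reflexive (sym (∑-split m (n ∸ m) f))))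

∑-δ : ∀ n k (g : ℕ → ℕ) → k < n → ∑ n (λ i → ⟦ i ≟ k ⟧ * g i) ≡ g k
∑-δ (suc n) k g k<1+n with n ≟ k
... | yes refl = trans (cong (_+ (g n + 0)) (∑-zero n λ i i<n → cong (_* g i) (⟦⟧-no (i ≟ n) (<⇒≢ i<n)))) (+-identityʳ (g n))
... | no n≢k = trans (+-identityʳ _) (∑-δ n k g (≤∧≢⇒< (s≤s⁻¹ k<1+n) (n≢k ∘ sym)))

∑-term : ∀ n k f → k < n → f k ≤ ∑ n f
∑-term (suc n) k f k<1+n with n ≟ k
... | yes refl = m≤n+m (f n) _
... | no n≢k = ≤-trans (∑-term n k f (≤∧≢⇒< (s≤s⁻¹ k<1+n) (n≢k ∘ sym))) (m≤m+n _ _)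

∑-bij : ∀ n (φ ψ : ℕ → ℕ) (g : ℕ → ℕ) → (∀ i → i < n → φ i < n) → (∀ i → i < n → ψ i < n) →
  (∀ i → i < n → ψ (φ i) ≡ i) → (∀ i → i < n → φ (ψ i) ≡ i) → ∑ n (λ i → g (φ i)) ≡ ∑ n g
∑-bij n φ ψ g φ< ψ< ψφ φψ = begin
  ∑ n (λ i → g (φ i))                       ≡⟨ ∑-cong n (λ i i<n → sym (∑-δ n (φ i) g (φ< i i<n))) ⟩
  ∑ n (λ i → ∑ n (λ j → ⟦ j ≟ φ i ⟧ * g j)) ≡⟨ ∑-swap n n _ ⟩
  ∑ n (λ j → ∑ n (λ i → ⟦ j ≟ φ i ⟧ * g j)) ≡⟨ ∑-cong n (λ j j<n → ∑-cong n λ i i<n → cong (_* g j) (⟦⟧-cong (j ≟ φ i) (i ≟ ψ j)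
      (λ e → trans (sym (ψφ i i<n)) (cong ψ (sym e))) (λ e → trans (sym (φψ j j<n)) (cong φ (sym e))))) ⟩
  ∑ n (λ j → ∑ n (λ i → ⟦ i ≟ ψ j ⟧ * g j)) ≡⟨ ∑-cong n (λ j j<n → ∑-δ n (ψ j) (λ _ → g j) (ψ< j j<n)) ⟩
  ∑ n g ∎
  where open ≡-Reasoning

-- To derive a ≤ b from x ≤ y it suffices to check an identity.
lin : ∀ {x y} → x ≤ y → ∀ {a b} e → a + y + e ≡ b + x → a ≤ b
lin {x} {y} x≤y {a} {b} e eq = +-cancelʳ-≤ y a b (≤-trans (m≤m+n (a + y) e) (≤-trans (≤-reflexive eq) (+-monoʳ-≤ b x≤y)))

-- Logarithms to the base ρ

module Greatest {P : ℕ → Set} (P? : ∀ n → Dec (P n)) where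

  greatest : ℕ → ℕ
  greatest zero    = 0
  greatest (suc k) with P? (suc k)
  ... | yes _ = suc k
  ... | no  _ = greatest k

  greatest-holds : ∀ k → P 0 → P (greatest k)
  greatest-holds zero    p₀ = p₀
  greatest-holds (suc k) p₀ with P? (suc k)
  ... | yes p = p
  ... | no  _ = greatest-holds k p₀

  greatest-max : ∀ k i → i ≤ k → P i → i ≤ greatest k
  greatest-max zero    i i≤0 _ = i≤0
  greatest-max (suc k) i i≤1+k p with P? (suc k)
  ... | yes _ = i≤1+k
  ... | no ¬p = greatest-max k i (s≤s⁻¹ (≤∧≢⇒< i≤1+k λ { refl → ¬p p })) p

bernoulli : ∀ r k → r ^ k * (r + k) ≤ suc r ^ k * r
bernoulli r zero    = ≤-reflexive (cong (_+ 0) (+-identityʳ r))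
bernoulli r (suc k) = lin (*-monoʳ-≤ (suc r) (bernoulli r k)) (r ^ k * k) (identity r k (r ^ k) (suc r ^ k))
  where
  identity : ∀ r k u v → r * u * (r + suc k) + suc r * (v * r) + u * k ≡ suc r * v * r + suc r * (u * (r + k))
  identity = solve-∀

-- ι n is the integer part of the logarithm of n in base ρ = (R + 1) / R.
module Logarithm (R : ℕ) .{{_ : NonZero R}} where

  A : ℕ
  A = suc R

  module G (n : ℕ) = Greatest (λ i → A ^ i ≤? n * R ^ i)

  private
    -- By Bernoulli 1 + i / R ≤ ρ^i ≤ n, so `n * R` is a sufficient limit for the search that
    -- defines `ι`.
    bound : ∀ n i → A ^ i ≤ n * R ^ i → i ≤ n * R
    bound n i p = +-cancelˡ-≤ R i (n * R) (≤-trans (*-cancelˡ-≤ (R ^ i) {{>-nonZero (m^n>0 R i)}}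
        (≤-trans (bernoulli R i) (≤-trans (*-monoˡ-≤ R p) (≤-reflexive (identity n (R ^ i) R))))) (m≤n+m (n * R) R))
      where
      identity : ∀ n u r → n * u * r ≡ u * (n * r)
      identity = solve-∀

  abstract
    ι : ℕ → ℕ
    ι n = G.greatest n (n * R)

    ι-lower : ∀ n → 1 ≤ n → A ^ ι n ≤ n * R ^ ι n
    ι-lower n 1≤n = G.greatest-holds n (n * R) (≤-trans 1≤n (≤-reflexive (sym (*-identityʳ n))))

    ι-max : ∀ n i → A ^ i ≤ n * R ^ i → i ≤ ι n
    ι-max n i p = G.greatest-max n (n * R) i (bound n i p) p

  R^>0 : ∀ k → 0 < R ^ k
  R^>0 k = m^n>0 R k

  A^>0 : ∀ k → 0 < A ^ k
  A^>0 k = m^n>0 A k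

  R^≤A^ : ∀ k → R ^ k ≤ A ^ k
  R^≤A^ k = ^-monoˡ-≤ k (n≤1+n R)

  ι-upper : ∀ n k → ι n < k → n * R ^ k < A ^ k
  ι-upper n k ιn<k = ≰⇒> λ p → <⇒≱ ιn<k (ι-max n k p)

  ratio-mono : ∀ n i j → i ≤ j → A ^ j ≤ n * R ^ j → A ^ i ≤ n * R ^ i
  ratio-mono n i j i≤j p = *-cancelʳ-≤ (A ^ i) (n * R ^ i) (A ^ (j ∸ i)) {{>-nonZero (A^>0 (j ∸ i))}} (begin
    A ^ i * A ^ (j ∸ i)       ≡⟨ ^-distribˡ-+-* A i (j ∸ i) ⟨
    A ^ (i + (j ∸ i))         ≡⟨ cong (A ^_) (m+[n∸m]≡n i≤j) ⟩
    A ^ j                     ≤⟨ p ⟩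
    n * R ^ j                 ≡⟨ cong (λ e → n * R ^ e) (m+[n∸m]≡n i≤j) ⟨
    n * R ^ (i + (j ∸ i))     ≡⟨ cong (n *_) (^-distribˡ-+-* R i (j ∸ i)) ⟩
    n * (R ^ i * R ^ (j ∸ i)) ≡⟨ *-assoc n _ _ ⟨
    n * R ^ i * R ^ (j ∸ i)   ≤⟨ *-monoʳ-≤ (n * R ^ i) (R^≤A^ (j ∸ i)) ⟩
    n * R ^ i * A ^ (j ∸ i)   ∎)
    where open ≤-Reasoning

  ι-lt : ∀ n k → 1 ≤ n → n * R ^ k < A ^ k → ι n < k
  ι-lt n k 1≤n p = ≰⇒> λ k≤ιn → <⇒≱ p (ratio-mono n k (ι n) k≤ιn (ι-lower n 1≤n))

  ι-mono : ∀ {m n} → 1 ≤ m → m ≤ n → ι m ≤ ι n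
  ι-mono {m} {n} 1≤m m≤n = ι-max n (ι m) (≤-trans (ι-lower m 1≤m) (*-monoˡ-≤ _ m≤n))

  -- `A ^ i ≤ n * R ^ i` means ρ^i ≤ n, and such inequalities multiply. Rounding down makes `ι`
  -- superadditive; `ι-sub` limits the loss to one unit per product.
  ι-super : ∀ m n → 1 ≤ m → 1 ≤ n → ι m + ι n ≤ ι (m * n)
  ι-super m n 1≤m 1≤n = ι-max (m * n) (ι m + ι n) (begin
    A ^ (ι m + ι n)                 ≡⟨ ^-distribˡ-+-* A (ι m) (ι n) ⟩
    A ^ ι m * A ^ ι n               ≤⟨ *-mono-≤ (ι-lower m 1≤m) (ι-lower n 1≤n) ⟩
    m * R ^ ι m * (n * R ^ ι n)     ≡⟨ identity m n (R ^ ι m) (R ^ ι n) ⟩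
    m * n * (R ^ ι m * R ^ ι n)     ≡⟨ cong (m * n *_) (^-distribˡ-+-* R (ι m) (ι n)) ⟨
    m * n * R ^ (ι m + ι n)         ∎)
    where
    open ≤-Reasoning
    identity : ∀ m n u v → m * u * (n * v) ≡ m * n * (u * v)
    identity = solve-∀

  ι-sub : ∀ m n → 1 ≤ m → 1 ≤ n → ι (m * n) ≤ suc (ι m) + ι n
  ι-sub m n 1≤m 1≤n = s≤s⁻¹ (≤-trans (ι-lt (m * n) (suc (ι m) + suc (ι n)) (*-mono-≤ 1≤m 1≤n) (begin-strict
    m * n * R ^ (suc (ι m) + suc (ι n))             ≡⟨ cong (m * n *_) (^-distribˡ-+-* R (suc (ι m)) (suc (ι n))) ⟩
    m * n * (R ^ suc (ι m) * R ^ suc (ι n))         ≡⟨ identity m n (R ^ suc (ι m)) (R ^ suc (ι n)) ⟩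
    m * R ^ suc (ι m) * (n * R ^ suc (ι n))         <⟨ *-mono-< (ι-upper m _ ≤-refl) (ι-upper n _ ≤-refl) ⟩
    A ^ suc (ι m) * A ^ suc (ι n)                   ≡⟨ ^-distribˡ-+-* A (suc (ι m)) (suc (ι n)) ⟨
    A ^ (suc (ι m) + suc (ι n))                     ∎)) (≤-reflexive (+-suc (suc (ι m)) (ι n))))
    where
    open ≤-Reasoning
    identity : ∀ m n u v → m * n * (u * v) ≡ m * u * (n * v)
    identity = solve-∀

  ι-pow : ∀ n k → 1 ≤ n → ι (n ^ k) ≤ k * suc (ι n)
  ι-pow n zero    1≤n = s≤s⁻¹ (ι-lt 1 1 ≤-refl (≤-reflexive (cong suc (+-identityʳ _))))
  ι-pow n (suc k) 1≤n = ≤-trans (ι-sub n (n ^ k) 1≤n (m^n>0 n {{>-nonZero 1≤n}} k)) (+-monoʳ-≤ (suc (ι n)) (ι-pow n k 1≤n))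

  ι-pow-super : ∀ n k → 1 ≤ n → k * ι n ≤ ι (n ^ k)
  ι-pow-super n zero    1≤n = z≤n
  ι-pow-super n (suc k) 1≤n = ≤-trans (+-monoʳ-≤ (ι n) (ι-pow-super n k 1≤n)) (ι-super n (n ^ k) 1≤n (m^n>0 n {{>-nonZero 1≤n}} k))

  ι1≡0 : ι 1 ≡ 0
  ι1≡0 = n≤0⇒n≡0 (ι-pow 1 0 ≤-refl)

  ι-A^ : ∀ k → k ≤ ι (A ^ k)
  ι-A^ k = ι-max (A ^ k) k (m≤m*n (A ^ k) (R ^ k) {{>-nonZero (R^>0 k)}})

  ι-large : ∀ k n → A ^ k ≤ n → k ≤ ι n
  ι-large k n p = ≤-trans (ι-A^ k) (ι-mono (A^>0 k) p)

-- Mertens' estimate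

-- The exponent of a prime p in n, counted through the powers of p that divide n; for n ≥ 1 it is
-- exact once n < p^(J + 1).
val : ℕ → ℕ → ℕ → ℕ
val J p n = ∑ J λ j → ⟦ p ^ suc j ∣? n ⟧

∑-head : ∀ n f → ∑ (suc n) f ≡ f 0 + ∑ n (λ i → f (suc i))
∑-head n f = ∑-split 1 n f

n<p^n : ∀ p n → 2 ≤ p → n < p ^ n
n<p^n p zero    2≤p = s≤s z≤n
n<p^n p (suc n) 2≤p = begin-strict
  suc n         <⟨ s≤s (n<p^n p n 2≤p) ⟩
  suc (p ^ n)   ≤⟨ +-monoˡ-≤ (p ^ n) (m^n>0 p {{>-nonZero (≤-trans (s≤s z≤n) 2≤p)}} n) ⟩
  p ^ n + p ^ n ≡⟨ cong (p ^ n +_) (+-identityʳ (p ^ n)) ⟨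
  2 * p ^ n     ≤⟨ *-monoˡ-≤ (p ^ n) 2≤p ⟩
  p * p ^ n     ∎
  where open ≤-Reasoning

-- Multiplication by p shifts the divisibility conditions by one place. The condition at the last
-- place fails for n by size, so nothing is lost at the truncation.
val-*-self : ∀ J p n → 2 ≤ p → 1 ≤ n → n < p ^ suc J → suc (val (suc J) p n) ≤ val (suc J) p (p * n)
val-*-self J p n 2≤p 1≤n n<p^ = ≤-reflexive (begin
  suc (val J p n + ⟦ p ^ suc J ∣? n ⟧)                       ≡⟨ cong (λ e → suc (val J p n + e)) (⟦⟧-no (p ^ suc J ∣? n) λ d → <⇒≱ n<p^ (∣⇒≤ {{>-nonZero 1≤n}} d)) ⟩
  suc (val J p n + 0)                                        ≡⟨ cong suc (+-identityʳ _) ⟩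
  1 + ∑ J (λ j → ⟦ p ^ suc j ∣? n ⟧)                         ≡⟨ cong₂ _+_ (⟦⟧-yes (p ^ 1 ∣? p * n) (subst (_∣ p * n) (sym (*-identityʳ p)) (m∣m*n n)))
                                                                 (∑-cong J λ j _ → ⟦⟧-cong (p ^ suc (suc j) ∣? p * n) (p ^ suc j ∣? n) (*-cancelˡ-∣ p) (*-monoʳ-∣ p)) ⟨
  ⟦ p ^ 1 ∣? p * n ⟧ + ∑ J (λ j → ⟦ p ^ suc (suc j) ∣? p * n ⟧) ≡⟨ ∑-head J (λ j → ⟦ p ^ suc j ∣? p * n ⟧) ⟨
  val (suc J) p (p * n)                                      ∎)
  where
  open ≡-Reasoning
  instance _ = >-nonZero (≤-trans (s≤s z≤n) 2≤p)

val-∣ : ∀ J p {m n} → m ∣ n → val J p m ≤ val J p n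
val-∣ J p {m} {n} m∣n = ∑-mono J λ j _ → ⟦⟧-mono (p ^ suc j ∣? m) (p ^ suc j ∣? n) (λ d → ∣-trans d m∣n)

multiples : ℕ → ℕ → ℕ
multiples m X = ∑ X λ n → ⟦ m ∣? suc n ⟧

multiples-bounds : ∀ m X → 1 ≤ m → multiples m X * m ≤ X × X < suc (multiples m X) * m
multiples-bounds m zero    1≤m = z≤n , ≤-trans 1≤m (m≤m+n m 0)
multiples-bounds m (suc X) 1≤m with m ∣? suc X | multiples-bounds m X 1≤m
... | no ¬d | lo , hi = subst (λ c → c * m ≤ suc X × suc X < suc c * m) (sym (+-identityʳ (multiples m X)))
        (≤-trans lo (n≤1+n X) , ≤∧≢⇒< hi λ e → ¬d (divides (suc (multiples m X)) e))
... | yes (divides k e) | lo , hi = subst (λ c → c * m ≤ suc X × suc X < suc c * m) k≡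
        (≤-reflexive (sym e) , subst (_< m + k * m) (sym e) (m<n+m (k * m) 1≤m))
  where
  k≡ : k ≡ multiples m X + 1
  k≡ = trans (≤-antisym (*-cancelʳ-≤ k (suc (multiples m X)) m {{>-nonZero 1≤m}} (subst (_≤ suc (multiples m X) * m) e hi))
                        (*-cancelʳ-< m (multiples m X) k (subst (multiples m X * m <_) e (s≤s lo)))) (+-comm 1 _)

multiples-* : ∀ p m X → 1 ≤ p → 1 ≤ m → p * multiples (p * m) X ≤ multiples m X
multiples-* p m X 1≤p 1≤m = s≤s⁻¹ (*-cancelʳ-< m (p * multiples (p * m) X) (suc (multiples m X)) (begin-strict
  p * multiples (p * m) X * m   ≡⟨ identity p (multiples (p * m) X) m ⟩
  multiples (p * m) X * (p * m) ≤⟨ proj₁ (multiples-bounds (p * m) X (*-mono-≤ 1≤p 1≤m)) ⟩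
  X                             <⟨ proj₂ (multiples-bounds m X 1≤m) ⟩
  suc (multiples m X) * m       ∎))
  where
  open ≤-Reasoning
  identity : ∀ p c m → p * c * m ≡ c * (p * m)
  identity = solve-∀

-- For a prime p this is the exponent of p in X!, and it takes the place of X / p in Mertens' sums.
vals : ℕ → ℕ → ℕ
vals X p = ∑ X λ n → val X p (suc n)

-- Let q = p + 1 and let c j be the number of multiples of q^j up to X. From q · c (j + 1) ≤ c j
-- follows p · c (j + 1) ≤ c j - c (j + 1), and these differences add up to at most c 0 ≤ X.
vals-bound : ∀ X p → 2 ≤ suc p → p * vals X (suc p) ≤ X
vals-bound X p 2≤p = ≤-trans (≤-reflexive (cong (p *_) (∑-swap X X _))) (≤-trans (m≤m+n _ _) (telescope X))
  where
  c : ℕ → ℕ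
  c j = multiples (suc p ^ j) X
  telescope : ∀ J → p * ∑ J (λ j → c (suc j)) + c J ≤ X
  telescope zero    = ≤-trans (≤-reflexive (trans (cong (_+ c 0) (*-zeroʳ p)) (sym (*-identityʳ _)))) (proj₁ (multiples-bounds 1 X ≤-refl))
  telescope (suc J) = lin (+-mono-≤ (telescope J) (multiples-* (suc p) (suc p ^ J) X (s≤s z≤n) (m^n>0 (suc p) J))) 0
    (identity p (∑ J (λ j → c (suc j))) (c J) (c (suc J)) X)
    where
    identity : ∀ p s u v X → p * (s + v) + v + (X + u) + 0 ≡ X + (p * s + u + suc p * v)
    identity = solve-∀

count-multiples : ∀ s Y X → (∑ X λ n → ⟦ suc n * s ≤? Y ⟧) ≤ X × (∑ X λ n → ⟦ suc n * s ≤? Y ⟧) * s ≤ Y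
count-multiples s Y zero    = z≤n , z≤n
count-multiples s Y (suc X) with suc X * s ≤? Y | count-multiples s Y X
... | no _  | l , m = subst (λ c → c ≤ suc X × c * s ≤ Y) (sym (+-identityʳ _)) (m≤n⇒m≤1+n l , m)
... | yes p | l , m = subst (λ c → c ≤ suc X × c * s ≤ Y) (+-comm 1 _) (s≤s l , ≤-trans (*-monoˡ-≤ s (s≤s l)) p)

module Mertens (R : ℕ) .{{_ : NonZero R}} where
  open Logarithm R

  -- A weak form of Stirling's lower bound for log X!. Numbers n > X / s have logarithm at least
  -- `ι X` - `ι s` - 1, and the at most X / s others cost at most `ι X` each; so a fraction 1 / s of
  -- the main term is given away.
  ∑ι-upper : ∀ s X → 1 ≤ s → 1 ≤ X → s * (X * ι X) ≤ s * ∑ X (λ n → ι (suc n)) + (s * (X * suc (ι s)) + X * ι X)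
  ∑ι-upper s X 1≤s 1≤X = begin
    s * (X * ι X)                                   ≡⟨ cong (s *_) (∑-const X (ι X)) ⟨
    s * ∑ X (λ _ → ι X)                             ≤⟨ *-monoʳ-≤ s (∑-mono X λ n _ → step n) ⟩
    s * ∑ X (λ n → ι (suc n) + (suc (ι s) + far n * ι X))
      ≡⟨ cong (s *_) (trans (∑-+ X _ _) (cong (∑ X (λ n → ι (suc n)) +_) (trans (∑-+ X _ _) (cong₂ _+_ (∑-const X _) (∑-*ʳ X (ι X) far))))) ⟩
    s * (∑ X (λ n → ι (suc n)) + (X * suc (ι s) + ∑ X far * ι X)) ≤⟨ lin (*-monoˡ-≤ (ι X) (proj₂ (count-multiples s X X))) 0 (identity s (∑ X (λ n → ι (suc n))) X (ι s) (∑ X far) (ι X)) ⟩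
    s * ∑ X (λ n → ι (suc n)) + (s * (X * suc (ι s)) + X * ι X) ∎
    where
    open ≤-Reasoning
    far : ℕ → ℕ
    far n = ⟦ suc n * s ≤? X ⟧
    identity : ∀ s u X i f j → s * (u + (X * suc i + f * j)) + X * j + 0 ≡ s * u + (s * (X * suc i) + X * j) + f * s * j
    identity = solve-∀
    step : ∀ n → ι X ≤ ι (suc n) + (suc (ι s) + far n * ι X)
    step n with suc n * s ≤? X
    ... | yes _ = ≤-trans (≤-reflexive (sym (+-identityʳ (ι X)))) (≤-trans (m≤n+m (ι X + 0) (suc (ι s))) (m≤n+m _ (ι (suc n))))
    ... | no ¬p = ≤-trans (ι-mono 1≤X (<⇒≤ (≰⇒> ¬p))) (≤-trans (ι-sub (suc n) s (s≤s z≤n) 1≤s)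
                    (≤-reflexive (identity′ (ι (suc n)) (ι s))))
      where
      identity′ : ∀ a b → suc a + b ≡ a + (suc b + 0)
      identity′ = solve-∀

  -- The `suc` absorbs the unit that `ι-sub` loses for each prime factor in `ι-factor`.
  weight : ℕ → ℕ → ℕ
  weight p v = ⟦ prime? p ⟧ * (suc (ι p) * v)

  ι-factor : ∀ X ps → All Prime ps → product ps ≤ suc X → ι (product ps) ≤ ∑ (suc (suc X)) (λ p → weight p (val (suc X) p (product ps)))
  ι-factor X []       []        _ = ≤-trans (≤-reflexive ι1≡0) z≤n
  ι-factor X (q ∷ ps) (pq ∷ pps) q*n≤X = begin
    ι (q * n)                                              ≤⟨ ι-sub q n (≤-trans (s≤s z≤n) 2≤q) 1≤n ⟩
    suc (ι q) + ι n                                        ≤⟨ +-monoʳ-≤ (suc (ι q)) (ι-factor X ps pps (≤-trans n≤q*n q*n≤X)) ⟩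
    suc (ι q) + ∑ N (λ p → weight p (val (suc X) p n))     ≡⟨ cong₂ _+_ (∑-δ N q (λ p → suc (ι p)) (s≤s (≤-trans q≤q*n q*n≤X))) refl ⟨
    ∑ N (λ p → ⟦ p ≟ q ⟧ * suc (ι p)) + ∑ N (λ p → weight p (val (suc X) p n)) ≡⟨ ∑-+ N _ _ ⟨
    ∑ N (λ p → ⟦ p ≟ q ⟧ * suc (ι p) + weight p (val (suc X) p n)) ≤⟨ ∑-mono N (λ p _ → step p) ⟩
    ∑ N (λ p → weight p (val (suc X) p (q * n)))           ∎
    where
    open ≤-Reasoning
    N = suc (suc X)
    n = product ps
    1≤n : 1 ≤ n
    1≤n = productOfPrimes≥1 pps
    2≤q : 2 ≤ q
    2≤q = nonTrivial⇒n>1 q {{prime⇒nonTrivial pq}}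
    n≤q*n : n ≤ q * n
    n≤q*n = m≤n*m n q {{prime⇒nonZero pq}}
    q≤q*n : q ≤ q * n
    q≤q*n = m≤m*n q n {{>-nonZero 1≤n}}
    step : ∀ p → ⟦ p ≟ q ⟧ * suc (ι p) + weight p (val (suc X) p n) ≤ weight p (val (suc X) p (q * n))
    step p with p ≟ q
    ... | no _ = *-monoʳ-≤ ⟦ prime? p ⟧ (*-monoʳ-≤ (suc (ι p)) (val-∣ (suc X) p (n∣m*n q)))
    ... | yes refl rewrite ⟦⟧-yes (prime? p) pq = lin (*-monoʳ-≤ (suc (ι p)) (val-*-self X p n 2≤q 1≤n
            (≤-<-trans (≤-trans n≤q*n q*n≤X) (n<p^n p (suc X) 2≤q)))) 0 (identity (suc (ι p)) (val (suc X) p n) (val (suc X) p (p * n)))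
      where
      identity : ∀ i v w → 1 * i + 1 * (i * v) + i * w + 0 ≡ 1 * (i * w) + i * suc v
      identity = solve-∀

  ∑ι-factor : ∀ X → ∑ X (λ n → ι (suc n)) ≤ ∑ (suc X) (λ p → weight p (vals X p))
  ∑ι-factor zero    = z≤n
  ∑ι-factor (suc X) = begin
    ∑ (suc X) (λ n → ι (suc n))                                       ≤⟨ ∑-mono (suc X) step ⟩
    ∑ (suc X) (λ n → ∑ N (λ p → weight p (val (suc X) p (suc n))))    ≡⟨ ∑-swap (suc X) N _ ⟩
    ∑ N (λ p → ∑ (suc X) (λ n → weight p (val (suc X) p (suc n))))    ≡⟨ ∑-cong N (λ p _ → trans (∑-*ˡ (suc X) ⟦ prime? p ⟧ _) (cong (⟦ prime? p ⟧ *_) (∑-*ˡ (suc X) (suc (ι p)) _))) ⟩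
    ∑ N (λ p → weight p (vals (suc X) p))                             ∎
    where
    open ≤-Reasoning
    N = suc (suc X)
    step : ∀ n → n < suc X → ι (suc n) ≤ ∑ N (λ p → weight p (val (suc X) p (suc n)))
    step n n<X = subst (λ m → ι m ≤ ∑ N (λ p → weight p (val (suc X) p m))) (sym (PrimeFactorisation.isFactorisation f))
      (ι-factor X (PrimeFactorisation.factors f) (PrimeFactorisation.factorsPrime f) (subst (_≤ suc X) (PrimeFactorisation.isFactorisation f) n<X))
      where f = factorise (suc n)

-- Split primes

prime≥2 : ∀ {p} → Prime p → 2 ≤ p
prime≥2 {p} pp = nonTrivial⇒n>1 p {{prime⇒nonTrivial pp}}

prime∣prime : ∀ {p q} → Prime p → Prime q → p ∣ q → p ≡ q
prime∣prime pp pq p∣q with prime⇒irreducible pq p∣q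
... | inj₁ refl = ⊥-elim (<-irrefl refl (prime≥2 pp))
... | inj₂ e    = e

prime∣^ : ∀ {p} m e → Prime p → p ∣ m ^ e → p ∣ m
prime∣^ m zero    pp d = ⊥-elim (<⇒≱ (prime≥2 pp) (∣⇒≤ d))
prime∣^ m (suc e) pp d with euclidsLemma m (m ^ e) pp d
... | inj₁ x = x
... | inj₂ y = prime∣^ m e pp y

prime-power-cancel : ∀ {k} m w e → Prime k → ¬ (k ∣ m) → k ^ e ∣ m * w → k ^ e ∣ w
prime-power-cancel         m w zero    pk k∤m d = 1∣ w
prime-power-cancel {k} m w (suc e) pk k∤m d with euclidsLemma m w pk (∣-trans (m∣m*n (k ^ e)) d)
... | inj₁ k∣m = ⊥-elim (k∤m k∣m)
... | inj₂ (divides w′ refl) = subst (k * k ^ e ∣_) (*-comm k w′) (*-monoʳ-∣ k (prime-power-cancel m w′ e pk k∤m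
        (*-cancelˡ-∣ k {{prime⇒nonZero pk}} (subst (k * k ^ e ∣_) (identity m w′ k) d))))
  where
  identity : ∀ m w k → m * (w * k) ≡ k * (m * w)
  identity = solve-∀

-- If powers of distinct primes divide V, so does their product, whence Σ ι p · E p ≤ ι V. Exponents
-- zero outside the relevant primes let E be a function on all natural numbers.
module PrimePowers (R : ℕ) .{{_ : NonZero R}} (V : ℕ) (E : ℕ → ℕ) where
  open Logarithm R

  primePart : ℕ → ℕ
  primePart zero    = 1
  primePart (suc p) = primePart p * p ^ E p

  Admissible : ℕ → Set
  Admissible N = ∀ p → p < N → (E p ≡ 0) ⊎ (Prime p × p ^ E p ∣ V)

  primePart-support : ∀ N q → Admissible N → Prime q → q ∣ primePart N → q < N
  primePart-support zero    q h pq d = ⊥-elim (<⇒≱ (prime≥2 pq) (∣⇒≤ d))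
  primePart-support (suc p) q h pq d with euclidsLemma (primePart p) (p ^ E p) pq d
  ... | inj₁ x = m<n⇒m<1+n (primePart-support p q (λ r r<p → h r (m<n⇒m<1+n r<p)) pq x)
  ... | inj₂ y with h p ≤-refl
  ...   | inj₁ e       = ⊥-elim (<⇒≱ (prime≥2 pq) (∣⇒≤ (subst (λ k → q ∣ p ^ k) e y)))
  ...   | inj₂ (pp , _) = s≤s (≤-reflexive (prime∣prime pq pp (prime∣^ p (E p) pq y)))

  primePart-∣ : ∀ N → Admissible N → primePart N ∣ V
  primePart-∣ zero    h = 1∣ V
  primePart-∣ (suc p) h with primePart-∣ p (λ r r<p → h r (m<n⇒m<1+n r<p)) | h p ≤-refl
  ... | d | inj₁ e = subst (_∣ V) (sym (trans (cong (λ k → primePart p * p ^ k) e) (*-identityʳ (primePart p)))) d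
  ... | divides w eq | inj₂ (pp , p^∣V) = subst (primePart p * p ^ E p ∣_) (sym (trans eq (*-comm w _))) (*-monoʳ-∣ (primePart p)
         (prime-power-cancel (primePart p) w (E p) pp (λ d → <-irrefl refl (primePart-support p p (λ r r<p → h r (m<n⇒m<1+n r<p)) pp d))
            (subst (p ^ E p ∣_) (trans eq (*-comm w _)) p^∣V)))

  primePart>0 : ∀ N → Admissible N → 1 ≤ primePart N
  primePart>0 zero    h = ≤-refl
  primePart>0 (suc p) h with primePart>0 p (λ r r<p → h r (m<n⇒m<1+n r<p)) | h p ≤-refl
  ... | pos | inj₁ e = subst (1 ≤_) (sym (trans (cong (λ k → primePart p * p ^ k) e) (*-identityʳ (primePart p)))) pos
  ... | pos | inj₂ (pp , _) = *-mono-≤ pos (m^n>0 p {{prime⇒nonZero pp}} (E p))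

  ∑ι-primePart : ∀ N → Admissible N → ∑ N (λ p → ι p * E p) ≤ ι (primePart N)
  ∑ι-primePart zero    h = z≤n
  ∑ι-primePart (suc p) h with h p ≤-refl
  ... | inj₁ e = subst₂ _≤_ (trans (sym (+-identityʳ (∑ p (λ p → ι p * E p)))) (cong (∑ p (λ p → ι p * E p) +_) (sym (trans (cong (ι p *_) e) (*-zeroʳ (ι p))))))
        (cong ι (sym (trans (cong (λ k → primePart p * p ^ k) e) (*-identityʳ (primePart p))))) (∑ι-primePart p λ r r<p → h r (m<n⇒m<1+n r<p))
  ... | inj₂ (pp , _) = ≤-trans (+-mono-≤ (∑ι-primePart p h′) (≤-trans (≤-reflexive (*-comm (ι p) (E p))) (ι-pow-super p (E p) 1≤p)))
        (ι-super (primePart p) (p ^ E p) (primePart>0 p h′) (m^n>0 p {{prime⇒nonZero pp}} (E p)))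
    where
    1≤p : 1 ≤ p
    1≤p = ≤-trans (s≤s z≤n) (prime≥2 pp)
    h′ : Admissible p
    h′ r r<p = h r (m<n⇒m<1+n r<p)

  ∑ι-exponents : ∀ N → 1 ≤ V → Admissible N → ∑ N (λ p → ι p * E p) ≤ ι V
  ∑ι-exponents N 1≤V h = ≤-trans (∑ι-primePart N h) (ι-mono (primePart>0 N h) (∣⇒≤ {{>-nonZero 1≤V}} (primePart-∣ N h)))

2mn≤m²+n² : ∀ m n → 2 * (m * n) ≤ m * m + n * n
2mn≤m²+n² m n with ≤-total m n
... | inj₁ m≤n = subst (λ k → 2 * (m * k) ≤ m * m + k * k) (m+[n∸m]≡n m≤n) (lin z≤n ((n ∸ m) * (n ∸ m)) (identity m (n ∸ m)))
  where
  identity : ∀ m e → 2 * (m * (m + e)) + 0 + e * e ≡ m * m + (m + e) * (m + e) + 0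
  identity = solve-∀
... | inj₂ n≤m = subst (λ k → 2 * (k * n) ≤ k * k + n * n) (m+[n∸m]≡n n≤m) (lin z≤n ((m ∸ n) * (m ∸ n)) (identity n (m ∸ n)))
  where
  identity : ∀ n e → 2 * ((n + e) * n) + 0 + e * e ≡ (n + e) * (n + e) + n * n + 0
  identity = solve-∀

∑-*-∑ : ∀ m n f g → ∑ m f * ∑ n g ≡ ∑ m (λ i → ∑ n (λ j → f i * g j))
∑-*-∑ m n f g = trans (sym (∑-*ʳ m (∑ n g) f)) (∑-cong m λ i _ → sym (∑-*ˡ n (f i) g))

cauchy-schwarz : ∀ p f → ∑ p f * ∑ p f ≤ p * ∑ p (λ x → f x * f x)
cauchy-schwarz p f = *-cancelˡ-≤ 2 (begin
  2 * (∑ p f * ∑ p f)                                     ≡⟨ cong (2 *_) (∑-*-∑ p p f f) ⟩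
  2 * ∑ p (λ x → ∑ p (λ y → f x * f y))                   ≡⟨ trans (∑-cong p λ x _ → ∑-*ˡ p 2 _) (∑-*ˡ p 2 _) ⟨
  ∑ p (λ x → ∑ p (λ y → 2 * (f x * f y)))                 ≤⟨ ∑-mono p (λ x _ → ∑-mono p λ y _ → 2mn≤m²+n² (f x) (f y)) ⟩
  ∑ p (λ x → ∑ p (λ y → f x * f x + f y * f y))           ≡⟨ ∑-cong p (λ x _ → trans (∑-+ p _ _) (cong (_+ S) (∑-const p (f x * f x)))) ⟩
  ∑ p (λ x → p * (f x * f x) + S)                         ≡⟨ trans (∑-+ p _ _) (cong₂ _+_ (∑-*ˡ p p _) (∑-const p S)) ⟩
  p * S + p * S                                           ≡⟨ cong (p * S +_) (+-identityʳ (p * S)) ⟨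
  2 * (p * S)                                             ∎)
  where
  open ≤-Reasoning
  S = ∑ p (λ x → f x * f x)

-- The fibres of c have total size n, and their squares count the pairs with equal values: n points
-- in p classes coincide at least as often as if they were spread evenly.
coincidences : ∀ n p (c : ℕ → ℕ) → (∀ i → c i < p) → n * n ≤ p * ∑ n (λ i → ∑ n (λ j → ⟦ c i ≟ c j ⟧))
coincidences n p c c<p = begin
  n * n                                        ≡⟨ cong₂ _*_ total total ⟩
  ∑ p fibre * ∑ p fibre                        ≤⟨ cauchy-schwarz p fibre ⟩
  p * ∑ p (λ x → fibre x * fibre x)            ≡⟨ cong (p *_) squares ⟩
  p * ∑ n (λ i → ∑ n (λ j → ⟦ c i ≟ c j ⟧))    ∎
  where
  open ≤-Reasoning
  fibre : ℕ → ℕ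
  fibre x = ∑ n λ i → ⟦ x ≟ c i ⟧
  total : n ≡ ∑ p fibre
  total = sym (trans (∑-swap p n _) (trans (∑-cong n λ i _ → trans (∑-cong p λ x _ → sym (*-identityʳ ⟦ x ≟ c i ⟧)) (∑-δ p (c i) (λ _ → 1) (c<p i)))
            (trans (∑-const n 1) (*-identityʳ n))))
  squares : ∑ p (λ x → fibre x * fibre x) ≡ ∑ n (λ i → ∑ n (λ j → ⟦ c i ≟ c j ⟧))
  squares = trans (∑-cong p λ x _ → ∑-*-∑ n n _ _) (trans (∑-swap p n _) (∑-cong n λ i _ →
              trans (∑-swap p n _) (∑-cong n λ j _ → ∑-δ p (c i) (λ x → ⟦ x ≟ c j ⟧) (c<p i))))

%≡⇒∣ℤ : ∀ m n p .{{_ : NonZero p}} → m % p ≡ n % p → (ℤ.+ p) ∣ℤ (ℤ.+ m ℤ.- ℤ.+ n)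
%≡⇒∣ℤ m n p e = ℤ∣.divides (ℤ.+ (m / p) ℤ.- ℤ.+ (n / p)) (trans (cong₂ ℤ._-_ (expand m) (trans (expand n) (cong (λ k → ℤ.+ k ℤ.+ ℤ.+ (n / p) ℤ.* ℤ.+ p) (sym e))))
    (identity (ℤ.+ (m % p)) (ℤ.+ (m / p)) (ℤ.+ (n / p)) (ℤ.+ p)))
  where
  expand : ∀ m → ℤ.+ m ≡ ℤ.+ (m % p) ℤ.+ ℤ.+ (m / p) ℤ.* ℤ.+ p
  expand m = trans (cong ℤ.+_ (m≡m%n+[m/n]*n m p)) (cong (ℤ._+_ (ℤ.+ (m % p))) (ℤₚ.pos-* (m / p) p))
  identity : ∀ r a b p → (r ℤ.+ a ℤ.* p) ℤ.- (r ℤ.+ b ℤ.* p) ≡ (a ℤ.- b) ℤ.* p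
  identity = ℤ-solver.solve-∀

x*x≡∣x∣*∣x∣ : ∀ x → x ℤ.* x ≡ ℤ.+ (ℤ.∣ x ∣ * ℤ.∣ x ∣)
x*x≡∣x∣*∣x∣ (ℤ.+ zero)  = refl
x*x≡∣x∣*∣x∣ (ℤ.+ suc n) = refl
x*x≡∣x∣*∣x∣ ℤ.-[1+ n ]  = refl

norm : ℤ → ℤ → ℤ → ℤ
norm δ x y = x ℤ.* x ℤ.- δ ℤ.* (y ℤ.* y)

norm≡ : ∀ d x y → norm (ℤ.+ d) x y ≡ (ℤ.∣ x ∣ * ℤ.∣ x ∣) ℤ.⊖ (d * (ℤ.∣ y ∣ * ℤ.∣ y ∣))
norm≡ d x y = trans (cong₂ (λ u v → u ℤ.- ℤ.+ d ℤ.* v) (x*x≡∣x∣*∣x∣ x) (x*x≡∣x∣*∣x∣ y))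
  (trans (cong (λ v → ℤ.+ (ℤ.∣ x ∣ * ℤ.∣ x ∣) ℤ.- v) (sym (ℤₚ.pos-* d (ℤ.∣ y ∣ * ℤ.∣ y ∣)))) (ℤₚ.[+m]-[+n]≡m⊖n (ℤ.∣ x ∣ * ℤ.∣ x ∣) (d * (ℤ.∣ y ∣ * ℤ.∣ y ∣))))

euclidℤ : ∀ {p} x y → Prime p → (ℤ.+ p) ∣ℤ (x ℤ.* y) → (ℤ.+ p) ∣ℤ x ⊎ (ℤ.+ p) ∣ℤ y
euclidℤ {p} x y pp d with euclidsLemma ℤ.∣ x ∣ ℤ.∣ y ∣ pp (subst (p ∣_) (ℤₚ.∣i*j∣≡∣i∣*∣j∣ x y) (ℤ∣.∣⇒∣ᵤ d))
... | inj₁ u = inj₁ (ℤ∣.∣ᵤ⇒∣ u)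
... | inj₂ u = inj₂ (ℤ∣.∣ᵤ⇒∣ u)

Root : ℕ → ℕ → ℕ → Set
Root d p r = p ∣ ℤ.∣ ℤ.+ r ℤ.* ℤ.+ r ℤ.- ℤ.+ d ∣

-- The prime divisors of d and the prime 2 count as split, since d is a square modulo each of them.
-- So `Inert` will mean that d is a nonresidue modulo an odd prime.
Split : ℕ → ℕ → Set
Split d p = ∃ λ r → r < p × Root d p r

split? : ∀ d p → Dec (Split d p)
split? d p = anyUpTo? (λ r → p ∣? ℤ.∣ ℤ.+ r ℤ.* ℤ.+ r ℤ.- ℤ.+ d ∣) p

linear-factors : ∀ P r x y δ → P ∣ℤ (r ℤ.* r ℤ.- δ) → P ∣ℤ ((x ℤ.+ r ℤ.* y) ℤ.* (x ℤ.- r ℤ.* y)) → P ∣ℤ (x ℤ.* x ℤ.- δ ℤ.* (y ℤ.* y))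
linear-factors P r x y δ root e = subst (P ∣ℤ_) (identity x y r δ) (ℤ∣.∣m∣n⇒∣m+n e (ℤ∣.∣m⇒∣m*n (y ℤ.* y) root))
  where
  identity : ∀ x y r δ → (x ℤ.+ r ℤ.* y) ℤ.* (x ℤ.- r ℤ.* y) ℤ.+ (r ℤ.* r ℤ.- δ) ℤ.* (y ℤ.* y) ≡ x ℤ.* x ℤ.- δ ℤ.* (y ℤ.* y)
  identity = ℤ-solver.solve-∀

∣-sum : ∀ P x z → P ∣ℤ (x ℤ.+ z) → P ∣ℤ (x ℤ.- z) → P ∣ℤ (ℤ.+ 2 ℤ.* x)
∣-sum P x z e f = subst (P ∣ℤ_) (identity x z) (ℤ∣.∣m∣n⇒∣m+n e f)
  where
  identity : ∀ x z → (x ℤ.+ z) ℤ.+ (x ℤ.- z) ≡ ℤ.+ 2 ℤ.* x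
  identity = ℤ-solver.solve-∀

∣-difference : ∀ P x z → P ∣ℤ (x ℤ.+ z) → P ∣ℤ (x ℤ.- z) → P ∣ℤ (ℤ.+ 2 ℤ.* z)
∣-difference P x z e f = subst (P ∣ℤ_) (identity x z) (ℤ∣.∣m∣n⇒∣m-n e f)
  where
  identity : ∀ x z → (x ℤ.+ z) ℤ.- (x ℤ.- z) ≡ ℤ.+ 2 ℤ.* z
  identity = ℤ-solver.solve-∀

∣-norm² : ∀ P x y δ → P ∣ℤ x → P ∣ℤ y → (P ℤ.* P) ∣ℤ (x ℤ.* x ℤ.- δ ℤ.* (y ℤ.* y))
∣-norm² P x y δ (ℤ∣.divides s es) (ℤ∣.divides t et) = ℤ∣.divides (s ℤ.* s ℤ.- δ ℤ.* (t ℤ.* t))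
  (trans (cong₂ (λ x y → x ℤ.* x ℤ.- δ ℤ.* (y ℤ.* y)) es et) (identity s t P δ))
  where
  identity : ∀ s t P δ → s ℤ.* P ℤ.* (s ℤ.* P) ℤ.- δ ℤ.* (t ℤ.* P ℤ.* (t ℤ.* P)) ≡ (s ℤ.* s ℤ.- δ ℤ.* (t ℤ.* t)) ℤ.* (P ℤ.* P)
  identity = ℤ-solver.solve-∀

∣-minus : ∀ P x y r s → s ≡ P ℤ.- r → P ∣ℤ (x ℤ.+ s ℤ.* y) → P ∣ℤ (x ℤ.- r ℤ.* y)
∣-minus P x y r s refl e = subst (P ∣ℤ_) (identity x y P r) (ℤ∣.∣m∣n⇒∣m-n e (ℤ∣.∣m⇒∣m*n y ℤ∣.∣-refl))
  where
  identity : ∀ x y P r → (x ℤ.+ (P ℤ.- r) ℤ.* y) ℤ.- P ℤ.* y ≡ x ℤ.- r ℤ.* y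
  identity = ℤ-solver.solve-∀

∣-root : ∀ P r δ → P ∣ℤ (r ℤ.* r ℤ.- δ) → P ∣ℤ r → P ∣ℤ δ
∣-root P r δ root e = subst (P ∣ℤ_) (identity r δ) (ℤ∣.∣m∣n⇒∣m-n (ℤ∣.∣m⇒∣m*n r e) root)
  where
  identity : ∀ r δ → r ℤ.* r ℤ.- (r ℤ.* r ℤ.- δ) ≡ δ
  identity = ℤ-solver.solve-∀

module SplitPrimes (d : ℕ) (1≤d : 1 ≤ d) (aniso : ∀ a b → a * a ≡ d * (b * b) → b ≡ 0) (R : ℕ) .{{_ : NonZero R}} (B : ℕ) (2≤B : 2 ≤ B) (d≤B : d ≤ B) where
  open Logarithm R

  -- A prime above B divides neither 2 nor d, so the two square roots of d modulo p are distinct.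
  -- Later B is also large enough to make p - 1 and p, and `ι p` and `suc (ι p)`, nearly
  -- proportional to 1.
  Good : ℕ → Set
  Good p = Prime p × (B < p × Split d p)

  good? : ∀ p → Dec (Good p)
  good? p = prime? p ×-dec ((B <? p) ×-dec split? d p)

  root : ℕ → ℕ
  root p with split? d p
  ... | yes (r , _) = r
  ... | no  _       = 0

  root-< : ∀ p → Split d p → root p < p
  root-< p s with split? d p
  ... | yes (r , r<p , _) = r<p
  ... | no ¬s             = ⊥-elim (¬s s)

  root-root : ∀ p → Split d p → Root d p (root p)
  root-root p s with split? d p
  ... | yes (r , _ , e) = e
  ... | no ¬s           = ⊥-elim (¬s s)

  -- Both linear factors x + ry and x − ry of the norm modulo p count, so p divides the norm to the power 2 when it divides both.
  module Exponents (p : ℕ) (good : Good p) (x y : ℤ) where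
    pp : Prime p
    pp = proj₁ good

    B<p : B < p
    B<p = proj₁ (proj₂ good)

    r-root : (ℤ.+ p) ∣ℤ (ℤ.+ root p ℤ.* ℤ.+ root p ℤ.- ℤ.+ d)
    r-root = ℤ∣.∣ᵤ⇒∣ (root-root p (proj₂ (proj₂ good)))

    p∤r : ¬ ((ℤ.+ p) ∣ℤ (ℤ.+ root p))
    p∤r e = <⇒≱ (≤-<-trans d≤B B<p) (∣⇒≤ {{>-nonZero 1≤d}} (ℤ∣.∣⇒∣ᵤ {ℤ.+ p} {ℤ.+ d} (∣-root (ℤ.+ p) (ℤ.+ root p) (ℤ.+ d) r-root e)))

    cancel2 : ∀ z → (ℤ.+ p) ∣ℤ (ℤ.+ 2 ℤ.* z) → (ℤ.+ p) ∣ℤ z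
    cancel2 z e with euclidℤ (ℤ.+ 2) z pp e
    ... | inj₁ u = ⊥-elim (<⇒≱ (≤-<-trans 2≤B B<p) (∣⇒≤ (ℤ∣.∣⇒∣ᵤ {ℤ.+ p} {ℤ.+ 2} u)))
    ... | inj₂ u = u

    either : (ℤ.+ p) ∣ℤ (x ℤ.+ ℤ.+ root p ℤ.* y) ⊎ (ℤ.+ p) ∣ℤ (x ℤ.- ℤ.+ root p ℤ.* y) → (ℤ.+ p) ∣ℤ norm (ℤ.+ d) x y
    either (inj₁ e) = linear-factors (ℤ.+ p) (ℤ.+ root p) x y (ℤ.+ d) r-root (ℤ∣.∣m⇒∣m*n (x ℤ.- ℤ.+ root p ℤ.* y) e)
    either (inj₂ e) = linear-factors (ℤ.+ p) (ℤ.+ root p) x y (ℤ.+ d) r-root (ℤ∣.∣n⇒∣m*n (x ℤ.+ ℤ.+ root p ℤ.* y) e)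

    both : (ℤ.+ p) ∣ℤ (x ℤ.+ ℤ.+ root p ℤ.* y) → (ℤ.+ p) ∣ℤ (x ℤ.- ℤ.+ root p ℤ.* y) → (ℤ.+ p ℤ.* ℤ.+ p) ∣ℤ norm (ℤ.+ d) x y
    both e f = ∣-norm² (ℤ.+ p) x y (ℤ.+ d) (cancel2 x (∣-sum (ℤ.+ p) x (ℤ.+ root p ℤ.* y) e f)) p∣y
      where
      p∣y : (ℤ.+ p) ∣ℤ y
      p∣y = [ ⊥-elim ∘ p∤r , id ]′ (euclidℤ (ℤ.+ root p) y pp (cancel2 (ℤ.+ root p ℤ.* y) (∣-difference (ℤ.+ p) x (ℤ.+ root p ℤ.* y) e f)))

    minus : (ℤ.+ p) ∣ℤ (x ℤ.+ ℤ.+ (p ∸ root p) ℤ.* y) → (ℤ.+ p) ∣ℤ (x ℤ.- ℤ.+ root p ℤ.* y)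
    minus = ∣-minus (ℤ.+ p) x y (ℤ.+ root p) (ℤ.+ (p ∸ root p))
      (trans (sym (ℤₚ.⊖-≥ (<⇒≤ (root-< p (proj₂ (proj₂ good)))))) (sym (ℤₚ.[+m]-[+n]≡m⊖n p (root p))))

    power₁ : (ℤ.+ p) ∣ℤ norm (ℤ.+ d) x y → p ^ 1 ∣ ℤ.∣ norm (ℤ.+ d) x y ∣
    power₁ u = subst (_∣ ℤ.∣ norm (ℤ.+ d) x y ∣) (sym (*-identityʳ p)) (ℤ∣.∣⇒∣ᵤ u)

    power₂ : (ℤ.+ p ℤ.* ℤ.+ p) ∣ℤ norm (ℤ.+ d) x y → p ^ 2 ∣ ℤ.∣ norm (ℤ.+ d) x y ∣
    power₂ u = subst (_∣ ℤ.∣ norm (ℤ.+ d) x y ∣) (trans (ℤₚ.∣i*j∣≡∣i∣*∣j∣ (ℤ.+ p) (ℤ.+ p)) (cong (p *_) (sym (*-identityʳ p)))) (ℤ∣.∣⇒∣ᵤ u)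

  -- The points of the square are numbered by i < Y², with coordinates i % Y and i / Y.
  module Points (Y : ℕ) {{_ : NonZero Y}} where
    n : ℕ
    n = Y * Y

    Δa : ℕ → ℕ → ℤ
    Δa i j = ℤ.+ (i % Y) ℤ.- ℤ.+ (j % Y)

    Δb : ℕ → ℕ → ℤ
    Δb i j = ℤ.+ (i / Y) ℤ.- ℤ.+ (j / Y)

    V : ℕ → ℕ → ℕ
    V i j = ℤ.∣ norm (ℤ.+ d) (Δa i j) (Δb i j) ∣

    -- The value of the linear form a + r b modulo p at the point i; 0 is a default value for p = 0.
    -- The form a - r b is obtained with p - r in place of r.
    class : (p r : ℕ) → ℕ → ℕ
    class zero    r i = 0
    class (suc p) r i = (i % Y + r * (i / Y)) % suc p

    class-< : ∀ p r i → 1 ≤ p → class p r i < p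
    class-< (suc p) r i _ = m%n<n (i % Y + r * (i / Y)) (suc p)

    class⇒∣ : ∀ p r i j → 1 ≤ p → class p r i ≡ class p r j → (ℤ.+ p) ∣ℤ (Δa i j ℤ.+ ℤ.+ r ℤ.* Δb i j)
    class⇒∣ (suc p) r i j _ e = subst (ℤ.+ suc p ∣ℤ_) (trans (cong₂ ℤ._-_ (cast i) (cast j)) (identity (ℤ.+ (i % Y)) (ℤ.+ (j % Y)) (ℤ.+ r) (ℤ.+ (i / Y)) (ℤ.+ (j / Y))))
        (%≡⇒∣ℤ (i % Y + r * (i / Y)) (j % Y + r * (j / Y)) (suc p) e)
      where
      cast : ∀ i → ℤ.+ (i % Y + r * (i / Y)) ≡ ℤ.+ (i % Y) ℤ.+ ℤ.+ r ℤ.* ℤ.+ (i / Y)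
      cast i = cong (ℤ._+_ (ℤ.+ (i % Y))) (ℤₚ.pos-* r (i / Y))
      identity : ∀ a a′ r b b′ → (a ℤ.+ r ℤ.* b) ℤ.- (a′ ℤ.+ r ℤ.* b′) ≡ (a ℤ.- a′) ℤ.+ r ℤ.* (b ℤ.- b′)
      identity = ℤ-solver.solve-∀

    e₊ e₋ e : ℕ → ℕ → ℕ → ℕ
    e₊ p i j = ⟦ class p (root p) i ≟ class p (root p) j ⟧
    e₋ p i j = ⟦ class p (p ∸ root p) i ≟ class p (p ∸ root p) j ⟧
    e p i j = e₊ p i j + e₋ p i j

    exponent : ∀ p i j → Good p → p ^ e p i j ∣ V i j
    exponent p i j good = cases (class p (root p) i ≟ class p (root p) j) (class p (p ∸ root p) i ≟ class p (p ∸ root p) j)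
      where
      open Exponents p good (Δa i j) (Δb i j)
      1≤p : 1 ≤ p
      1≤p = ≤-trans (s≤s z≤n) (prime≥2 pp)
      cases : (s : Dec (class p (root p) i ≡ class p (root p) j)) (t : Dec (class p (p ∸ root p) i ≡ class p (p ∸ root p) j)) →
        p ^ (⟦ s ⟧ + ⟦ t ⟧) ∣ V i j
      cases (no _)  (no _)  = 1∣ V i j
      cases (yes u) (no _)  = power₁ (either (inj₁ (class⇒∣ p (root p) i j 1≤p u)))
      cases (no _)  (yes v) = power₁ (either (inj₂ (minus (class⇒∣ p (p ∸ root p) i j 1≤p v))))
      cases (yes u) (yes v) = power₂ (both (class⇒∣ p (root p) i j 1≤p u) (minus (class⇒∣ p (p ∸ root p) i j 1≤p v)))

    -- Anisotropy enters here: a vanishing norm forces both coordinate differences to vanish, and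
    -- the coordinates determine the number of the point.
    V>0 : ∀ i j → i ≢ j → 1 ≤ V i j
    V>0 i j i≢j with V i j in eq
    ... | suc _ = s≤s z≤n
    ... | zero  = ⊥-elim (i≢j i≡j)
      where
      a b : ℕ
      a = ℤ.∣ Δa i j ∣
      b = ℤ.∣ Δb i j ∣
      a²≡db² : a * a ≡ d * (b * b)
      a²≡db² = ℤₚ.+-injective (ℤₚ.i-j≡0⇒i≡j (ℤ.+ (a * a)) (ℤ.+ (d * (b * b))) (trans (ℤₚ.[+m]-[+n]≡m⊖n (a * a) (d * (b * b))) (trans (sym (norm≡ d (Δa i j) (Δb i j))) (ℤₚ.∣i∣≡0⇒i≡0 eq))))
      b≡0 : b ≡ 0
      b≡0 = aniso a b a²≡db²
      a≡0 : a ≡ 0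
      a≡0 with m*n≡0⇒m≡0∨n≡0 a (trans a²≡db² (trans (cong (λ k → d * (k * k)) b≡0) (*-zeroʳ d)))
      ... | inj₁ u = u
      ... | inj₂ u = u
      eq0 : ∀ m n → ℤ.∣ ℤ.+ m ℤ.- ℤ.+ n ∣ ≡ 0 → m ≡ n
      eq0 m n u = ℤₚ.+-injective (ℤₚ.i-j≡0⇒i≡j (ℤ.+ m) (ℤ.+ n) (ℤₚ.∣i∣≡0⇒i≡0 u))
      i≡j : i ≡ j
      i≡j = trans (m≡m%n+[m/n]*n i Y) (trans (cong₂ (λ u v → u + v * Y) (eq0 (i % Y) (j % Y) a≡0) (eq0 (i / Y) (j / Y) b≡0)) (sym (m≡m%n+[m/n]*n j Y)))

    ∣-∣≤ : ∀ u v → u ≤ Y → v ≤ Y → ℤ.∣ ℤ.+ u ℤ.- ℤ.+ v ∣ ≤ Y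
    ∣-∣≤ u v u≤Y v≤Y = ≤-trans (≤-reflexive (cong ℤ.∣_∣ (ℤₚ.[+m]-[+n]≡m⊖n u v))) (≤-trans (ℤₚ.∣m⊝n∣≤m⊔n u v) (⊔-lub u≤Y v≤Y))

    V≤ : ∀ i j → i < n → j < n → V i j ≤ d * n
    V≤ i j i<n j<n = ≤-trans (≤-reflexive (cong ℤ.∣_∣ (norm≡ d (Δa i j) (Δb i j)))) (≤-trans (ℤₚ.∣m⊝n∣≤m⊔n (ℤ.∣ Δa i j ∣ * ℤ.∣ Δa i j ∣) (d * (ℤ.∣ Δb i j ∣ * ℤ.∣ Δb i j ∣)))
        (⊔-lub (≤-trans (*-mono-≤ a≤ a≤) (m≤n*m n d {{>-nonZero 1≤d}})) (*-monoʳ-≤ d {ℤ.∣ Δb i j ∣ * ℤ.∣ Δb i j ∣} {Y * Y} (*-mono-≤ b≤ b≤))))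
      where
      a≤ : ℤ.∣ Δa i j ∣ ≤ Y
      a≤ = ∣-∣≤ (i % Y) (j % Y) (<⇒≤ (m%n<n i Y)) (<⇒≤ (m%n<n j Y))
      b≤ : ℤ.∣ Δb i j ∣ ≤ Y
      b≤ = ∣-∣≤ (i / Y) (j / Y) (<⇒≤ (m<n*o⇒m/o<n i<n)) (<⇒≤ (m<n*o⇒m/o<n j<n))

    sp : ℕ → ℕ
    sp p = ⟦ good? p ⟧

    T : ℕ → ℕ
    T p = ∑ n λ i → ∑ n λ j → e p i j

    -- Each of the two linear forms accounts for n² / p coincidences. This factor 2 is the source of
    -- the bound 1/2 for the split primes.
    T-lower : ∀ p → 1 ≤ p → 2 * (n * n) ≤ p * T p
    T-lower p 1≤p = begin
      n * n + (n * n + 0) ≡⟨ cong (n * n +_) (+-identityʳ (n * n)) ⟩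
      n * n + n * n       ≤⟨ +-mono-≤ (coincidences n p (class p (root p)) (λ i → class-< p _ i 1≤p)) (coincidences n p (class p (p ∸ root p)) (λ i → class-< p _ i 1≤p)) ⟩
      p * ∑ n (λ i → ∑ n (e₊ p i)) + p * ∑ n (λ i → ∑ n (e₋ p i)) ≡⟨ *-distribˡ-+ p _ _ ⟨
      p * (∑ n (λ i → ∑ n (e₊ p i)) + ∑ n (λ i → ∑ n (e₋ p i)))  ≡⟨ cong (p *_) (trans (∑-cong n λ i _ → ∑-+ n _ _) (∑-+ n _ _)) ⟨
      p * T p             ∎
      where open ≤-Reasoning

    -- Off the diagonal the powers p ^ e divide a nonzero number of size at most d n. On the
    -- diagonal the norm is 0 and says nothing, so the trivial bound 2 for the exponent is used;
    -- there are only n such pairs among n².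
    pair-bound : ∀ N i j → i < n → j < n → ∑ N (λ p → ι p * (sp p * e p i j)) ≤ ι (d * n) + ⟦ j ≟ i ⟧ * (2 * ∑ N (λ p → sp p * ι p))
    pair-bound N i j i<n j<n with j ≟ i
    ... | yes _ = ≤-trans (∑-mono N λ p _ → bound (ι p) (sp p) (e₊ p i j) (e₋ p i j) (⟦⟧≤1 (_ ≟ _)) (⟦⟧≤1 (_ ≟ _)))
          (≤-trans (≤-reflexive (trans (∑-*ˡ N 2 _) (sym (+-identityʳ _)))) (m≤n+m _ (ι (d * n))))
      where
      bound : ∀ l s u v → u ≤ 1 → v ≤ 1 → l * (s * (u + v)) ≤ 2 * (s * l)
      bound l s u v u≤1 v≤1 = lin (*-monoʳ-≤ (l * s) (+-mono-≤ u≤1 v≤1)) 0 (identity l s u v)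
        where
        identity : ∀ l s u v → l * (s * (u + v)) + l * s * 2 + 0 ≡ 2 * (s * l) + l * s * (u + v)
        identity = solve-∀
    ... | no j≢i = ≤-trans (PrimePowers.∑ι-exponents R (V i j) (λ p → sp p * e p i j) N (V>0 i j (j≢i ∘ sym)) admissible)
          (≤-trans (ι-mono (V>0 i j (j≢i ∘ sym)) (V≤ i j i<n j<n)) (m≤m+n _ 0))
      where
      admissible : PrimePowers.Admissible R (V i j) (λ p → sp p * e p i j) N
      admissible p _ with good? p
      ... | no _  = inj₁ refl
      ... | yes g = inj₂ (proj₁ g , subst (λ k → p ^ k ∣ V i j) (sym (+-identityʳ (e p i j))) (exponent p i j g))

    split-bound : ∀ N → ∑ N (λ p → ι p * (sp p * T p)) ≤ n * n * ι (d * n) + n * (2 * ∑ N (λ p → sp p * ι p))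
    split-bound N = begin
      ∑ N (λ p → ι p * (sp p * T p))                                     ≡⟨ ∑-cong N (λ p _ → pull p) ⟩
      ∑ N (λ p → ∑ n (λ i → ∑ n (λ j → ι p * (sp p * e p i j))))         ≡⟨ trans (∑-swap N n _) (∑-cong n λ i _ → ∑-swap N n _) ⟩
      ∑ n (λ i → ∑ n (λ j → ∑ N (λ p → ι p * (sp p * e p i j))))         ≤⟨ ∑-mono n (λ i i<n → ∑-mono n λ j j<n → pair-bound N i j i<n j<n) ⟩
      ∑ n (λ i → ∑ n (λ j → ι (d * n) + ⟦ j ≟ i ⟧ * L))                  ≡⟨ ∑-cong n (λ i i<n → trans (∑-+ n _ _) (cong₂ _+_ (∑-const n _) (∑-δ n i (λ _ → L) i<n))) ⟩
      ∑ n (λ i → n * ι (d * n) + L)                                      ≡⟨ ∑-const n _ ⟩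
      n * (n * ι (d * n) + L)                                            ≡⟨ trans (*-distribˡ-+ n _ L) (cong (_+ n * L) (sym (*-assoc n n _))) ⟩
      n * n * ι (d * n) + n * L                                          ∎
      where
      open ≤-Reasoning
      L = 2 * ∑ N (λ p → sp p * ι p)
      pull : ∀ p → ι p * (sp p * T p) ≡ ∑ n (λ i → ∑ n (λ j → ι p * (sp p * e p i j)))
      pull p = sym (trans (∑-cong n λ i _ → trans (∑-*ˡ n (ι p) _) (cong (ι p *_) (∑-*ˡ n (sp p) _)))
                 (trans (∑-*ˡ n (ι p) _) (cong (ι p *_) (∑-*ˡ n (sp p) _))))

-- The mass of the inert primes

∑-below : ∀ N B → ∑ N (λ p → ⟦ p ≤? B ⟧) ≤ suc B
∑-below N B = proj₂ (go N)
  where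
  go : ∀ N → ∑ N (λ p → ⟦ p ≤? B ⟧) ≤ N × ∑ N (λ p → ⟦ p ≤? B ⟧) ≤ suc B
  go zero    = z≤n , z≤n
  go (suc N) with N ≤? B | go N
  ... | yes q | l , m = subst (λ c → c ≤ suc N × c ≤ suc B) (+-comm 1 _) (s≤s l , s≤s (≤-trans l q))
  ... | no _  | l , m = subst (λ c → c ≤ suc N × c ≤ suc B) (sym (+-identityʳ _)) (m≤n⇒m≤1+n l , m)

Inert : ℕ → ℕ → Set
Inert d p = Prime p × ¬ Split d p

inert? : ∀ d p → Dec (Inert d p)
inert? d p = prime? p ×-dec ¬? (split? d p)

vals≤ : ∀ X {p} → Prime p → vals X p ≤ X
vals≤ X {suc zero}    pp = ⊥-elim (<-irrefl refl (prime≥2 pp))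
vals≤ X {suc (suc p)} pp = ≤-trans (m≤n*m (vals X (suc (suc p))) (suc p)) (vals-bound X (suc p) (s≤s (s≤s z≤n)))

trichotomy-bound : ∀ {P L S G I : Set} (p? : Dec P) (l? : Dec L) (s? : Dec S) (g? : Dec G) (i? : Dec I) v c →
  (P → L → v ≤ c) → (P → ¬ L → S → G) → (P → ¬ S → I) → ⟦ p? ⟧ * v ≤ ⟦ l? ⟧ * c + (⟦ g? ⟧ * v + ⟦ i? ⟧ * v)
trichotomy-bound (no _)  l? s? g? i? v c f g h = z≤n
trichotomy-bound (yes p) (yes l) s? g? i? v c f g h = ≤-trans (+-monoˡ-≤ 0 (f p l)) (m≤m+n (c + 0) _)
trichotomy-bound (yes p) (no ¬l) (yes s) g? i? v c f g h =
  ≤-trans (≤-reflexive (cong (_* v) (sym (⟦⟧-yes g? (g p ¬l s))))) (m≤m+n (⟦ g? ⟧ * v) _)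
trichotomy-bound (yes p) (no ¬l) (no ¬s) g? i? v c f g h =
  ≤-trans (≤-reflexive (cong (_* v) (sym (⟦⟧-yes i? (h p ¬s))))) (m≤n+m (⟦ i? ⟧ * v) _)

module InertMass (d : ℕ) (1≤d : 1 ≤ d) (aniso : ∀ a b → a * a ≡ d * (b * b) → b ≡ 0) (R : ℕ) .{{_ : NonZero R}} where
  open Logarithm R
  open Mertens R

  -- Up to rounding, X times the sum of log p / p over the inert primes p ≤ X. With `vals` it is
  -- literally a part of the factorisation of log X!.
  inertMass : ℕ → ℕ
  inertMass X = ∑ (suc X) λ p → ⟦ inert? d p ⟧ * (suc (ι p) * vals X p)

  module Estimate (u : ℕ) (6≤u : 6 ≤ u) (w : ℕ) where
    -- X is k times a square in order that the square of side k (w + 1) has exactly n = k X points.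
    -- With k = 4 u the diagonal pairs, which cost at most 4 n X · `ι X`, take the fraction 1 / u of
    -- n² · `ι X`. In B, the summand u gives p - 1 ≥ u, and `A ^ u` gives ι p ≥ u.
    k X B : ℕ
    k = 4 * u
    X = k * (suc w * suc w)
    B = 2 + d + u + A ^ u

    1≤u : 1 ≤ u
    1≤u = ≤-trans (s≤s z≤n) 6≤u

    1≤k : 1 ≤ k
    1≤k = *-mono-≤ {1} {4} (s≤s z≤n) 1≤u

    1≤X : 1 ≤ X
    1≤X = *-mono-≤ 1≤k (s≤s z≤n)

    instance
      Y≢0 : NonZero (k * suc w)
      Y≢0 = >-nonZero (*-mono-≤ 1≤k (s≤s z≤n))

    open SplitPrimes d 1≤d aniso R B (≤-trans (m≤m+n 2 d) (≤-trans (m≤m+n (2 + d) u) (m≤m+n _ _)))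
           (≤-trans (m≤n+m d 2) (≤-trans (m≤m+n (2 + d) u) (m≤m+n _ _)))
    open Points (k * suc w)

    n≡kX : n ≡ k * X
    n≡kX = identity k (suc w)
      where
      identity : ∀ k w → k * w * (k * w) ≡ k * (k * (w * w))
      identity = solve-∀

    splitMass smallMass : ℕ
    splitMass = ∑ (suc X) λ p → sp p * (suc (ι p) * vals X p)
    smallMass = suc B * (suc (ι B) * X)

    trichotomy : ∑ (suc X) (λ p → weight p (vals X p)) ≤ smallMass + (splitMass + inertMass X)
    trichotomy = begin
      ∑ (suc X) (λ p → weight p (vals X p)) ≤⟨ ∑-mono (suc X) (λ p _ → cases p) ⟩
      ∑ (suc X) (λ p → ⟦ p ≤? B ⟧ * (suc (ι B) * X) + (sp p * (suc (ι p) * vals X p) + ⟦ inert? d p ⟧ * (suc (ι p) * vals X p)))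
        ≡⟨ trans (∑-+ (suc X) _ _) (cong₂ _+_ (∑-*ʳ (suc X) _ _) (∑-+ (suc X) _ _)) ⟩
      ∑ (suc X) (λ p → ⟦ p ≤? B ⟧) * (suc (ι B) * X) + (splitMass + inertMass X) ≤⟨ +-monoˡ-≤ _ (*-monoˡ-≤ (suc (ι B) * X) (∑-below (suc X) B)) ⟩
      smallMass + (splitMass + inertMass X) ∎
      where
      open ≤-Reasoning
      cases : ∀ p → weight p (vals X p) ≤ ⟦ p ≤? B ⟧ * (suc (ι B) * X) + (sp p * (suc (ι p) * vals X p) + ⟦ inert? d p ⟧ * (suc (ι p) * vals X p))
      cases p = trichotomy-bound (prime? p) (p ≤? B) (split? d p) (good? p) (inert? d p) (suc (ι p) * vals X p) (suc (ι B) * X)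
        (λ pp p≤B → *-mono-≤ (s≤s (ι-mono (≤-trans (s≤s z≤n) (prime≥2 pp)) p≤B)) (vals≤ X pp))
        (λ pp p≰B s → pp , ≰⇒> p≰B , s) _,_

    -- `vals X p` is at most X / (p - 1), and `T p` is at least 2 n² / p. One factor (u + 1) / u
    -- pays for replacing p - 1 by p, the other for replacing `suc (ι p)` by `ι p`.
    sp-pointwise : ∀ p → 2 * (n * n) * (u * u) * (sp p * (suc (ι p) * vals X p)) ≤ X * (suc u * suc u) * (ι p * (sp p * T p))
    sp-pointwise p with good? p
    ... | no _ = ≤-trans (≤-reflexive (*-zeroʳ (2 * (n * n) * (u * u)))) z≤n
    sp-pointwise zero    | yes (pp , _) = ⊥-elim (<⇒≱ (prime≥2 pp) z≤n)
    sp-pointwise (suc p) | yes (pp , B<p , _) = begin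
      2 * (n * n) * (u * u) * (1 * (suc (ι q) * W))         ≡⟨ regroup (2 * (n * n)) u (suc (ι q)) W ⟩
      u * suc (ι q) * (2 * (n * n) * u * W)                 ≤⟨ *-mono-≤ log-step vals-step ⟩
      suc u * ι q * (X * suc u * T q)                       ≡⟨ regroup′ (suc u) (ι q) X (T q) ⟩
      X * (suc u * suc u) * (ι q * (1 * T q))               ∎
      where
      open ≤-Reasoning
      q W : ℕ
      q = suc p
      W = vals X q
      regroup : ∀ N u i W → N * (u * u) * (1 * (i * W)) ≡ u * i * (N * u * W)
      regroup = solve-∀
      regroup′ : ∀ v i X t → v * i * (X * v * t) ≡ X * (v * v) * (i * (1 * t))
      regroup′ = solve-∀
      u≤p : u ≤ p
      u≤p = s≤s⁻¹ (≤-trans (s≤s (≤-trans (m≤n+m u (2 + d)) (m≤m+n (2 + d + u) _))) B<p)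
      u≤ι : u ≤ ι q
      u≤ι = ι-large u q (≤-trans (m≤n+m (A ^ u) (2 + d + u)) (<⇒≤ B<p))
      log-step : u * suc (ι q) ≤ suc u * ι q
      log-step = lin u≤ι 0 (identity u (ι q))
        where
        identity : ∀ u i → u * suc i + i + 0 ≡ suc u * i + u
        identity = solve-∀
      1≤p : 1 ≤ p
      1≤p = s≤s⁻¹ (prime≥2 pp)
      vals-step : 2 * (n * n) * u * W ≤ X * suc u * T q
      vals-step = *-cancelˡ-≤ p {{>-nonZero 1≤p}} (begin
        p * (2 * (n * n) * u * W)   ≡⟨ e₁ p (2 * (n * n)) u W ⟩
        2 * (n * n) * u * (p * W)   ≤⟨ *-monoʳ-≤ (2 * (n * n) * u) (vals-bound X p (prime≥2 pp)) ⟩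
        2 * (n * n) * u * X         ≡⟨ *-assoc (2 * (n * n)) u X ⟩
        2 * (n * n) * (u * X)       ≤⟨ *-monoˡ-≤ (u * X) (T-lower q (s≤s z≤n)) ⟩
        q * T q * (u * X)           ≡⟨ e₂ q (T q) u X ⟩
        u * q * (T q * X)           ≤⟨ *-monoˡ-≤ (T q * X) (lin u≤p 0 (e₃ u p)) ⟩
        p * suc u * (T q * X)       ≡⟨ e₄ p (suc u) (T q) X ⟩
        p * (X * suc u * T q)       ∎)
        where
        e₁ : ∀ p N u W → p * (N * u * W) ≡ N * u * (p * W)
        e₁ = solve-∀
        e₂ : ∀ q t u X → q * t * (u * X) ≡ u * q * (t * X)
        e₂ = solve-∀
        e₃ : ∀ u p → u * suc p + p + 0 ≡ p * suc u + u
        e₃ = solve-∀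
        e₄ : ∀ p v t X → p * v * (t * X) ≡ p * (X * v * t)
        e₄ = solve-∀

    ∑ι≤ : ∑ (suc X) (λ p → sp p * ι p) ≤ 2 * (X * ι X)
    ∑ι≤ = begin
      ∑ (suc X) (λ p → sp p * ι p) ≤⟨ ∑-mono (suc X) (λ p p≤X → bound p (s≤s⁻¹ p≤X)) ⟩
      ∑ (suc X) (λ _ → ι X)        ≡⟨ ∑-const (suc X) (ι X) ⟩
      suc X * ι X                  ≤⟨ lin (*-monoˡ-≤ (ι X) 1≤X) 0 (identity X (ι X)) ⟩
      2 * (X * ι X)                ∎
      where
      open ≤-Reasoning
      identity : ∀ X i → suc X * i + X * i + 0 ≡ 2 * (X * i) + 1 * i
      identity = solve-∀
      bound : ∀ p → p ≤ X → sp p * ι p ≤ ι X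
      bound p p≤X with good? p
      ... | no _ = z≤n
      ... | yes (pp , _) = ≤-trans (≤-reflexive (+-identityʳ (ι p))) (ι-mono (≤-trans (s≤s z≤n) (prime≥2 pp)) p≤X)

    -- The split mass is at most (1/2) (1 + 1/u)³ X · `ι X` + O(X): two factors come from
    -- `sp-pointwise` and the third from the diagonal pairs.
    splitMass-bound : 2 * (u * u * u) * splitMass ≤ suc u * suc u * suc u * (X * ι X) + suc u * suc u * u * suc (ι (d * k)) * X
    splitMass-bound = *-cancelˡ-≤ (n * n) {{>-nonZero (*-mono-≤ n>0 n>0)}} (begin
      n * n * (2 * (u * u * u) * splitMass)
        ≡⟨ e₁ (n * n) u splitMass ⟩
      u * (2 * (n * n) * (u * u) * splitMass)
        ≡⟨ cong (u *_) (∑-*ˡ (suc X) (2 * (n * n) * (u * u)) _) ⟨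
      u * ∑ (suc X) (λ p → 2 * (n * n) * (u * u) * (sp p * (suc (ι p) * vals X p)))
        ≤⟨ *-monoʳ-≤ u (∑-mono (suc X) λ p _ → sp-pointwise p) ⟩
      u * ∑ (suc X) (λ p → X * (suc u * suc u) * (ι p * (sp p * T p)))
        ≡⟨ cong (u *_) (∑-*ˡ (suc X) (X * (suc u * suc u)) _) ⟩
      u * (X * (suc u * suc u) * ∑ (suc X) (λ p → ι p * (sp p * T p)))
        ≤⟨ *-monoʳ-≤ u (*-monoʳ-≤ (X * (suc u * suc u)) (split-bound (suc X))) ⟩
      u * (X * (suc u * suc u) * (n * n * ι (d * n) + n * (2 * ∑ (suc X) (λ p → sp p * ι p))))
        ≤⟨ *-monoʳ-≤ u (*-monoʳ-≤ (X * (suc u * suc u)) (+-mono-≤ (*-monoʳ-≤ (n * n) ιdn≤) (*-monoʳ-≤ n (*-monoʳ-≤ 2 ∑ι≤)))) ⟩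
      u * (X * (suc u * suc u) * (n * n * (suc (ι (d * k)) + ι X) + n * (2 * (2 * (X * ι X)))))
        ≡⟨ e₂ u X (suc u) n (suc (ι (d * k))) (ι X) ⟩
      X * (suc u * suc u) * (n * n * (u * (suc (ι (d * k)) + ι X)) + n * (4 * u * X) * ι X)
        ≡⟨ cong (λ m → X * (suc u * suc u) * (n * n * (u * (suc (ι (d * k)) + ι X)) + n * m * ι X)) n≡kX ⟨
      X * (suc u * suc u) * (n * n * (u * (suc (ι (d * k)) + ι X)) + n * n * ι X)
        ≡⟨ e₃ u X n (suc (ι (d * k))) (ι X) ⟩
      n * n * (suc u * suc u * suc u * (X * ι X) + suc u * suc u * u * suc (ι (d * k)) * X) ∎)
      where
      open ≤-Reasoning
      n>0 : 1 ≤ n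
      n>0 = subst (1 ≤_) (sym n≡kX) (*-mono-≤ 1≤k 1≤X)
      ιdn≤ : ι (d * n) ≤ suc (ι (d * k)) + ι X
      ιdn≤ = subst (λ m → ι m ≤ suc (ι (d * k)) + ι X) (trans (*-assoc d k X) (cong (d *_) (sym n≡kX))) (ι-sub (d * k) X (*-mono-≤ 1≤d 1≤k) 1≤X)
      e₁ : ∀ N u S → N * (2 * (u * u * u) * S) ≡ u * (2 * N * (u * u) * S)
      e₁ = solve-∀
      e₂ : ∀ u X v n c i → u * (X * (v * v) * (n * n * (c + i) + n * (2 * (2 * (X * i))))) ≡ X * (v * v) * (n * n * (u * (c + i)) + n * (4 * u * X) * i)
      e₂ = solve-∀
      e₃ : ∀ u X n c i → X * (suc u * suc u) * (n * n * (u * (c + i)) + n * n * i) ≡ n * n * (suc u * suc u * suc u * (X * i) + suc u * suc u * u * c * X)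
      e₃ = solve-∀

    constant : ℕ
    constant = 2 * (u * u * u) * u * (suc B * suc (ι B)) + (u * (suc u * suc u * u * suc (ι (d * k))) + 2 * (u * u * u) * u * suc (ι u))

    -- The inert mass is at least (1/2) (1 - 6/u) X · `ι X` - O(X). After doubling, the weak
    -- Stirling bound loses 2/u, and (1 + 1/u)³ - 1 is at most 4/u by `absorb`.
    estimate : u * u * u * (u * (X * ι X)) ≤ u * u * u * (2 * u * inertMass X + 6 * (X * ι X)) + constant * X
    estimate = lin (+-mono-≤ (+-mono-≤ (*-monoʳ-≤ (2 * (u * u * u)) mertens) (*-monoʳ-≤ u splitMass-bound)) (*-monoˡ-≤ (u * (X * ι X)) absorb)) 0
      (identity u (X * ι X) X splitMass (inertMass X) (suc B) (suc (ι B)) (suc (ι u)) (suc u * suc u * u * suc (ι (d * k))))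
      where
      mertens : u * (X * ι X) ≤ u * (smallMass + (splitMass + inertMass X)) + (u * (X * suc (ι u)) + X * ι X)
      mertens = ≤-trans (∑ι-upper u X 1≤u 1≤X) (+-monoˡ-≤ _ (*-monoʳ-≤ u (≤-trans (∑ι-factor X) trichotomy)))
      absorb : 3 * u + 1 ≤ u * u
      absorb = ≤-trans (≤-trans (+-monoʳ-≤ (3 * u) 1≤u) (≤-trans (≤-reflexive (quadruple u)) (*-monoˡ-≤ u {4} {6} (s≤s (s≤s (s≤s (s≤s z≤n))))))) (*-monoˡ-≤ u 6≤u)
        where
        quadruple : ∀ u → 3 * u + u ≡ 4 * u
        quadruple = solve-∀
      identity : ∀ u J X S I b β σ c →
        u * u * u * (u * J)
          + (2 * (u * u * u) * (u * (b * (β * X) + (S + I)) + (u * (X * σ) + J)) + u * (suc u * suc u * suc u * J + c * X) + u * u * (u * J)) + 0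
        ≡ u * u * u * (2 * u * I + 6 * J) + (2 * (u * u * u) * u * (b * β) + (u * c + 2 * (u * u * u) * u * σ)) * X
          + (2 * (u * u * u) * (u * J) + u * (2 * (u * u * u) * S) + (3 * u + 1) * (u * J))
      identity = solve-∀

  inertMass-lower : ∀ v → 1 ≤ v → ∃ λ C → ∀ X₀ → ∃ λ X → X₀ ≤ X × 1 ≤ X × v * (X * ι X) ≤ 2 * v * inertMass X + (X * ι X + C * X)
  inertMass-lower v 1≤v = C , λ X₀ → Estimate.X u 6≤u X₀ ,
      ≤-trans (n≤1+n X₀) (≤-trans (m≤m*n (suc X₀) (suc X₀)) (m≤n*m _ (4 * u) {{>-nonZero (Estimate.1≤k u 6≤u X₀)}})) ,
      Estimate.1≤X u 6≤u X₀ , final X₀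
    where
    u C : ℕ
    u = 6 * v
    6≤u : 6 ≤ u
    6≤u = *-monoʳ-≤ 6 1≤v
    -- `constant` does not involve w, so its value at w = 0 serves for every X.
    C = Estimate.constant u 6≤u 0
    final : ∀ X₀ → let X = Estimate.X u 6≤u X₀ in v * (X * ι X) ≤ 2 * v * inertMass X + (X * ι X + C * X)
    final X₀ = *-cancelˡ-≤ 6 (*-cancelˡ-≤ (u * u * u) {{>-nonZero (*-mono-≤ (*-mono-≤ 1≤u 1≤u) 1≤u)}}
        (lin (+-mono-≤ estimate (*-monoˡ-≤ (constant * X) (≤-trans (*-mono-≤ (*-mono-≤ 1≤u 1≤u) 1≤u) (m≤n*m (u * u * u) 6)))) 0
          (identity v (u * u * u) (X * ι X) (inertMass X) (constant * X))))
      where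
      open Estimate u 6≤u X₀
      identity : ∀ v c J I K → c * (6 * (v * J)) + (c * (2 * (6 * v) * I + 6 * J) + K + 6 * c * K) + 0
        ≡ c * (6 * (2 * v * I + (J + K))) + (c * (6 * v * J) + 1 * K)
      identity = solve-∀

-- Congruences and half systems

∣ℤ⇒%≡ : ∀ m n p .{{_ : NonZero p}} → (ℤ.+ p) ∣ℤ (ℤ.+ m ℤ.- ℤ.+ n) → m % p ≡ n % p
∣ℤ⇒%≡ m n p (ℤ∣.divides (ℤ.+ k) e) = trans (cong (_% p) m≡) ([m+kn]%n≡m%n n k p)
  where
  identity : ∀ m n → m ≡ n ℤ.+ (m ℤ.- n)
  identity = ℤ-solver.solve-∀
  m≡ : m ≡ n + k * p
  m≡ = ℤₚ.+-injective (trans (identity (ℤ.+ m) (ℤ.+ n)) (cong (ℤ._+_ (ℤ.+ n)) (trans e (sym (ℤₚ.pos-* k p)))))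
∣ℤ⇒%≡ m n p (ℤ∣.divides (ℤ.-[1+ k ]) e) = sym (trans (cong (_% p) n≡) ([m+kn]%n≡m%n m (suc k) p))
  where
  identity : ∀ m n → n ≡ m ℤ.+ ℤ.- (m ℤ.- n)
  identity = ℤ-solver.solve-∀
  n≡ : n ≡ m + suc k * p
  n≡ = ℤₚ.+-injective (trans (identity (ℤ.+ m) (ℤ.+ n)) (cong (ℤ._+_ (ℤ.+ m)) (trans (cong ℤ.-_ e)
         (trans (ℤₚ.neg-distribˡ-* ℤ.-[1+ k ] (ℤ.+ p)) (sym (ℤₚ.pos-* (suc k) p))))))

module Modular (M : ℕ) {{_ : NonZero M}} where
  infix 4 _≈_
  _≈_ : ℕ → ℕ → Set
  a ≈ b = a % M ≡ b % M

  ≈-+ : ∀ a b c e → a ≈ b → c ≈ e → a + c ≈ b + e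
  ≈-+ a b c e p q = trans (%-distribˡ-+ a c M) (trans (cong₂ (λ x y → (x + y) % M) p q) (sym (%-distribˡ-+ b e M)))

  ≈-* : ∀ a b c e → a ≈ b → c ≈ e → a * c ≈ b * e
  ≈-* a b c e p q = trans (%-distribˡ-* a c M) (trans (cong₂ (λ x y → (x * y) % M) p q) (sym (%-distribˡ-* b e M)))

  ≈-% : ∀ a → a % M ≈ a
  ≈-% a = m%n%n≡m%n a M

  ≈-∑ : ∀ n {f g} → (∀ i → i < n → f i ≈ g i) → ∑ n f ≈ ∑ n g
  ≈-∑ zero    h = refl
  ≈-∑ (suc n) {f} {g} h = ≈-+ (∑ n f) (∑ n g) (f n) (g n) (≈-∑ n λ i i<n → h i (m<n⇒m<1+n i<n)) (h n ≤-refl)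

  multiple≈0 : ∀ k → k * M ≈ 0
  multiple≈0 k = trans (m*n%n≡0 k M) (sym (m<n⇒m%n≡m (>-nonZero⁻¹ M)))

  ≈-cancelʳ : ∀ a b c → a + c ≈ b + c → a ≈ b
  ≈-cancelʳ a b c e = ∣ℤ⇒%≡ a b M (subst ((ℤ.+ M) ∣ℤ_) (identity (ℤ.+ a) (ℤ.+ b) (ℤ.+ c)) (%≡⇒∣ℤ (a + c) (b + c) M e))
    where
    identity : ∀ a b c → (a ℤ.+ c) ℤ.- (b ℤ.+ c) ≡ a ℤ.- b
    identity = ℤ-solver.solve-∀

  ≈-small : ∀ {a b} → a < M → b < M → a ≈ b → a ≡ b
  ≈-small a<M b<M e = trans (sym (m<n⇒m%n≡m a<M)) (trans e (m<n⇒m%n≡m b<M))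

  ≈0⇒∣ : ∀ {a} → a ≈ 0 → M ∣ a
  ≈0⇒∣ {a} e = m%n≡0⇒n∣m a M (trans e (m<n⇒m%n≡m (>-nonZero⁻¹ M)))

  ∣⇒≈0 : ∀ {a} → M ∣ a → a ≈ 0
  ∣⇒≈0 {a} d = trans (n∣m⇒m%n≡0 a M d) (sym (m<n⇒m%n≡m (>-nonZero⁻¹ M)))

  inverse : ∀ a → Coprime a M → ∃ λ v → a * v ≈ 1
  inverse a c with Coprimality.coprime-Bézout c
  ... | Bézout.+- x y e = x , trans (cong (_% M) (trans (*-comm a x) (sym e))) ([m+kn]%n≡m%n 1 y M)
  -- Here Bézout's identity makes -x the inverse, and -x is written x (M - 1).
  ... | Bézout.-+ x y e = x * pred M , ≈-cancelʳ (a * (x * pred M)) 1 M (trans (cong (_% M) eq) (trans ([m+kn]%n≡m%n 1 (pred M * y) M) (sym ([m+n]%n≡m%n 1 M))))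
    where
    step : ∀ a x m y → 1 + x * a ≡ y * suc m → a * (x * m) + suc m ≡ 1 + m * y * suc m
    step a x m y e = trans (identity a x m) (trans (cong (λ k → 1 + m * k) e) (cong suc (sym (*-assoc m y (suc m)))))
      where
      identity : ∀ a x m → a * (x * m) + suc m ≡ 1 + m * (1 + x * a)
      identity = solve-∀
    eq : a * (x * pred M) + M ≡ 1 + (pred M * y) * M
    eq = subst (λ N → a * (x * pred M) + N ≡ 1 + pred M * y * N) (suc-pred M) (step a x (pred M) y (trans e (cong (y *_) (sym (suc-pred M)))))

  inverse-cancel : ∀ a b x → a * b ≈ 1 → x < M → (b * ((a * x) % M)) % M ≡ x
  inverse-cancel a b x ab≈1 x<M = trans (≈-* b b ((a * x) % M) (a * x) refl (≈-% (a * x))) (trans (cong (_% M) (shuffle a b x))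
    (trans (≈-* (a * b) 1 x x ab≈1 refl) (trans (cong (_% M) (*-identityˡ x)) (m<n⇒m%n≡m x<M))))
    where
    shuffle : ∀ a b x → b * (a * x) ≡ a * b * x
    shuffle = solve-∀

-- The involution pairs off the points that it moves.
involution-parity : ∀ n (μ g : ℕ → ℕ) → (∀ x → x < n → μ x < n) → (∀ x → x < n → μ (μ x) ≡ x) → (∀ x → x < n → g (μ x) ≡ g x) →
  ∑ n g % 2 ≡ ∑ n (λ x → ⟦ μ x ≟ x ⟧ * g x) % 2
involution-parity n μ g μ< μμ gμ = begin
  ∑ n g % 2                   ≡⟨ cong (_% 2) (trans (∑-cong n λ x _ → cases x) (trans (∑-+ n _ _) (cong (_+ F) (trans (∑-+ n _ _) (cong (L +_) upper≡lower))))) ⟩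
  (L + L + F) % 2             ≡⟨ cong (_% 2) (identity L F) ⟩
  (F + L * 2) % 2             ≡⟨ [m+kn]%n≡m%n F L 2 ⟩
  F % 2                       ∎
  where
  open ≡-Reasoning
  L F : ℕ
  L = ∑ n λ x → ⟦ x <? μ x ⟧ * g x
  F = ∑ n λ x → ⟦ μ x ≟ x ⟧ * g x
  identity : ∀ L F → L + L + F ≡ F + L * 2
  identity = solve-∀
  upper≡lower : ∑ n (λ x → ⟦ μ x <? x ⟧ * g x) ≡ L
  upper≡lower = trans (sym (∑-bij n μ μ (λ x → ⟦ μ x <? x ⟧ * g x) μ< μ< μμ μμ))
    (∑-cong n λ x x<n → cong₂ _*_ (⟦⟧-cong (μ (μ x) <? μ x) (x <? μ x) (subst (_< μ x) (μμ x x<n)) (subst (_< μ x) (sym (μμ x x<n)))) (gμ x x<n))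
  cases : ∀ x → g x ≡ ⟦ x <? μ x ⟧ * g x + ⟦ μ x <? x ⟧ * g x + ⟦ μ x ≟ x ⟧ * g x
  cases x with <-cmp x (μ x)
  ... | tri< a b c rewrite ⟦⟧-yes (x <? μ x) a | ⟦⟧-no (μ x <? x) c | ⟦⟧-no (μ x ≟ x) (b ∘ sym) = sym (trans (+-identityʳ _) (trans (+-identityʳ _) (+-identityʳ _)))
  ... | tri≈ a b c rewrite ⟦⟧-no (x <? μ x) a | ⟦⟧-no (μ x <? x) c | ⟦⟧-yes (μ x ≟ x) (sym b) = sym (+-identityʳ _)
  ... | tri> a b c rewrite ⟦⟧-no (x <? μ x) a | ⟦⟧-yes (μ x <? x) c | ⟦⟧-no (μ x ≟ x) (b ∘ sym) = sym (trans (+-identityʳ _) (+-identityʳ _))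

∑-reverse : ∀ n f → ∑ n f ≡ ∑ n (λ i → f (n ∸ suc i))
∑-reverse n f = sym (∑-bij n (λ i → n ∸ suc i) (λ i → n ∸ suc i) f lt lt inv inv)
  where
  lt : ∀ i → i < n → n ∸ suc i < n
  lt i i<n = ∸-monoʳ-< {n} {suc i} {0} (s≤s z≤n) i<n
  inv : ∀ i → i < n → n ∸ suc (n ∸ suc i) ≡ i
  inv i i<n = trans (cong (n ∸_) (sym (+-∸-assoc 1 i<n))) (m∸[m∸n]≡n (<⇒≤ i<n))

-- A bijection of ℤ/M commuting with negation preserves the sum of an even function over a half system; e ≤ 1 is the number of
-- self-negative nonzero residues.
module HalfSystem (h e M : ℕ) (M≡ : M ≡ suc (h + (e + h))) where
  suc<M : ∀ {k} → k < h + (e + h) → suc k < M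
  suc<M {k} k< = subst (suc k <_) (sym M≡) (s≤s k<)

  low<M : ∀ {k} → k < h → suc k < M
  low<M k<h = suc<M (≤-trans k<h (m≤m+n h (e + h)))

  0<M : 0 < M
  0<M = subst (0 <_) (sym M≡) (s≤s z≤n)

  Even : (ℕ → ℕ) → Set
  Even g = ∀ x → 1 ≤ x → x < M → g (M ∸ x) ≡ g x

  full : ∀ g → Even g → ∑ M g ≡ g 0 + (∑ e (λ j → g (suc (h + j))) + 2 * ∑ h (λ k → g (suc k)))
  full g even = begin
    ∑ M g                                                                    ≡⟨ trans (cong (λ m → ∑ m g) M≡) (∑-head (h + (e + h)) g) ⟩
    g 0 + ∑ (h + (e + h)) (λ k → g (suc k))                                  ≡⟨ cong (g 0 +_) (trans (∑-split h (e + h) _) (cong (H +_) (∑-split e h _))) ⟩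
    g 0 + (H + (E + ∑ h (λ k → g (suc (h + (e + k))))))                      ≡⟨ cong (λ s → g 0 + (H + (E + s))) (trans (∑-reverse h _) (∑-cong h reflect)) ⟩
    g 0 + (H + (E + H))                                                      ≡⟨ cong (g 0 +_) (identity H E) ⟩
    g 0 + (E + 2 * H)                                                        ∎
    where
    open ≡-Reasoning
    H E : ℕ
    H = ∑ h (λ k → g (suc k))
    E = ∑ e (λ j → g (suc (h + j)))
    identity : ∀ H E → H + (E + H) ≡ E + 2 * H
    identity = solve-∀
    reflect : ∀ k → k < h → g (suc (h + (e + (h ∸ suc k)))) ≡ g (suc k)
    reflect k k<h = trans (cong g (sym M∸)) (even (suc k) (s≤s z≤n) (low<M k<h))
      where
      M∸ : M ∸ suc k ≡ suc (h + (e + (h ∸ suc k)))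
      M∸ = trans (cong (_∸ suc k) (trans M≡ (sym (identity′ h e (h ∸ suc k) (suc k) (m∸n+n≡m k<h))))) (m+n∸n≡m _ (suc k))
        where
        identity′ : ∀ h e a b → a + b ≡ h → suc (h + (e + a)) + b ≡ suc (h + (e + h))
        identity′ h e a b refl = shuffle e a b
          where
          shuffle : ∀ e a b → suc (a + b + (e + a)) + b ≡ suc (a + b + (e + (a + b)))
          shuffle = solve-∀

  -- φ preserves the sum over all residues. By `full` this sum consists of the terms at 0 and at the
  -- self-negative residue, which φ fixes, and of twice the sum over the half system.
  half-bij : ∀ (φ ψ g : ℕ → ℕ) → (∀ i → i < M → φ i < M) → (∀ i → i < M → ψ i < M) →
    (∀ i → i < M → ψ (φ i) ≡ i) → (∀ i → i < M → φ (ψ i) ≡ i) →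
    φ 0 ≡ 0 → (∀ j → j < e → φ (suc (h + j)) ≡ suc (h + j)) → (∀ x → 1 ≤ x → x < M → φ (M ∸ x) ≡ M ∸ φ x) → Even g →
    ∑ h (λ k → g (φ (suc k))) ≡ ∑ h (λ k → g (suc k))
  half-bij φ ψ g φ< ψ< ψφ φψ φ0 φmid φneg even = *-cancelˡ-≡ _ _ 2 (+-cancelˡ-≡ (∑ e (λ j → g (suc (h + j)))) _ _ (+-cancelˡ-≡ (g 0) _ _ (begin
    g 0 + (∑ e (λ j → g (suc (h + j))) + 2 * ∑ h (λ k → g (φ (suc k))))
      ≡⟨ cong₂ _+_ (cong g φ0) (cong (_+ _) (∑-cong e λ j j<e → cong g (φmid j j<e))) ⟨
    g (φ 0) + (∑ e (λ j → g (φ (suc (h + j)))) + 2 * ∑ h (λ k → g (φ (suc k))))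
      ≡⟨ full (λ x → g (φ x)) (λ x 1≤x x<M → trans (cong g (φneg x 1≤x x<M)) (even (φ x) (φ≥1 x 1≤x x<M) (φ< x x<M))) ⟨
    ∑ M (λ x → g (φ x))
      ≡⟨ ∑-bij M φ ψ g φ< ψ< ψφ φψ ⟩
    ∑ M g
      ≡⟨ full g even ⟩
    g 0 + (∑ e (λ j → g (suc (h + j))) + 2 * ∑ h (λ k → g (suc k))) ∎)))
    where
    open ≡-Reasoning
    φ≥1 : ∀ x → 1 ≤ x → x < M → 1 ≤ φ x
    φ≥1 x 1≤x x<M with φ x in eq
    ... | suc _ = s≤s z≤n
    ... | zero  = ⊥-elim (<-irrefl (trans (sym (ψφ 0 0<M)) (trans (cong ψ (trans φ0 (sym eq))) (ψφ x x<M))) 1≤x)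

[m+kn]/n≡m/n+k : ∀ m k n .{{_ : NonZero n}} → (m + k * n) / n ≡ m / n + k
[m+kn]/n≡m/n+k m k n = trans (+-distrib-/-∣ʳ m (n∣m*n k)) (cong (m / n +_) (m*n/n≡m k n))

residues-sum : ∀ a b k M .{{_ : NonZero M}} → a + b ≡ k * M → ¬ (M ∣ a) → a % M + b % M ≡ M × suc (a / M + b / M) ≡ k
residues-sum a b k M e M∤a = sum , *-cancelʳ-≡ (suc (a / M + b / M)) k M (begin
    suc (a / M + b / M) * M                         ≡⟨ cong (_+ (a / M + b / M) * M) sum ⟨
    a % M + b % M + (a / M + b / M) * M             ≡⟨ total ⟩
    k * M                                           ∎)
  where
  open ≡-Reasoning
  identity : ∀ r s u v M → r + s + (u + v) * M ≡ (r + u * M) + (s + v * M)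
  identity = solve-∀
  total : a % M + b % M + (a / M + b / M) * M ≡ k * M
  total = trans (identity (a % M) (b % M) (a / M) (b / M) M) (trans (cong₂ _+_ (sym (m≡m%n+[m/n]*n a M)) (sym (m≡m%n+[m/n]*n b M))) e)
  a%M≥1 : 1 ≤ a % M
  a%M≥1 = n≢0⇒n>0 (λ eq → M∤a (m%n≡0⇒n∣m a M eq))
  sum : a % M + b % M ≡ M
  sum = one (∣m+n∣m⇒∣n {M} {(a / M + b / M) * M} {a % M + b % M} (divides k (trans (+-comm ((a / M + b / M) * M) (a % M + b % M)) total)) (n∣m*n (a / M + b / M)))
    where
    one : M ∣ a % M + b % M → a % M + b % M ≡ M
    one (divides 0 eq) = ⊥-elim (<⇒≱ a%M≥1 (≤-trans (m≤m+n (a % M) (b % M)) (≤-reflexive eq)))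
    one (divides 1 eq) = trans eq (*-identityˡ M)
    one (divides (suc (suc q)) eq) = ⊥-elim (<⇒≱ (+-mono-< (m%n<n a M) (m%n<n b M))
      (≤-trans (≤-trans (m≤m+n (M + M) (q * M)) (≤-reflexive (+-assoc M M (q * M)))) (≤-reflexive (sym eq))))

-- Quadratic reciprocity

pos-∸ : ∀ {m n} → n ≤ m → ℤ.+ (m ∸ n) ≡ ℤ.+ m ℤ.- ℤ.+ n
pos-∸ {m} {n} n≤m = trans (sym (ℤₚ.⊖-≥ n≤m)) (sym (ℤₚ.[+m]-[+n]≡m⊖n m n))

parity-flip : ∀ a b {a′ b′} → a + a′ ≡ 1 → b + b′ ≡ 1 → (a′ + b′) % 2 ≡ (a + b) % 2
parity-flip 0 0 refl refl = refl
parity-flip 0 1 refl refl = refl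
parity-flip 1 0 refl refl = refl
parity-flip 1 1 refl refl = refl
parity-flip (suc (suc a)) b () _
parity-flip 0 (suc (suc b)) _ ()
parity-flip 1 (suc (suc b)) _ ()

module Mod2 = Modular 2

⟦≤⟧+⟦<⟧ : ∀ m n → ⟦ m ≤? n ⟧ + ⟦ n <? m ⟧ ≡ 1
⟦≤⟧+⟦<⟧ m n = [ (λ m≤n → cong₂ _+_ (⟦⟧-yes (m ≤? n) m≤n) (⟦⟧-no (n <? m) (≤⇒≯ m≤n)))
             , (λ n<m → cong₂ _+_ (⟦⟧-no (m ≤? n) (<⇒≱ n<m)) (⟦⟧-yes (n <? m) n<m)) ]′ (≤-<-connex m n)

-- Gauss's lemma: for a prime M = 2h + 1 the parity of f u, the number of k ≤ h such that the residue of uk exceeds h, tells whether u is a square.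
-- Summing the even function E u over the half system { k⁻¹ } instead of { k } relates f u to the involutions x ↦ u / x and x ↦ 1 / x,
-- whose fixed points are the square roots of u and of 1.
module GaussLemma (h M : ℕ) {{M≢0 : NonZero M}} (M≡ : M ≡ suc (h + h)) (pp : Prime M) (1≤h : 1 ≤ h) where
  open HalfSystem h 0 M M≡
  open Modular M

  1<M : 1 < M
  1<M = prime≥2 pp

  0≉1 : ¬ (0 ≈ 1)
  0≉1 e = <-irrefl (≈-small 0<M 1<M e) (s≤s z≤n)

  ≈-cancel-* : ∀ x y z → ¬ (M ∣ x) → x * y ≈ x * z → y ≈ z
  ≈-cancel-* x y z M∤x e = ∣ℤ⇒%≡ y z M ([ (λ u → ⊥-elim (M∤x (ℤ∣.∣⇒∣ᵤ u))) , id ]′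
    (euclidℤ (ℤ.+ x) (ℤ.+ y ℤ.- ℤ.+ z) pp (subst ((ℤ.+ M) ∣ℤ_) eq (%≡⇒∣ℤ (x * y) (x * z) M e))))
    where
    identity : ∀ x y z → x ℤ.* y ℤ.- x ℤ.* z ≡ x ℤ.* (y ℤ.- z)
    identity = ℤ-solver.solve-∀
    eq : ℤ.+ (x * y) ℤ.- ℤ.+ (x * z) ≡ ℤ.+ x ℤ.* (ℤ.+ y ℤ.- ℤ.+ z)
    eq = trans (cong₂ ℤ._-_ (ℤₚ.pos-* x y) (ℤₚ.pos-* x z)) (identity (ℤ.+ x) (ℤ.+ y) (ℤ.+ z))

  M∤ : ∀ x → 1 ≤ x → x < M → ¬ (M ∣ x)
  M∤ x 1≤x x<M d = <⇒≱ x<M (∣⇒≤ {{>-nonZero 1≤x}} d)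

  M∤* : ∀ x y → ¬ (M ∣ x) → ¬ (M ∣ y) → ¬ (M ∣ x * y)
  M∤* x y a b d = [ a , b ]′ (euclidsLemma x y pp d)

  abstract
    inv : ℕ → ℕ
    inv zero    = 0
    inv (suc x) with suc x <? M
    ... | yes lt = proj₁ (inverse (suc x) (Coprimality.sym (Coprimality.prime⇒coprime pp lt))) % M
    ... | no  _  = 0

    inv-zero : inv 0 ≡ 0
    inv-zero = refl

    inv-< : ∀ x → inv x < M
    inv-< zero    = 0<M
    inv-< (suc x) with suc x <? M
    ... | yes lt = m%n<n (proj₁ (inverse (suc x) (Coprimality.sym (Coprimality.prime⇒coprime pp lt)))) M
    ... | no  _  = 0<M

    inv-* : ∀ x → 1 ≤ x → x < M → x * inv x ≈ 1
    inv-* (suc x) _ x<M with suc x <? M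
    ... | no x≮M = ⊥-elim (x≮M x<M)
    ... | yes lt = trans (≈-* (suc x) (suc x) (v % M) v refl (≈-% v)) (proj₂ (inverse (suc x) (Coprimality.sym (Coprimality.prime⇒coprime pp lt))))
      where
      v : ℕ
      v = proj₁ (inverse (suc x) (Coprimality.sym (Coprimality.prime⇒coprime pp lt)))

  inv≥1 : ∀ x → 1 ≤ x → x < M → 1 ≤ inv x
  inv≥1 x 1≤x x<M = n≢0⇒n>0 λ e → 0≉1 (trans (sym (cong (_% M) (trans (cong (x *_) e) (*-zeroʳ x)))) (inv-* x 1≤x x<M))

  inv-unique : ∀ x y → 1 ≤ x → x < M → y < M → x * y ≈ 1 → inv x ≡ y
  inv-unique x y 1≤x x<M y<M e = ≈-small (inv-< x) y<M (≈-cancel-* x (inv x) y (M∤ x 1≤x x<M) (trans (inv-* x 1≤x x<M) (sym e)))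

  inv-inv : ∀ x → x < M → inv (inv x) ≡ x
  inv-inv zero    _   = trans (cong inv inv-zero) inv-zero
  inv-inv (suc x) x<M = inv-unique (inv (suc x)) (suc x) (inv≥1 (suc x) (s≤s z≤n) x<M) (inv-< (suc x)) x<M
    (trans (cong (_% M) (*-comm (inv (suc x)) (suc x))) (inv-* (suc x) (s≤s z≤n) x<M))

  neg-* : ∀ x y → x ≤ M → y ≤ M → (M ∸ x) * (M ∸ y) ≈ x * y
  neg-* x y x≤M y≤M = ∣ℤ⇒%≡ ((M ∸ x) * (M ∸ y)) (x * y) M (ℤ∣.divides (ℤ.+ M ℤ.- ℤ.+ x ℤ.- ℤ.+ y)
    (trans (cong₂ ℤ._-_ (trans (ℤₚ.pos-* (M ∸ x) (M ∸ y)) (cong₂ ℤ._*_ (pos-∸ x≤M) (pos-∸ y≤M))) (ℤₚ.pos-* x y)) (identity (ℤ.+ M) (ℤ.+ x) (ℤ.+ y))))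
    where
    identity : ∀ m x y → (m ℤ.- x) ℤ.* (m ℤ.- y) ℤ.- x ℤ.* y ≡ (m ℤ.- x ℤ.- y) ℤ.* m
    identity = ℤ-solver.solve-∀

  inv-neg : ∀ x → 1 ≤ x → x < M → inv (M ∸ x) ≡ M ∸ inv x
  inv-neg x 1≤x x<M = inv-unique (M ∸ x) (M ∸ inv x) (m<n⇒0<n∸m x<M) (∸-monoʳ-< {M} {x} {0} 1≤x (<⇒≤ x<M))
    (∸-monoʳ-< {M} {inv x} {0} (inv≥1 x 1≤x x<M) (<⇒≤ (inv-< x))) (trans (neg-* x (inv x) (<⇒≤ x<M) (<⇒≤ (inv-< x))) (inv-* x 1≤x x<M))

  σ : ℕ → ℕ
  σ x = ⟦ h <? x % M ⟧

  σ-low : ∀ k → k < h → σ (suc k) ≡ 0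
  σ-low k k<h = ⟦⟧-no (h <? suc k % M) (subst (λ r → ¬ (h < r)) (sym (m<n⇒m%n≡m (low<M k<h))) (≤⇒≯ k<h))

  σ-neg : ∀ y z → y + z ≈ 0 → ¬ (M ∣ y) → σ y + σ z ≡ 1
  σ-neg y z e M∤y = trans (cong₂ _+_ (⟦⟧-cong (h <? r) (r′ ≤? h) upper⇒lower lower⇒upper) refl) (⟦≤⟧+⟦<⟧ r′ h)
    where
    r r′ : ℕ
    r = y % M
    r′ = z % M
    sum : r + r′ ≡ M
    sum = proj₁ (residues-sum y z (quotient M∣y+z) M (_∣_.equality M∣y+z) M∤y)
      where
      open _∣_
      M∣y+z : M ∣ y + z
      M∣y+z = ≈0⇒∣ {y + z} e
    upper⇒lower : h < r → r′ ≤ h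
    upper⇒lower h<r = +-cancelˡ-≤ (suc h) r′ h (≤-trans (+-monoˡ-≤ r′ h<r) (≤-reflexive (trans sum M≡)))
    lower⇒upper : r′ ≤ h → h < r
    lower⇒upper r′≤h = +-cancelʳ-≤ h (suc h) r (≤-trans (≤-reflexive (sym (trans sum M≡))) (+-monoʳ-≤ r r′≤h))

  -- Negating x flips both summands, so their parity is an even function of x, which `σ (u * x)`
  -- alone is not. On the lower half system `σ x` vanishes, so the second summand leaves the
  -- exponent of Gauss's lemma unchanged.
  E : ℕ → ℕ → ℕ
  E u x = (σ (u * x) + σ x) % 2

  complement : ∀ u x → x ≤ M → u * x + u * (M ∸ x) ≈ 0
  complement u x x≤M = trans (cong (_% M) (trans (sym (*-distribˡ-+ u x (M ∸ x))) (cong (u *_) (m+[n∸m]≡n x≤M)))) (multiple≈0 u)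

  E-even : ∀ u → ¬ (M ∣ u) → Even (E u)
  E-even u M∤u x 1≤x x<M = parity-flip (σ (u * x)) (σ x) (σ-neg (u * x) (u * (M ∸ x)) (complement u x (<⇒≤ x<M)) (M∤* u x M∤u (M∤ x 1≤x x<M)))
    (σ-neg x (M ∸ x) (trans (cong (_% M) (m+[n∸m]≡n (<⇒≤ x<M))) (trans (cong (_% M) (sym (*-identityˡ M))) (multiple≈0 1))) (M∤ x 1≤x x<M))

  -- For k ≤ h, `f u` counts the residues of u k above h, `G u` and `N u` those of u / k above h and
  -- at most h, and `s u` the square roots of u.
  f G N s : ℕ → ℕ
  f u = ∑ h λ k → σ (u * suc k)
  G u = ∑ h λ k → σ (u * inv (suc k))
  N u = ∑ h λ k → ⟦ (u * inv (suc k)) % M ≤? h ⟧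
  s u = ∑ h λ k → ⟦ (suc k * suc k) % M ≟ u % M ⟧

  f≈G+G : ∀ u → ¬ (M ∣ u) → f u Mod2.≈ G u + G 1
  f≈G+G u M∤u = begin
    f u % 2                                                   ≡⟨ Mod2.≈-∑ h (λ k k<h → cong (_% 2) (trans (sym (+-identityʳ _)) (cong (σ (u * suc k) +_) (sym (σ-low k k<h))))) ⟩
    ∑ h (λ k → σ (u * suc k) + σ (suc k)) % 2                 ≡⟨ Mod2.≈-∑ h (λ k _ → Mod2.≈-% (σ (u * suc k) + σ (suc k))) ⟨
    ∑ h (λ k → E u (suc k)) % 2                               ≡⟨ cong (_% 2) (half-bij inv inv (E u) (λ i _ → inv-< i) (λ i _ → inv-< i) inv-inv inv-inv inv-zero (λ j ()) inv-neg (E-even u M∤u)) ⟨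
    ∑ h (λ k → E u (inv (suc k))) % 2                         ≡⟨ Mod2.≈-∑ h (λ k _ → Mod2.≈-% (σ (u * inv (suc k)) + σ (inv (suc k)))) ⟩
    ∑ h (λ k → σ (u * inv (suc k)) + σ (inv (suc k))) % 2     ≡⟨ cong (_% 2) (trans (∑-+ h _ _) (cong (G u +_) (∑-cong h λ k _ → cong σ (sym (*-identityˡ (inv (suc k))))))) ⟩
    (G u + G 1) % 2                                           ∎
    where open ≡-Reasoning

  N+G : ∀ u → N u + G u ≡ h
  N+G u = trans (sym (∑-+ h _ _)) (trans (∑-cong h λ k _ → ⟦≤⟧+⟦<⟧ ((u * inv (suc k)) % M) h) (trans (∑-const h 1) (*-identityʳ h)))

  module Quotient (u : ℕ) (M∤u : ¬ (M ∣ u)) where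
    μ : ℕ → ℕ
    μ x = (u * inv x) % M

    μ-< : ∀ x → μ x < M
    μ-< x = m%n<n (u * inv x) M

    μ-zero : μ 0 ≡ 0
    μ-zero = trans (cong (_% M) (trans (cong (u *_) inv-zero) (*-zeroʳ u))) (m<n⇒m%n≡m 0<M)

    x*μx : ∀ x → 1 ≤ x → x < M → x * μ x ≈ u
    x*μx x 1≤x x<M = trans (≈-* x x (μ x) (u * inv x) refl (≈-% (u * inv x))) (trans (cong (_% M) (swap x u (inv x)))
      (trans (≈-* u u (x * inv x) 1 refl (inv-* x 1≤x x<M)) (cong (_% M) (*-identityʳ u))))
      where
      swap : ∀ x u v → x * (u * v) ≡ u * (x * v)
      swap = solve-∀

    μ≥1 : ∀ x → 1 ≤ x → x < M → 1 ≤ μ x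
    μ≥1 x 1≤x x<M = n≢0⇒n>0 λ e → M∤u (≈0⇒∣ (trans (sym (x*μx x 1≤x x<M)) (cong (_% M) (trans (cong (x *_) e) (*-zeroʳ x)))))

    μμ : ∀ x → x < M → μ (μ x) ≡ x
    μμ zero    _   = trans (cong μ μ-zero) μ-zero
    μμ (suc x) x<M = ≈-small (μ-< y) x<M (≈-cancel-* y (μ y) (suc x) (M∤ y y≥1 (μ-< (suc x)))
      (trans (x*μx y y≥1 (μ-< (suc x))) (trans (sym (x*μx (suc x) (s≤s z≤n) x<M)) (cong (_% M) (*-comm (suc x) y)))))
      where
      y = μ (suc x)
      y≥1 = μ≥1 (suc x) (s≤s z≤n) x<M

    low g : ℕ → ℕ
    low x = ⟦ 1 ≤? x ⟧ * ⟦ x ≤? h ⟧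
    g x = low x * low (μ x)

    low-in : ∀ x → 1 ≤ x → x ≤ h → low x ≡ 1
    low-in x a b = cong₂ _*_ (⟦⟧-yes (1 ≤? x) a) (⟦⟧-yes (x ≤? h) b)

    low-out : ∀ x → h < x → low x ≡ 0
    low-out x h<x = trans (cong (⟦ 1 ≤? x ⟧ *_) (⟦⟧-no (x ≤? h) (<⇒≱ h<x))) (*-zeroʳ ⟦ 1 ≤? x ⟧)

    restrict : ∀ (c : ℕ → ℕ) → ∑ M (λ x → c x * g x) ≡ ∑ h (λ k → c (suc k) * low (μ (suc k)))
    restrict c = trans (trans (cong (λ m → ∑ m (λ x → c x * g x)) M≡) (∑-head (h + h) _)) (trans (cong₂ _+_ (*-zeroʳ (c 0)) (∑-split h h _)) (trans (cong₂ _+_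
      (∑-cong h λ k k<h → cong (c (suc k) *_) (trans (cong (_* low (μ (suc k))) (low-in (suc k) (s≤s z≤n) k<h)) (*-identityˡ _)))
      (∑-zero h λ k k<h → trans (cong (λ l → c (suc (h + k)) * (l * low (μ (suc (h + k))))) (low-out (suc (h + k)) (s≤s (m≤m+n h k)))) (*-zeroʳ (c (suc (h + k))))))
      (+-identityʳ _)))

    fixed : ∀ k → k < h → ⟦ μ (suc k) ≟ suc k ⟧ * low (μ (suc k)) ≡ ⟦ (suc k * suc k) % M ≟ u % M ⟧
    fixed k k<h = trans (absorb (μ (suc k) ≟ suc k)) (⟦⟧-cong (μ (suc k) ≟ suc k) ((suc k * suc k) % M ≟ u % M)
      (λ e → trans (cong (λ y → (suc k * y) % M) (sym e)) (x*μx (suc k) (s≤s z≤n) (low<M k<h)))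
      (λ e → ≈-small (μ-< (suc k)) (low<M k<h) (≈-cancel-* (suc k) (μ (suc k)) (suc k) (M∤ (suc k) (s≤s z≤n) (low<M k<h))
               (trans (x*μx (suc k) (s≤s z≤n) (low<M k<h)) (sym e)))))
      where
      absorb : (q : Dec (μ (suc k) ≡ suc k)) → ⟦ q ⟧ * low (μ (suc k)) ≡ ⟦ q ⟧
      absorb (no _)  = refl
      absorb (yes e) = trans (*-identityˡ _) (trans (cong low e) (low-in (suc k) (s≤s z≤n) k<h))

    -- N u counts the x from 1 to h for which u / x lies there too. On this set x ↦ u / x is an
    -- involution, and its fixed points are the square roots of u.
    N≈s : N u Mod2.≈ s u
    N≈s = begin
      N u % 2                                            ≡⟨ cong (_% 2) (∑-cong h λ k k<h → sym (trans (*-identityˡ (low (μ (suc k)))) (trans (cong (_* ⟦ μ (suc k) ≤? h ⟧) (⟦⟧-yes (1 ≤? μ (suc k)) (μ≥1 (suc k) (s≤s z≤n) (low<M k<h)))) (*-identityˡ _)))) ⟩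
      ∑ h (λ k → 1 * low (μ (suc k))) % 2                ≡⟨ cong (_% 2) (trans (∑-cong M λ x _ → sym (*-identityˡ (g x))) (restrict (λ _ → 1))) ⟨
      ∑ M g % 2                                          ≡⟨ involution-parity M μ g (λ x _ → μ-< x) μμ (λ x x<M → trans (cong (λ y → low (μ x) * low y) (μμ x x<M)) (*-comm (low (μ x)) (low x))) ⟩
      ∑ M (λ x → ⟦ μ x ≟ x ⟧ * g x) % 2                  ≡⟨ cong (_% 2) (trans (restrict (λ x → ⟦ μ x ≟ x ⟧)) (∑-cong h fixed)) ⟩
      s u % 2                                            ∎
      where open ≡-Reasoning

  f+s+s : ∀ u → ¬ (M ∣ u) → f u + (s u + s 1) Mod2.≈ 0
  f+s+s u M∤u = begin
    (f u + (s u + s 1)) % 2               ≡⟨ Mod2.≈-+ (f u) (G u + G 1) (s u + s 1) (N u + N 1) (f≈G+G u M∤u) (Mod2.≈-+ (s u) (N u) (s 1) (N 1) (sym (Quotient.N≈s u M∤u)) (sym (Quotient.N≈s 1 (M∤ 1 ≤-refl 1<M)))) ⟩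
    (G u + G 1 + (N u + N 1)) % 2         ≡⟨ cong (_% 2) (trans (shuffle (G u) (G 1) (N u) (N 1)) (cong₂ _+_ (N+G u) (N+G 1))) ⟩
    (h + h) % 2                           ≡⟨ cong (_% 2) (double h) ⟩
    (h * 2) % 2                           ≡⟨ Mod2.multiple≈0 h ⟩
    0 ∎
    where
    open ≡-Reasoning
    shuffle : ∀ a b c e → a + b + (c + e) ≡ (c + a) + (e + b)
    shuffle = solve-∀
    double : ∀ h → h + h ≡ h * 2
    double = solve-∀

  s-one : s 1 ≡ 1
  s-one = trans (∑-cong h one) (∑-δ h 0 (λ _ → 1) 1≤h)
    where
    one : ∀ k → k < h → ⟦ (suc k * suc k) % M ≟ 1 % M ⟧ ≡ ⟦ k ≟ 0 ⟧ * 1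
    one k k<h = trans (⟦⟧-cong ((suc k * suc k) % M ≟ 1 % M) (k ≟ 0) to (λ { refl → refl })) (sym (*-identityʳ ⟦ k ≟ 0 ⟧))
      where
      identity : ∀ k → suc k * suc k ≡ k * (k + 2) + 1
      identity = solve-∀
      to : suc k * suc k ≈ 1 → k ≡ 0
      to e = [ (λ d → small k (<-trans (n<1+n k) (low<M k<h)) d)
             , (λ d → ⊥-elim (M∤ (k + 2) (≤-trans (s≤s z≤n) (m≤n+m 2 k)) k+2<M d)) ]′
             (euclidsLemma k (k + 2) pp (≈0⇒∣ {k * (k + 2)} (≈-cancelʳ (k * (k + 2)) 0 1 (trans (cong (_% M) (sym (identity k))) e))))
        where
        small : ∀ k → k < M → M ∣ k → k ≡ 0
        small zero    _   _ = refl
        small (suc k) k<M d = ⊥-elim (M∤ (suc k) (s≤s z≤n) k<M d)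
        k+2<M : k + 2 < M
        k+2<M = subst (k + 2 <_) (sym M≡) (s≤s (≤-trans (≤-reflexive (+-comm k 2)) (≤-trans (s≤s k<h) (+-monoˡ-≤ h 1≤h))))

  nonresidue-odd : ∀ d → ¬ (M ∣ d) → ¬ Split d M → f d Mod2.≈ 1
  nonresidue-odd d M∤d nonsplit = Mod2.≈-cancelʳ (f d) 1 1 (trans (cong (_% 2) (cong (f d +_) (sym (cong₂ _+_ s-zero s-one)))) (f+s+s d M∤d))
    where
    s-zero : s d ≡ 0
    s-zero = ∑-zero h λ k k<h → ⟦⟧-no ((suc k * suc k) % M ≟ d % M) λ e → nonsplit (suc k , low<M k<h ,
      ℤ∣.∣⇒∣ᵤ (subst (λ z → (ℤ.+ M) ∣ℤ (z ℤ.- ℤ.+ d)) (ℤₚ.pos-* (suc k) (suc k)) (%≡⇒∣ℤ (suc k * suc k) d M e)))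

-- Lattice points and the Jacobi symbol

∑-< : ∀ N c → c ≤ N → ∑ N (λ k → ⟦ k <? c ⟧) ≡ c
∑-< N c c≤N = trans (cong (λ n → ∑ n (λ k → ⟦ k <? c ⟧)) (sym (m+[n∸m]≡n c≤N))) (trans (∑-split c (N ∸ c) _)
  (trans (cong₂ _+_ (trans (∑-cong c λ k k<c → ⟦⟧-yes (k <? c) k<c) (trans (∑-const c 1) (*-identityʳ c)))
     (∑-zero (N ∸ c) λ k _ → ⟦⟧-no (c + k <? c) (≤⇒≯ (m≤m+n c k)))) (+-identityʳ c)))

floor-count : ∀ N m Y .{{_ : NonZero m}} → Y < suc N * m → ∑ N (λ k → ⟦ suc k * m ≤? Y ⟧) ≡ Y / m
floor-count N m Y Y< = trans (∑-cong N λ k _ → ⟦⟧-cong (suc k * m ≤? Y) (k <? Y / m)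
    (λ le → ≤-trans (≤-reflexive (sym (m*n/n≡m (suc k) m))) (/-monoˡ-≤ m le))
    (λ lt → ≤-trans (*-monoˡ-≤ m lt) (m/n*n≤m Y m)))
  (∑-< N (Y / m) (s≤s⁻¹ (m<n*o⇒m/o<n Y<)))

≤+≥ : ∀ x y → x ≢ y → ⟦ x ≤? y ⟧ + ⟦ y ≤? x ⟧ ≡ 1
≤+≥ x y x≢y = trans (cong (⟦ x ≤? y ⟧ +_) (⟦⟧-cong (y ≤? x) (y <? x) (λ le → ≤∧≢⇒< le (x≢y ∘ sym)) <⇒≤)) (⟦≤⟧+⟦<⟧ x y)

coprime-* : ∀ {a b q} → Coprime a q → Coprime b q → Coprime (a * b) q
coprime-* {a} {b} {q} ca cb {i} (i∣ab , i∣q) = cb (Coprimality.coprime-divisor (λ { (j∣i , j∣a) → ca (j∣a , ∣-trans j∣i i∣q) }) i∣ab , i∣q)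

coprime-% : ∀ {a q} .{{_ : NonZero q}} → Coprime a q → Coprime (a % q) q
coprime-% ca (i∣a% , i∣q) = ca (∣n∣m%n⇒∣m i∣q i∣a% , i∣q)

-- (−1)^χ n is the Jacobi symbol (d / n); for a prime n, counting the lattice points under the diagonal of a rectangle in two ways
-- turns the exponent of Gauss's lemma into an expression that is visibly periodic and multiplicative in n.
module Character (m : ℕ) where
  d D : ℕ
  d = suc m
  D = 2 * d

  L χ : ℕ → ℕ
  L n = ∑ m λ k → suc k * n / D
  χ n = m * (n / 2) + L n

  D≡ : D ≡ suc (m + (1 + m))
  D≡ = identity m
    where
    identity : ∀ m → 2 * suc m ≡ suc (m + (1 + m))
    identity = solve-∀

  module Reciprocity (h M : ℕ) {{M≢0 : NonZero M}} (M≡ : M ≡ suc (h + h)) (pp : Prime M) (1≤h : 1 ≤ h) (M∤2 : ¬ (M ∣ 2)) (M∤d : ¬ (M ∣ d)) where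
    open GaussLemma h M M≡ pp 1≤h
    open HalfSystem h 0 M M≡ using (low<M)

    -- The points (j, k) with 1 ≤ j ≤ h and 1 ≤ k ≤ m lie on one side or the other of the line k M =
    -- D j. None lies on it, because the prime M divides neither D nor j.
    lattice : ∑ h (λ j → D * suc j / M) + L M ≡ h * m
    lattice = begin
      ∑ h (λ j → D * suc j / M) + L M
        ≡⟨ cong₂ _+_ (∑-cong h λ j j<h → floor-count m M (D * suc j) (below j j<h)) (∑-cong m λ k k<m → floor-count h D (suc k * M) (above k k<m)) ⟨
      ∑ h (λ j → ∑ m (λ k → ⟦ suc k * M ≤? D * suc j ⟧)) + ∑ m (λ k → ∑ h (λ j → ⟦ suc j * D ≤? suc k * M ⟧))
        ≡⟨ cong (∑ h (λ j → ∑ m (λ k → ⟦ suc k * M ≤? D * suc j ⟧)) +_) (∑-swap m h _) ⟩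
      ∑ h (λ j → ∑ m (λ k → ⟦ suc k * M ≤? D * suc j ⟧)) + ∑ h (λ j → ∑ m (λ k → ⟦ suc j * D ≤? suc k * M ⟧))
        ≡⟨ trans (∑-cong h λ j _ → ∑-+ m _ _) (∑-+ h _ _) ⟨
      ∑ h (λ j → ∑ m (λ k → ⟦ suc k * M ≤? D * suc j ⟧ + ⟦ suc j * D ≤? suc k * M ⟧))
        ≡⟨ ∑-cong h (λ j j<h → ∑-cong m λ k _ → trans (cong (λ y → ⟦ suc k * M ≤? D * suc j ⟧ + ⟦ y ≤? suc k * M ⟧) (*-comm (suc j) D)) (≤+≥ (suc k * M) (D * suc j) (distinct j k j<h))) ⟩
      ∑ h (λ j → ∑ m (λ k → 1))
        ≡⟨ trans (∑-cong h λ _ _ → trans (∑-const m 1) (*-identityʳ m)) (∑-const h m) ⟩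
      h * m ∎
      where
      open ≡-Reasoning
      2j<M : ∀ j → j < h → 2 * suc j < M
      2j<M j j<h = subst (2 * suc j <_) (sym M≡) (s≤s (≤-trans (≤-reflexive (cong (suc j +_) (+-identityʳ (suc j)))) (+-mono-≤ j<h j<h)))
      below : ∀ j → j < h → D * suc j < suc m * M
      below j j<h = subst (_< d * M) (identity d (suc j)) (*-monoʳ-< d (2j<M j j<h))
        where
        identity : ∀ d j → d * (2 * j) ≡ 2 * d * j
        identity = solve-∀
      above : ∀ k → k < m → suc k * M < suc h * D
      above k k<m = <-≤-trans (*-monoˡ-< M (s≤s k<m)) (subst (λ M → d * M ≤ suc h * D) (sym M≡) (≤-trans (m≤m+n (d * suc (h + h)) d) (≤-reflexive (identity d h))))
        where
        identity : ∀ d h → d * suc (h + h) + d ≡ suc h * (2 * d)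
        identity = solve-∀
      distinct : ∀ j k → j < h → suc k * M ≢ D * suc j
      distinct j k j<h e = M∤* D (suc j) (M∤* 2 d M∤2 M∤d) (M∤ (suc j) (s≤s z≤n) (low<M j<h)) (divides (suc k) (sym e))

    -- The residue of y exceeds h = (M - 1) / 2 exactly when doubling it passes M, that is, when the
    -- quotient of 2 y by M is odd.
    σ≈floor : ∀ y → σ y Mod2.≈ 2 * y / M
    σ≈floor y = begin
      σ y % 2                           ≡⟨ [m+kn]%n≡m%n (σ y) (y / M) 2 ⟨
      (σ y + y / M * 2) % 2             ≡⟨ cong (λ s → (s + y / M * 2) % 2) (half (y % M) (m%n<n y M)) ⟨
      (2 * (y % M) / M + y / M * 2) % 2 ≡⟨ cong (_% 2) ([m+kn]/n≡m/n+k (2 * (y % M)) (y / M * 2) M) ⟨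
      ((2 * (y % M) + y / M * 2 * M) / M) % 2 ≡⟨ cong (λ z → (z / M) % 2) (trans (identity (y % M) (y / M) M) (cong (2 *_) (sym (m≡m%n+[m/n]*n y M)))) ⟩
      (2 * y / M) % 2                   ∎
      where
      open ≡-Reasoning
      identity : ∀ r q M → 2 * r + q * 2 * M ≡ 2 * (r + q * M)
      identity = solve-∀
      half : ∀ r → r < M → 2 * r / M ≡ ⟦ h <? r ⟧
      half r r<M = [ (λ r≤h → trans (m<n⇒m/n≡0 (subst (2 * r <_) (sym M≡) (s≤s (≤-trans (≤-reflexive (cong (r +_) (+-identityʳ r))) (+-mono-≤ r≤h r≤h))))) (sym (⟦⟧-no (h <? r) (≤⇒≯ r≤h))))
                   , (λ h<r → trans (≤-antisym (s≤s⁻¹ (m<n*o⇒m/o<n {2 * r} {2} {M} (*-monoʳ-< 2 r<M)))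
                        (m≥n⇒m/n>0 (subst (_≤ 2 * r) (sym M≡) (≤-trans (+-mono-≤ h<r (<⇒≤ h<r)) (≤-reflexive (cong (r +_) (sym (+-identityʳ r))))))))
                        (sym (⟦⟧-yes (h <? r) h<r))) ]′ (≤-<-connex r h)

    inert-odd : ¬ Split d M → χ M Mod2.≈ 1
    inert-odd nonsplit = begin
      (m * (M / 2) + L M) % 2                     ≡⟨ cong (λ t → (m * t + L M) % 2) M/2 ⟩
      (m * h + L M) % 2                           ≡⟨ cong (λ t → (t + L M) % 2) (trans (*-comm m h) (sym lattice)) ⟩
      (∑ h (λ j → D * suc j / M) + L M + L M) % 2 ≡⟨ cong (_% 2) (double (∑ h (λ j → D * suc j / M)) (L M)) ⟩
      (∑ h (λ j → D * suc j / M) + L M * 2) % 2   ≡⟨ [m+kn]%n≡m%n (∑ h (λ j → D * suc j / M)) (L M) 2 ⟩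
      ∑ h (λ j → D * suc j / M) % 2               ≡⟨ Mod2.≈-∑ h (λ j _ → trans (σ≈floor (d * suc j)) (cong (λ y → (y / M) % 2) (sym (*-assoc 2 d (suc j))))) ⟨
      f d % 2                                     ≡⟨ nonresidue-odd d M∤d nonsplit ⟩
      1 % 2                                       ∎
      where
      open ≡-Reasoning
      double : ∀ a b → a + b + b ≡ a + b * 2
      double = solve-∀
      M/2 : M / 2 ≡ h
      M/2 = trans (cong (_/ 2) (trans M≡ (cong suc (trans (cong (h +_) (sym (+-identityʳ h))) (*-comm 2 h))))) ([m+kn]/n≡m/n+k 1 h 2)

  odd-form : ∀ n → n % 2 ≡ 1 → n ≡ 1 + n / 2 * 2
  odd-form n e = trans (m≡m%n+[m/n]*n n 2) (cong (_+ n / 2 * 2) e)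

  module Multiplicative (n : ℕ) (n-odd : n % 2 ≡ 1) (n-coprime : Coprime n D) (n′ : ℕ) (n′-odd : n′ % 2 ≡ 1) (n′-coprime : Coprime n′ D) where
    open Modular D
    open HalfSystem m 1 D D≡

    -- The summand `x / D` vanishes on the residues themselves; it makes E periodic, since replacing
    -- x by x + D adds n + 1, an even number. E is even because the quotients of n x and n (D - x)
    -- by D add up to n - 1.
    E : ℕ → ℕ
    E x = (n * x / D + x / D) % 2

    D∤* : ∀ k x → Coprime k D → 1 ≤ x → x < D → ¬ (D ∣ k * x)
    D∤* k x c 1≤x x<D D∣kx = <⇒≱ x<D (∣⇒≤ {{>-nonZero 1≤x}} (Coprimality.coprime-divisor (Coprimality.sym c) D∣kx))

    complement : ∀ k x → x ≤ D → k * x + k * (D ∸ x) ≡ k * D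
    complement k x x≤D = trans (sym (*-distribˡ-+ k x (D ∸ x))) (cong (k *_) (m+[n∸m]≡n x≤D))

    E-even : Even E
    E-even x 1≤x x<D = trans (cong (λ t → (n * (D ∸ x) / D + t) % 2) (m<n⇒m/n≡0 (∸-monoʳ-< {D} {x} {0} 1≤x (<⇒≤ x<D))))
      (trans (trans (cong (_% 2) (+-identityʳ (n * (D ∸ x) / D))) (trans (sym opposite) (cong (_% 2) (sym (+-identityʳ (n * x / D))))))
        (cong (λ t → (n * x / D + t) % 2) (sym (m<n⇒m/n≡0 x<D))))
      where
      a b : ℕ
      a = n * x / D
      b = n * (D ∸ x) / D
      sum : suc (a + b) ≡ n
      sum = proj₂ (residues-sum (n * x) (n * (D ∸ x)) n D (complement n x (<⇒≤ x<D)) (D∤* n x n-coprime 1≤x x<D))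
      opposite : a % 2 ≡ b % 2
      opposite = Mod2.≈-cancelʳ a b b (begin
        (a + b) % 2              ≡⟨ cong (_% 2) (suc-injective (trans sum (odd-form n n-odd))) ⟩
        (n / 2 * 2) % 2          ≡⟨ Mod2.multiple≈0 (n / 2) ⟩
        0 % 2                    ≡⟨ Mod2.multiple≈0 b ⟨
        (b * 2) % 2              ≡⟨ cong (_% 2) (double b) ⟩
        (b + b) % 2              ∎)
        where
        open ≡-Reasoning
        double : ∀ b → b * 2 ≡ b + b
        double = solve-∀

    E-periodic : ∀ y → E (y % D) ≡ E y
    E-periodic y = begin
      (n * r / D + r / D) % 2                        ≡⟨ [m+kn]%n≡m%n (n * r / D + r / D) (suc (n / 2) * q) 2 ⟨
      (n * r / D + r / D + suc (n / 2) * q * 2) % 2  ≡⟨ cong (_% 2) (identity (n * r / D) (r / D) (n / 2) q) ⟩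
      (n * r / D + (1 + n / 2 * 2) * q + (r / D + q)) % 2 ≡⟨ cong (λ k → (n * r / D + k * q + (r / D + q)) % 2) (odd-form n n-odd) ⟨
      (n * r / D + n * q + (r / D + q)) % 2          ≡⟨ cong (_% 2) (cong₂ _+_ ([m+kn]/n≡m/n+k (n * r) (n * q) D) ([m+kn]/n≡m/n+k r q D)) ⟨
      ((n * r + n * q * D) / D + (r + q * D) / D) % 2 ≡⟨ cong₂ (λ a b → (a / D + b / D) % 2) (trans (expand n r q D) (cong (n *_) (sym y≡))) (sym y≡) ⟩
      (n * y / D + y / D) % 2                        ∎
      where
      open ≡-Reasoning
      r q : ℕ
      r = y % D
      q = y / D
      y≡ : y ≡ r + q * D
      y≡ = m≡m%n+[m/n]*n y D
      identity : ∀ a b w q → a + b + suc w * q * 2 ≡ a + (1 + w * 2) * q + (b + q)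
      identity = solve-∀
      expand : ∀ n r q D → n * r + n * q * D ≡ n * (r + q * D)
      expand = solve-∀

    v : ℕ
    v = proj₁ (inverse n′ n′-coprime)

    -- The left side is the sum of E (n′ k) over the half system. Multiplication by n′ permutes the
    -- residues, commutes with negation and fixes the self-negative residue d because n′ is odd, so
    -- the sum equals that of E (k).
    L-shift : L (n * n′) + L n′ Mod2.≈ L n
    L-shift = begin
      (L (n * n′) + L n′) % 2                                          ≡⟨ cong (_% 2) (∑-+ m _ _) ⟨
      ∑ m (λ k → suc k * (n * n′) / D + suc k * n′ / D) % 2            ≡⟨ Mod2.≈-∑ m (λ k _ → cong (_% 2) (cong₂ (λ a b → a / D + b / D) (shuffle (suc k) n n′) (*-comm (suc k) n′))) ⟩
      ∑ m (λ k → n * (n′ * suc k) / D + n′ * suc k / D) % 2            ≡⟨ Mod2.≈-∑ m (λ k _ → Mod2.≈-% (n * (n′ * suc k) / D + n′ * suc k / D)) ⟨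
      ∑ m (λ k → E (n′ * suc k)) % 2                                   ≡⟨ cong (_% 2) (∑-cong m λ k _ → E-periodic (n′ * suc k)) ⟨
      ∑ m (λ k → E ((n′ * suc k) % D)) % 2
        ≡⟨ cong (_% 2) (half-bij (λ x → (n′ * x) % D) (λ x → (v * x) % D) E (λ x _ → m%n<n (n′ * x) D) (λ x _ → m%n<n (v * x) D)
             (λ x x<D → inverse-cancel n′ v x (proj₂ (inverse n′ n′-coprime)) x<D)
             (λ x x<D → inverse-cancel v n′ x (trans (cong (_% D) (*-comm v n′)) (proj₂ (inverse n′ n′-coprime))) x<D)
             (trans (cong (_% D) (*-zeroʳ n′)) (m<n⇒m%n≡m 0<M)) middle negation E-even) ⟩
      ∑ m (λ k → E (suc k)) % 2                                        ≡⟨ Mod2.≈-∑ m (λ k _ → Mod2.≈-% (n * suc k / D + suc k / D)) ⟩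
      ∑ m (λ k → n * suc k / D + suc k / D) % 2                        ≡⟨ cong (_% 2) (∑-cong m λ k k<m → trans (cong (n * suc k / D +_) (m<n⇒m/n≡0 (low<M k<m))) (trans (+-identityʳ _) (cong (_/ D) (*-comm n (suc k))))) ⟩
      L n % 2                                                          ∎
      where
      open ≡-Reasoning
      shuffle : ∀ k n n′ → k * (n * n′) ≡ n * (n′ * k)
      shuffle = solve-∀
      mid<D : suc (m + 0) < D
      mid<D = subst (suc (m + 0) <_) (sym D≡) (s≤s (≤-trans (≤-reflexive (sym (+-suc m 0))) (+-monoʳ-≤ m (s≤s z≤n))))
      middle : ∀ j → j < 1 → (n′ * suc (m + j)) % D ≡ suc (m + j)
      middle zero    _ = trans (cong (_% D) (trans (cong (_* suc (m + 0)) (odd-form n′ n′-odd)) (identity (n′ / 2) m)))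
                            (trans ([m+kn]%n≡m%n (suc (m + 0)) (n′ / 2) D) (m<n⇒m%n≡m mid<D))
        where
        identity : ∀ w m → (1 + w * 2) * suc (m + 0) ≡ suc (m + 0) + w * (2 * suc m)
        identity = solve-∀
      middle (suc j) (s≤s ())
      negation : ∀ x → 1 ≤ x → x < D → (n′ * (D ∸ x)) % D ≡ D ∸ (n′ * x) % D
      negation x 1≤x x<D = sym (trans (cong (_∸ (n′ * x) % D) (sym (proj₁ (residues-sum (n′ * x) (n′ * (D ∸ x)) n′ D (complement n′ x (<⇒≤ x<D)) (D∤* n′ x n′-coprime 1≤x x<D)))))
        (m+n∸m≡n ((n′ * x) % D) ((n′ * (D ∸ x)) % D)))

    χ-* : χ (n * n′) Mod2.≈ χ n + χ n′
    χ-* = Mod2.≈-cancelʳ (χ (n * n′)) (χ n + χ n′) (L n′) (begin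
      (m * (n * n′ / 2) + L (n * n′) + L n′) % 2       ≡⟨ cong (_% 2) (+-assoc (m * (n * n′ / 2)) (L (n * n′)) (L n′)) ⟩
      (m * (n * n′ / 2) + (L (n * n′) + L n′)) % 2     ≡⟨ Mod2.≈-+ (m * (n * n′ / 2)) (m * (n * n′ / 2)) (L (n * n′) + L n′) (L n) refl L-shift ⟩
      (m * (n * n′ / 2) + L n) % 2                     ≡⟨ cong (λ t → (m * t + L n) % 2) (trans (cong (_/ 2) product-odd) ([m+kn]/n≡m/n+k 1 _ 2)) ⟩
      (m * (a + b + a * b * 2) + L n) % 2              ≡⟨ [m+kn]%n≡m%n (m * (a + b + a * b * 2) + L n) (L n′) 2 ⟨
      (m * (a + b + a * b * 2) + L n + L n′ * 2) % 2   ≡⟨ cong (_% 2) (identity m a b (L n) (L n′)) ⟩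
      (m * a + L n + (m * b + L n′) + L n′ + m * (a * b) * 2) % 2 ≡⟨ [m+kn]%n≡m%n (χ n + χ n′ + L n′) (m * (a * b)) 2 ⟩
      (χ n + χ n′ + L n′) % 2                          ∎)
      where
      open ≡-Reasoning
      a b : ℕ
      a = n / 2
      b = n′ / 2
      expand : ∀ a b → (1 + a * 2) * (1 + b * 2) ≡ 1 + (a + b + a * b * 2) * 2
      expand = solve-∀
      product-odd : n * n′ ≡ 1 + (a + b + a * b * 2) * 2
      product-odd = trans (cong₂ _*_ (odd-form n n-odd) (odd-form n′ n′-odd)) (expand a b)
      identity : ∀ m a b l l′ → m * (a + b + a * b * 2) + l + l′ * 2 ≡ m * a + l + (m * b + l′) + l′ + m * (a * b) * 2
      identity = solve-∀

  -- The period is 2 D = 4 d: adding it to r adds m D to the first summand, where D is even, and 2 k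
  -- to each quotient in `L`.
  χ-periodic : ∀ r s → χ (r + s * (2 * D)) Mod2.≈ χ r
  χ-periodic r s = begin
    (m * ((r + s * (2 * D)) / 2) + L (r + s * (2 * D))) % 2
      ≡⟨ cong (_% 2) (cong₂ _+_ (cong (m *_) (trans (cong (λ t → (r + t) / 2) (e₁ s D)) ([m+kn]/n≡m/n+k r (s * D) 2)))
           (trans (∑-cong m λ k _ → trans (cong (_/ D) (e₂ (suc k) r s D)) ([m+kn]/n≡m/n+k (suc k * r) (suc k * s * 2) D)) (∑-+ m _ _))) ⟩
    (m * (r / 2 + s * D) + (L r + ∑ m (λ k → suc k * s * 2))) % 2
      ≡⟨ cong (λ t → (m * (r / 2 + s * D) + (L r + t)) % 2) (∑-*ʳ m 2 _) ⟩
    (m * (r / 2 + s * D) + (L r + ∑ m (λ k → suc k * s) * 2)) % 2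
      ≡⟨ cong (_% 2) (e₃ m (r / 2) s d (L r) (∑ m (λ k → suc k * s))) ⟩
    (m * (r / 2) + L r + (m * (s * d) + ∑ m (λ k → suc k * s)) * 2) % 2
      ≡⟨ [m+kn]%n≡m%n (χ r) (m * (s * d) + ∑ m (λ k → suc k * s)) 2 ⟩
    χ r % 2 ∎
    where
    open ≡-Reasoning
    e₁ : ∀ s D → s * (2 * D) ≡ s * D * 2
    e₁ = solve-∀
    e₂ : ∀ k r s D → k * (r + s * (2 * D)) ≡ k * r + k * s * 2 * D
    e₂ = solve-∀
    e₃ : ∀ m a s d l t → m * (a + s * (2 * d)) + (l + t * 2) ≡ m * a + l + (m * (s * d) + t) * 2
    e₃ = solve-∀

  -- The modulus is a multiple of the period 4 d, so that w can later take up all small primes and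
  -- leave only large ones to the sieve.
  module Classes (w : ℕ) (q : ℕ) {{_ : NonZero q}} (q≡ : q ≡ w * (2 * D)) where
    open Modular q

    Unit OddClass : ℕ → Set
    Unit n = Coprime n q
    OddClass n = Unit n × χ n % 2 ≡ 1

    unit? : ∀ n → Dec (Unit n)
    unit? n = Coprimality.coprime? n q

    oddClass? : ∀ n → Dec (OddClass n)
    oddClass? n = unit? n ×-dec (χ n % 2 ≟ 1)

    evenClass? : ∀ n → Dec (Unit n × χ n % 2 ≡ 0)
    evenClass? n = unit? n ×-dec (χ n % 2 ≟ 0)

    units oddClasses : ℕ
    units = ∑ q λ n → ⟦ unit? n ⟧
    oddClasses = ∑ q λ n → ⟦ oddClass? n ⟧

    χ-% : ∀ n → χ (n % q) Mod2.≈ χ n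
    χ-% n = trans (sym (χ-periodic (n % q) (n / q * w))) (cong (λ t → χ t % 2) (trans (cong (n % q +_) (trans (*-assoc (n / q) w (2 * D)) (cong (n / q *_) (sym q≡)))) (sym (m≡m%n+[m/n]*n n q))))

    D∣q : D ∣ q
    D∣q = subst (D ∣_) (sym q≡) (∣-trans (n∣m*n 2) (n∣m*n w))

    unit-coprime : ∀ {n} → Unit n → Coprime n D
    unit-coprime u (i∣n , i∣D) = u (i∣n , ∣-trans i∣D D∣q)

    unit-odd : ∀ {n} → Unit n → n % 2 ≡ 1
    unit-odd {n} u = odd (n % 2) refl (m%n<n n 2)
      where
      odd : ∀ r → n % 2 ≡ r → r < 2 → n % 2 ≡ 1
      odd 0 e _ = ⊥-elim (2≢1 (u (m%n≡0⇒n∣m n 2 e , ∣-trans (m∣m*n d) D∣q)))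
        where
        2≢1 : ¬ (2 ≡ 1)
        2≢1 ()
      odd 1 e _ = e
      odd (suc (suc r)) e (s≤s (s≤s ()))

    unit-split : ∀ n → ⟦ unit? n ⟧ ≡ ⟦ oddClass? n ⟧ + ⟦ evenClass? n ⟧
    unit-split n = go (χ n % 2) refl (m%n<n (χ n) 2)
      where
      go : ∀ r → χ n % 2 ≡ r → r < 2 → ⟦ unit? n ⟧ ≡ ⟦ oddClass? n ⟧ + ⟦ evenClass? n ⟧
      go 0 e _ = cong₂ _+_ {0} (sym (⟦⟧-no (oddClass? n) λ { (_ , e′) → 0≢1+n (trans (sym e) e′) })) (⟦⟧-cong (unit? n) (evenClass? n) (_, e) proj₁)
      go 1 e _ = trans (sym (+-identityʳ ⟦ unit? n ⟧)) (cong₂ _+_ (⟦⟧-cong (unit? n) (oddClass? n) (_, e) proj₁) (sym (⟦⟧-no (evenClass? n) λ { (_ , e′) → 0≢1+n (trans (sym e′) e) })))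
      go (suc (suc r)) e (s≤s (s≤s ()))

    -- Multiplication by an element of an odd class maps odd classes into even ones.
    module Shift (b : ℕ) (b-odd : OddClass b) where
      v : ℕ
      v = proj₁ (inverse b (proj₁ b-odd))

      oddClasses≤ : oddClasses ≤ ∑ q (λ n → ⟦ evenClass? n ⟧)
      oddClasses≤ = ≤-trans (∑-mono q λ n _ → ⟦⟧-mono (oddClass? n) (evenClass? ((b * n) % q)) shift)
        (≤-reflexive (∑-bij q (λ x → (b * x) % q) (λ x → (v * x) % q) (λ n → ⟦ evenClass? n ⟧) (λ x _ → m%n<n (b * x) q) (λ x _ → m%n<n (v * x) q)
          (λ x x<q → inverse-cancel b v x (proj₂ (inverse b (proj₁ b-odd))) x<q)
          (λ x x<q → inverse-cancel v b x (trans (cong (_% q) (*-comm v b)) (proj₂ (inverse b (proj₁ b-odd)))) x<q)))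
        where
        shift : ∀ {n} → OddClass n → Unit ((b * n) % q) × χ ((b * n) % q) % 2 ≡ 0
        shift {n} (u , e) = coprime-% (coprime-* (proj₁ b-odd) u) , trans (χ-% (b * n))
          (trans (Multiplicative.χ-* b (unit-odd (proj₁ b-odd)) (unit-coprime (proj₁ b-odd)) n (unit-odd u) (unit-coprime u))
            (Mod2.≈-+ (χ b) 1 (χ n) 1 (proj₂ b-odd) e))

    -- If some odd class exists, multiplication by it embeds the odd classes into the even ones;
    -- otherwise the left side is 0.
    half-classes : 2 * oddClasses ≤ units
    half-classes = go (anyUpTo? oddClass? q)
      where
      go : Dec (∃ λ b → b < q × OddClass b) → 2 * oddClasses ≤ units
      go (no none) = ≤-trans (≤-reflexive (cong (2 *_) (∑-zero q λ n n<q → ⟦⟧-no (oddClass? n) λ o → none (n , n<q , o)))) z≤n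
      go (yes (b , _ , o)) = ≤-trans (≤-reflexive (cong (oddClasses +_) (+-identityʳ oddClasses))) (≤-trans (+-monoʳ-≤ oddClasses (Shift.oddClasses≤ b o))
        (≤-reflexive (sym (trans (∑-cong q λ n _ → unit-split n) (∑-+ q _ _)))))

-- Selberg's sieve

∑ℤ : ℕ → (ℕ → ℤ) → ℤ
∑ℤ zero    f = ℤ.0ℤ
∑ℤ (suc n) f = ∑ℤ n f ℤ.+ f n

∑ℤ-cong : ∀ n {f g} → (∀ i → f i ≡ g i) → ∑ℤ n f ≡ ∑ℤ n g
∑ℤ-cong zero    h = refl
∑ℤ-cong (suc n) h = cong₂ ℤ._+_ (∑ℤ-cong n h) (h n)

∑ℤ-+ : ∀ n f g → ∑ℤ n (λ i → f i ℤ.+ g i) ≡ ∑ℤ n f ℤ.+ ∑ℤ n g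
∑ℤ-+ zero    f g = refl
∑ℤ-+ (suc n) f g = trans (cong (ℤ._+ (f n ℤ.+ g n)) (∑ℤ-+ n f g)) (shuffle (∑ℤ n f) (∑ℤ n g) (f n) (g n))
  where
  shuffle : ∀ a b c e → a ℤ.+ b ℤ.+ (c ℤ.+ e) ≡ a ℤ.+ c ℤ.+ (b ℤ.+ e)
  shuffle = ℤ-solver.solve-∀

∑ℤ-* : ∀ n c f → ∑ℤ n (λ i → c ℤ.* f i) ≡ c ℤ.* ∑ℤ n f
∑ℤ-* zero    c f = sym (ℤₚ.*-zeroʳ c)
∑ℤ-* (suc n) c f = trans (cong (ℤ._+ c ℤ.* f n) (∑ℤ-* n c f)) (sym (ℤₚ.*-distribˡ-+ c (∑ℤ n f) (f n)))

∑ℤ-const : ∀ n c → ∑ℤ n (λ _ → c) ≡ c ℤ.* ℤ.+ n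
∑ℤ-const zero    c = sym (ℤₚ.*-zeroʳ c)
∑ℤ-const (suc n) c = trans (cong (ℤ._+ c) (∑ℤ-const n c)) (identity c (ℤ.+ n))
  where
  identity : ∀ c n → c ℤ.* n ℤ.+ c ≡ c ℤ.* (ℤ.1ℤ ℤ.+ n)
  identity = ℤ-solver.solve-∀

∑ℤ-pos : ∀ n f → ∑ℤ n (λ i → ℤ.+ f i) ≡ ℤ.+ ∑ n f
∑ℤ-pos zero    f = refl
∑ℤ-pos (suc n) f = cong (ℤ._+ ℤ.+ f n) (∑ℤ-pos n f)

∣x+ky+mz∣≤ : ∀ x k y m z → ℤ.∣ x ℤ.+ k ℤ.* y ℤ.+ m ℤ.* z ∣ ≤ ℤ.∣ x ∣ + ℤ.∣ k ∣ * ℤ.∣ y ∣ + ℤ.∣ m ∣ * ℤ.∣ z ∣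
∣x+ky+mz∣≤ x k y m z = ≤-trans (ℤₚ.∣i+j∣≤∣i∣+∣j∣ (x ℤ.+ k ℤ.* y) (m ℤ.* z)) (+-mono-≤
  (≤-trans (ℤₚ.∣i+j∣≤∣i∣+∣j∣ x (k ℤ.* y)) (+-monoʳ-≤ ℤ.∣ x ∣ (≤-reflexive (ℤₚ.∣i*j∣≡∣i∣*∣j∣ k y)))) (≤-reflexive (ℤₚ.∣i*j∣≡∣i∣*∣j∣ m z)))

Avoids : List ℕ → ℕ → Set
Avoids L n = All (λ e → ¬ (suc e ∣ n)) L

-- Storing p - 1 keeps the sieve weights p - 1 free of subtraction. The condition `3 ≤ e` serves to
-- simplify the error term in `error≤ΠD`.
data Sieving : List ℕ → Set where
  []  : Sieving []
  add : ∀ {e L} → Prime (suc e) → 3 ≤ e → All (e ≢_) L → Sieving L → Sieving (e ∷ L)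

avoids-* : ∀ {L} b e → Sieving L → Prime (suc e) → All (e ≢_) L → Avoids L b → Avoids L (b * suc e)
avoids-* b e [] pe [] [] = []
avoids-* b e (add pf _ _ s) pe (e≢f ∷ ds) (f∤b ∷ av) =
  (λ d → [ f∤b , (λ f∣e → e≢f (sym (suc-injective (prime∣prime pf pe f∣e)))) ]′ (euclidsLemma b (suc e) pf d)) ∷ avoids-* b e s pe ds av

-- All progressions with step prime to L are treated at once because the induction passes from a
-- progression with step b to its terms divisible by a new prime p, which form a progression with
-- step b p.
record Mean (L : List ℕ) (g : ℕ → ℤ) (μ ε : ℕ) : Set where
  field estimate : ∀ a b T → Avoids L b → ℤ.∣ ∑ℤ T (λ t → g (a + b * t)) ℤ.- ℤ.+ μ ℤ.* ℤ.+ T ∣ ≤ ε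
open Mean

mean-cong : ∀ {L f g μ ε μ′ ε′} → (∀ n → f n ≡ g n) → μ ≡ μ′ → ε ≤ ε′ → Mean L f μ ε → Mean L g μ′ ε′
mean-cong {μ = μ} f≡g refl ε≤ mean .estimate a b T av = ≤-trans (≤-reflexive (cong (λ s → ℤ.∣ s ℤ.- ℤ.+ μ ℤ.* ℤ.+ T ∣) (∑ℤ-cong T λ t → sym (f≡g (a + b * t))))) (≤-trans (estimate mean a b T av) ε≤)

mean-+ : ∀ {L f g μ ν ε δ} → Mean L f μ ε → Mean L g ν δ → Mean L (λ n → f n ℤ.+ g n) (μ + ν) (ε + δ)
mean-+ {f = f} {g} {μ} {ν} mf mg .estimate a b T av = ≤-trans (≤-reflexive (cong ℤ.∣_∣ (trans (cong (ℤ._- ℤ.+ (μ + ν) ℤ.* ℤ.+ T) (∑ℤ-+ T _ _))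
    (identity (∑ℤ T (λ t → f (a + b * t))) (∑ℤ T (λ t → g (a + b * t))) (ℤ.+ μ) (ℤ.+ ν) (ℤ.+ T)))))
  (≤-trans (ℤₚ.∣i+j∣≤∣i∣+∣j∣ (∑ℤ T (λ t → f (a + b * t)) ℤ.- ℤ.+ μ ℤ.* ℤ.+ T) (∑ℤ T (λ t → g (a + b * t)) ℤ.- ℤ.+ ν ℤ.* ℤ.+ T)) (+-mono-≤ (estimate mf a b T av) (estimate mg a b T av)))
  where
  identity : ∀ x y m n t → (x ℤ.+ y) ℤ.- (m ℤ.+ n) ℤ.* t ≡ (x ℤ.- m ℤ.* t) ℤ.+ (y ℤ.- n ℤ.* t)
  identity = ℤ-solver.solve-∀

mean-scale : ∀ {L f μ ε} c → Mean L f μ ε → Mean L (λ n → ℤ.+ c ℤ.* f n) (c * μ) (c * ε)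
mean-scale {f = f} {μ} c mf .estimate a b T av = ≤-trans (≤-reflexive (trans (cong ℤ.∣_∣ (trans (cong₂ (λ x y → x ℤ.- y ℤ.* ℤ.+ T) (∑ℤ-* T (ℤ.+ c) _) (ℤₚ.pos-* c μ))
    (identity (ℤ.+ c) (∑ℤ T (λ t → f (a + b * t))) (ℤ.+ μ) (ℤ.+ T)))) (ℤₚ.∣i*j∣≡∣i∣*∣j∣ (ℤ.+ c) (∑ℤ T (λ t → f (a + b * t)) ℤ.- ℤ.+ μ ℤ.* ℤ.+ T)))) (*-monoʳ-≤ c (estimate mf a b T av))
  where
  identity : ∀ c x m t → c ℤ.* x ℤ.- c ℤ.* m ℤ.* t ≡ c ℤ.* (x ℤ.- m ℤ.* t)
  identity = ℤ-solver.solve-∀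

hit : ℕ → ℕ → ℤ
hit e n = ℤ.+ ⟦ suc e ∣? n ⟧

module Hits (e : ℕ) (pe : Prime (suc e)) (g : ℕ → ℤ) (a b : ℕ) (p∤b : ¬ (suc e ∣ b)) where
  open Modular (suc e)

  b-coprime : Coprime b (suc e)
  b-coprime {i} (i∣b , i∣p) = [ id , (λ i≡p → ⊥-elim (p∤b (subst (_∣ b) i≡p i∣b))) ]′ (prime⇒irreducible pe i∣p)

  v t₀ : ℕ
  v = proj₁ (inverse b b-coprime)
  -- Modulo p = e + 1 the factor e is -1, so t₀ is -a / b.
  t₀ = (v * (e * a)) % suc e

  first-hit : suc e ∣ a + b * t₀
  first-hit = ≈0⇒∣ (trans (≈-+ a a (b * t₀) (e * a) refl (trans (≈-* b b t₀ (v * (e * a)) refl (≈-% (v * (e * a))))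
      (trans (cong (_% suc e) (sym (*-assoc b v (e * a)))) (trans (≈-* (b * v) 1 (e * a) (e * a) (proj₂ (inverse b b-coprime)) refl) (cong (_% suc e) (*-identityˡ (e * a)))))))
    (trans (cong (_% suc e) (*-comm (suc e) a)) (multiple≈0 a)))

  -- `remaining` is the number of steps from T to the next index t with p ∣ a + b t, so `position`
  -- locates that index.
  record State (T : ℕ) : Set where
    field
      count remaining : ℕ
      remaining< : remaining < suc e
      position : T + remaining ≡ t₀ + suc e * count
      sum≡ : ∑ℤ T (λ t → hit e (a + b * t) ℤ.* g (a + b * t)) ≡ ∑ℤ count (λ s → g (a + b * t₀ + b * suc e * s))

  state : ∀ T → State T
  state zero = record { count = 0 ; remaining = t₀ ; remaining< = m%n<n (v * (e * a)) (suc e)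
    ; position = trans (sym (+-identityʳ t₀)) (cong (t₀ +_) (sym (*-zeroʳ (suc e)))) ; sum≡ = refl }
  state (suc T) = next (state T)
    where
    next : State T → State (suc T)
    next record { count = c ; remaining = zero ; remaining< = _ ; position = pos ; sum≡ = eq } = record
      { count = suc c ; remaining = e ; remaining< = ≤-refl ; position = position′
      ; sum≡ = cong₂ ℤ._+_ eq (trans (cong (ℤ._* g (a + b * T)) (cong ℤ.+_ (⟦⟧-yes (suc e ∣? (a + b * T)) (subst (suc e ∣_) (sym index) (∣m∣n⇒∣m+n first-hit (∣m⇒∣m*n c (n∣m*n b)))))))
                 (trans (ℤₚ.*-identityˡ _) (cong g index))) }
      where
      T≡ : T ≡ t₀ + suc e * c
      T≡ = trans (sym (+-identityʳ T)) pos
      index : a + b * T ≡ a + b * t₀ + b * suc e * c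
      index = trans (cong (λ t → a + b * t) T≡) (identity a b t₀ (suc e) c)
        where
        identity : ∀ a b t p c → a + b * (t + p * c) ≡ a + b * t + b * p * c
        identity = solve-∀
      position′ : suc T + e ≡ t₀ + suc e * suc c
      position′ = trans (cong (λ t → suc t + e) T≡) (identity t₀ e c)
        where
        identity : ∀ t e c → suc (t + suc e * c) + e ≡ t + suc e * suc c
        identity = solve-∀
    next record { count = c ; remaining = suc r ; remaining< = r< ; position = pos ; sum≡ = eq } = record
      { count = c ; remaining = r ; remaining< = <-trans (n<1+n r) r< ; position = trans (sym (+-suc T r)) pos
      ; sum≡ = trans (cong₂ ℤ._+_ eq (cong (ℤ._* g (a + b * T)) (cong ℤ.+_ (⟦⟧-no (suc e ∣? (a + b * T)) missed)))) (ℤₚ.+-identityʳ _) }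
      where
      missed : ¬ (suc e ∣ a + b * T)
      missed d = [ p∤b , (λ d′ → <⇒≱ r< (∣⇒≤ d′)) ]′ (euclidsLemma b (suc r) pe (∣m+n∣m⇒∣n {suc e} {a + b * T} {b * suc r}
        (subst (suc e ∣_) (trans (identity₁ a b t₀ (suc e) c) (trans (cong (λ t → a + b * t) (sym pos)) (identity₂ a b T (suc r)))) (∣m∣n⇒∣m+n first-hit (∣m⇒∣m*n c (n∣m*n b)))) d))
        where
        identity₁ : ∀ a b t p c → a + b * t + b * p * c ≡ a + b * (t + p * c)
        identity₁ = solve-∀
        identity₂ : ∀ a b T r → a + b * (T + r) ≡ a + b * T + b * r
        identity₂ = solve-∀

-- The function g + k·1_{p ∣ n} g has mean (1 + k/p) μ.
mean-hit : ∀ {L} e (g : ℕ → ℤ) μ ε μ′ (k : ℤ) → Prime (suc e) → All (e ≢_) L → Sieving L → Mean L g μ ε → ℤ.+ suc e ℤ.* ℤ.+ μ′ ≡ ℤ.+ suc e ℤ.* ℤ.+ μ ℤ.+ k ℤ.* ℤ.+ μ → ∀ m → k ≡ m ℤ.* ℤ.+ suc e →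
  Mean (e ∷ L) (λ n → g n ℤ.+ k ℤ.* (hit e n ℤ.* g n)) μ′ (ε + ℤ.∣ k ∣ * ε + ℤ.∣ m ∣ * μ * suc e)
mean-hit {L} e g μ ε μ′ k pe ds s mean μ′≡ m k≡ .estimate a b T (p∤b ∷ av) = begin
  ℤ.∣ ∑ℤ T (λ t → g (a + b * t) ℤ.+ k ℤ.* (hit e (a + b * t) ℤ.* g (a + b * t))) ℤ.- ℤ.+ μ′ ℤ.* ℤ.+ T ∣
    ≡⟨ cong ℤ.∣_∣ (trans (cong (ℤ._- ℤ.+ μ′ ℤ.* ℤ.+ T) (trans (∑ℤ-+ T _ _) (cong (ℤ._+_ X) (trans (∑ℤ-* T k _) (cong (k ℤ.*_) sum≡)))))
         (trans (cong (λ y → X ℤ.+ k ℤ.* Y ℤ.- y ℤ.* ℤ.+ T) mean-value) (trans (rearrange (ℤ.+ T) (ℤ.+ count) (ℤ.+ suc e) k m X Y (ℤ.+ μ) k≡) (cong (λ z → X ℤ.- ℤ.+ μ ℤ.* ℤ.+ T ℤ.+ k ℤ.* (Y ℤ.- ℤ.+ μ ℤ.* ℤ.+ count) ℤ.+ m ℤ.* ℤ.+ μ ℤ.* z) drift)))) ⟩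
  ℤ.∣ X ℤ.- ℤ.+ μ ℤ.* ℤ.+ T ℤ.+ k ℤ.* (Y ℤ.- ℤ.+ μ ℤ.* ℤ.+ count) ℤ.+ m ℤ.* ℤ.+ μ ℤ.* (ℤ.+ remaining ℤ.- ℤ.+ t₀) ∣
    ≤⟨ ∣x+ky+mz∣≤ (X ℤ.- ℤ.+ μ ℤ.* ℤ.+ T) k (Y ℤ.- ℤ.+ μ ℤ.* ℤ.+ count) (m ℤ.* ℤ.+ μ) (ℤ.+ remaining ℤ.- ℤ.+ t₀) ⟩
  ℤ.∣ X ℤ.- ℤ.+ μ ℤ.* ℤ.+ T ∣ + ℤ.∣ k ∣ * ℤ.∣ Y ℤ.- ℤ.+ μ ℤ.* ℤ.+ count ∣ + ℤ.∣ m ℤ.* ℤ.+ μ ∣ * ℤ.∣ ℤ.+ remaining ℤ.- ℤ.+ t₀ ∣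
    ≤⟨ +-mono-≤ (+-mono-≤ (estimate mean a b T av) (*-monoʳ-≤ ℤ.∣ k ∣ (estimate mean (a + b * t₀) (b * suc e) count (avoids-* b e s pe ds av))))
         (*-mono-≤ (≤-reflexive (ℤₚ.∣i*j∣≡∣i∣*∣j∣ m (ℤ.+ μ))) drift≤) ⟩
  ε + ℤ.∣ k ∣ * ε + ℤ.∣ m ∣ * μ * suc e ∎
  where
  open ≤-Reasoning
  open Hits e pe g a b p∤b
  open State (state T)
  X Y : ℤ
  X = ∑ℤ T (λ t → g (a + b * t))
  Y = ∑ℤ count (λ s → g (a + b * t₀ + b * suc e * s))
  drift : ℤ.+ suc e ℤ.* ℤ.+ count ℤ.- ℤ.+ T ≡ ℤ.+ remaining ℤ.- ℤ.+ t₀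
  drift = trans (identity₁ (ℤ.+ suc e ℤ.* ℤ.+ count) (ℤ.+ T) (ℤ.+ t₀)) (trans (cong (λ z → z ℤ.- ℤ.+ T ℤ.- ℤ.+ t₀) (trans (cong (ℤ._+_ (ℤ.+ t₀)) (sym (ℤₚ.pos-* (suc e) count))) (cong ℤ.+_ (sym position))))
    (identity₂ (ℤ.+ T) (ℤ.+ remaining) (ℤ.+ t₀)))
    where
    identity₁ : ∀ x y t → x ℤ.- y ≡ t ℤ.+ x ℤ.- y ℤ.- t
    identity₁ = ℤ-solver.solve-∀
    identity₂ : ∀ x y t → x ℤ.+ y ℤ.- x ℤ.- t ≡ y ℤ.- t
    identity₂ = ℤ-solver.solve-∀
  drift≤ : ℤ.∣ ℤ.+ remaining ℤ.- ℤ.+ t₀ ∣ ≤ suc e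
  drift≤ = ≤-trans (≤-reflexive (cong ℤ.∣_∣ (ℤₚ.[+m]-[+n]≡m⊖n remaining t₀))) (≤-trans (ℤₚ.∣m⊝n∣≤m⊔n remaining t₀) (⊔-lub (<⇒≤ remaining<) (<⇒≤ (m%n<n (v * (e * a)) (suc e)))))
  mean-value : ℤ.+ μ′ ≡ ℤ.+ μ ℤ.+ m ℤ.* ℤ.+ μ
  mean-value = ℤₚ.*-cancelˡ-≡ (ℤ.+ suc e) (ℤ.+ μ′) (ℤ.+ μ ℤ.+ m ℤ.* ℤ.+ μ) (trans μ′≡ (trans (cong (λ k → ℤ.+ suc e ℤ.* ℤ.+ μ ℤ.+ k ℤ.* ℤ.+ μ) k≡) (identity (ℤ.+ suc e) (ℤ.+ μ) m)))
    where
    identity : ∀ p μ m → p ℤ.* μ ℤ.+ m ℤ.* p ℤ.* μ ≡ p ℤ.* (μ ℤ.+ m ℤ.* μ)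
    identity = ℤ-solver.solve-∀
  rearrange : ∀ T c p k m X Y μ → k ≡ m ℤ.* p →
    X ℤ.+ k ℤ.* Y ℤ.- (μ ℤ.+ m ℤ.* μ) ℤ.* T ≡ X ℤ.- μ ℤ.* T ℤ.+ k ℤ.* (Y ℤ.- μ ℤ.* c) ℤ.+ m ℤ.* μ ℤ.* (p ℤ.* c ℤ.- T)
  rearrange T c p k m X Y μ refl = identity T c p m X Y μ
    where
    identity : ∀ T c p m X Y μ → X ℤ.+ m ℤ.* p ℤ.* Y ℤ.- (μ ℤ.+ m ℤ.* μ) ℤ.* T
      ≡ X ℤ.- μ ℤ.* T ℤ.+ m ℤ.* p ℤ.* (Y ℤ.- μ ℤ.* c) ℤ.+ m ℤ.* μ ℤ.* (p ℤ.* c ℤ.- T)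
    identity = ℤ-solver.solve-∀

-- Selberg's sieve in dual form, for a list of primes given by their predecessors.  F is the sum over squarefree m ≤ z of the products of
-- 1 − p·1_{p ∣ n} over the primes p dividing m, multiplied by Π; it takes the constant value S at an n without prime factors in the list,
-- and these products are orthogonal in mean.
atLeastOne : ℕ → ℕ
atLeastOne zero    = 0
atLeastOne (suc _) = 1

sieveFactor : ℕ → ℕ → ℤ
sieveFactor e n = ℤ.1ℤ ℤ.+ ℤ.- (ℤ.+ suc e) ℤ.* hit e n

F : List ℕ → ℕ → ℕ → ℤ
F []      z n = ℤ.+ atLeastOne z
F (e ∷ L) z n = ℤ.+ e ℤ.* F L z n ℤ.+ sieveFactor e n ℤ.* F L (z / suc e) n

S : List ℕ → ℕ → ℕ
S []      z = atLeastOne z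
S (e ∷ L) z = e * S L z + S L (z / suc e)

Π : List ℕ → ℕ
Π []      = 1
Π (e ∷ L) = e * Π L

-- The factor 1 - p · 1_{p ∣ n} has mean 0 and mean square p - 1 = e. So in the product of two
-- values of F the mixed terms vanish, and the two square terms remain.
mean : List ℕ → ℕ → ℕ → ℕ
mean []      z w = atLeastOne z * atLeastOne w
mean (e ∷ L) z w = e * e * mean L z w + e * mean L (z / suc e) (w / suc e)

-- The coefficient `2 * e + 3` is 1 + 2 p: the error in `mean-factor` is ε + p ε + μ p, and μ ≤ ε by
-- `mean≤error`.
error : List ℕ → ℕ → ℕ
error []      z = atLeastOne z
error (e ∷ L) z = e * error L z + (2 * e + 3) * error L (z / suc e)

F-avoids : ∀ L z n → Avoids L n → F L z n ≡ ℤ.+ S L z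
F-avoids []      z n []         = refl
F-avoids (e ∷ L) z n (p∤n ∷ av) = trans (cong₂ (λ x y → ℤ.+ e ℤ.* x ℤ.+ (ℤ.1ℤ ℤ.+ ℤ.- (ℤ.+ suc e) ℤ.* ℤ.+ y) ℤ.* F L (z / suc e) n) (F-avoids L z n av) (⟦⟧-no (suc e ∣? n) p∤n))
  (trans (cong (λ y → ℤ.+ e ℤ.* ℤ.+ S L z ℤ.+ (ℤ.1ℤ ℤ.+ ℤ.- (ℤ.+ suc e) ℤ.* ℤ.0ℤ) ℤ.* y) (F-avoids L (z / suc e) n av))
  (trans (identity (ℤ.+ e ℤ.* ℤ.+ S L z) (ℤ.+ suc e) (ℤ.+ S L (z / suc e))) (cong (ℤ._+ ℤ.+ S L (z / suc e)) (sym (ℤₚ.pos-* e (S L z))))))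
  where
  identity : ∀ x p y → x ℤ.+ (ℤ.1ℤ ℤ.+ ℤ.- p ℤ.* ℤ.0ℤ) ℤ.* y ≡ x ℤ.+ y
  identity = ℤ-solver.solve-∀

hit² : ∀ e n → hit e n ℤ.* hit e n ≡ hit e n
hit² e n = go (suc e ∣? n)
  where
  go : ∀ {P : Set} (p? : Dec P) → ℤ.+ ⟦ p? ⟧ ℤ.* ℤ.+ ⟦ p? ⟧ ≡ ℤ.+ ⟦ p? ⟧
  go (yes _) = refl
  go (no _)  = refl

mean-extend : ∀ {L g μ ε} e → Mean L g μ ε → Mean (e ∷ L) g μ ε
mean-extend e mg .estimate a b T (_ ∷ av) = estimate mg a b T av

mean-factor : ∀ {L} e g μ ε → Prime (suc e) → All (e ≢_) L → Sieving L → Mean L g μ ε →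
  Mean (e ∷ L) (λ n → sieveFactor e n ℤ.* g n) 0 (ε + suc e * ε + 1 * μ * suc e)
mean-factor e g μ ε pe ds s mg = mean-cong (λ n → identity (ℤ.+ suc e) (hit e n) (g n)) refl ≤-refl
  (mean-hit e g μ ε 0 (ℤ.- (ℤ.+ suc e)) pe ds s mg (balance (ℤ.+ suc e) (ℤ.+ μ)) (ℤ.- ℤ.1ℤ) (sym (ℤₚ.-1*i≡-i (ℤ.+ suc e))))
  where
  identity : ∀ p h g → g ℤ.+ ℤ.- p ℤ.* (h ℤ.* g) ≡ (ℤ.1ℤ ℤ.+ ℤ.- p ℤ.* h) ℤ.* g
  identity = ℤ-solver.solve-∀
  balance : ∀ p μ → p ℤ.* ℤ.0ℤ ≡ p ℤ.* μ ℤ.+ ℤ.- p ℤ.* μ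
  balance = ℤ-solver.solve-∀

-- Since the indicator h of p ∣ n satisfies h² = h, the square (1 - p h)² is 1 + p (p - 2) h, where
-- p - 2 = e′; its mean is 1 + (p - 2) = e.
mean-factor² : ∀ {L} e′ g μ ε → Prime (suc (suc e′)) → All (suc e′ ≢_) L → Sieving L → Mean L g μ ε →
  Mean (suc e′ ∷ L) (λ n → sieveFactor (suc e′) n ℤ.* sieveFactor (suc e′) n ℤ.* g n) (suc e′ * μ) (ε + e′ * suc (suc e′) * ε + e′ * μ * suc (suc e′))
mean-factor² e′ g μ ε pe ds s mg = mean-cong square refl ≤-refl
  (mean-hit e g μ ε (e * μ) (ℤ.+ (e′ * suc e)) pe ds s mg balance (ℤ.+ e′) (ℤₚ.pos-* e′ (suc e)))
  where
  e : ℕ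
  e = suc e′
  balance : ℤ.+ suc e ℤ.* ℤ.+ (e * μ) ≡ ℤ.+ suc e ℤ.* ℤ.+ μ ℤ.+ ℤ.+ (e′ * suc e) ℤ.* ℤ.+ μ
  balance = trans (cong (ℤ._*_ (ℤ.+ suc e)) (ℤₚ.pos-* e μ)) (trans (identity (ℤ.+ suc e) (ℤ.+ e′) (ℤ.+ μ))
              (cong (λ k → ℤ.+ suc e ℤ.* ℤ.+ μ ℤ.+ k ℤ.* ℤ.+ μ) (sym (ℤₚ.pos-* e′ (suc e)))))
    where
    identity : ∀ p e μ → p ℤ.* ((ℤ.1ℤ ℤ.+ e) ℤ.* μ) ≡ p ℤ.* μ ℤ.+ e ℤ.* p ℤ.* μ
    identity = ℤ-solver.solve-∀
  square : ∀ n → g n ℤ.+ ℤ.+ (e′ * suc e) ℤ.* (hit e n ℤ.* g n) ≡ sieveFactor e n ℤ.* sieveFactor e n ℤ.* g n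
  square n = trans (cong (λ k → g n ℤ.+ k ℤ.* (hit e n ℤ.* g n)) (ℤₚ.pos-* e′ (suc e))) (trans (identity₁ (ℤ.+ e′) (hit e n) (g n))
    (trans (cong (λ h → g n ℤ.+ (h ℤ.* p ℤ.* p ℤ.- ℤ.+ 2 ℤ.* p ℤ.* hit e n) ℤ.* g n) (sym (hit² e n))) (identity₂ p (hit e n) (g n))))
    where
    p : ℤ
    p = ℤ.+ 2 ℤ.+ ℤ.+ e′
    identity₁ : ∀ e h g → g ℤ.+ e ℤ.* (ℤ.+ 2 ℤ.+ e) ℤ.* (h ℤ.* g) ≡ g ℤ.+ (h ℤ.* (ℤ.+ 2 ℤ.+ e) ℤ.* (ℤ.+ 2 ℤ.+ e) ℤ.- ℤ.+ 2 ℤ.* (ℤ.+ 2 ℤ.+ e) ℤ.* h) ℤ.* g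
    identity₁ = ℤ-solver.solve-∀
    identity₂ : ∀ p h g → g ℤ.+ (h ℤ.* h ℤ.* p ℤ.* p ℤ.- ℤ.+ 2 ℤ.* p ℤ.* h) ℤ.* g ≡ (ℤ.1ℤ ℤ.+ ℤ.- p ℤ.* h) ℤ.* (ℤ.1ℤ ℤ.+ ℤ.- p ℤ.* h) ℤ.* g
    identity₂ = ℤ-solver.solve-∀

mean≤error : ∀ L z w → mean L z w ≤ error L z * error L w
mean≤error []      z w = ≤-refl
mean≤error (e ∷ L) z w = lin (+-mono-≤ (*-monoʳ-≤ (e * e) (mean≤error L z w)) (*-monoʳ-≤ e (mean≤error L (z / suc e) (w / suc e))))
  (e * (2 * e + 3) * (error L (z / suc e) * error L w + error L z * error L (w / suc e)) + (4 * (e * e) + 11 * e + 9) * (error L (z / suc e) * error L (w / suc e)))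
  (identity e (mean L z w) (mean L (z / suc e) (w / suc e)) (error L z) (error L (z / suc e)) (error L w) (error L (w / suc e)))
  where
  identity : ∀ e m m′ A A′ B B′ → e * e * m + e * m′ + (e * e * (A * B) + e * (A′ * B′)) + (e * (2 * e + 3) * (A′ * B + A * B′) + (4 * (e * e) + 11 * e + 9) * (A′ * B′))
    ≡ (e * A + (2 * e + 3) * A′) * (e * B + (2 * e + 3) * B′) + (e * e * m + e * m′)
  identity = solve-∀

F-mean : ∀ {L} → Sieving L → ∀ z w → Mean L (λ n → F L z n ℤ.* F L w n) (mean L z w) (error L z * error L w)
F-mean [] z w .estimate a b T _ = ≤-trans (≤-reflexive (cong ℤ.∣_∣ (trans (cong₂ (λ x y → x ℤ.- y ℤ.* ℤ.+ T) (∑ℤ-const T _) (ℤₚ.pos-* (atLeastOne z) (atLeastOne w)))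
    (ℤₚ.+-inverseʳ (ℤ.+ atLeastOne z ℤ.* ℤ.+ atLeastOne w ℤ.* ℤ.+ T))))) z≤n
F-mean {suc e′ ∷ L} (add pe 3≤e ds s) z w = mean-cong expand (total (e * e) e (mean L z w) (mean L z′ w′)) error-bound
  (mean-+ (mean-+ (mean-+ (mean-scale (e * e) (mean-extend e (F-mean s z w)))
      (mean-scale e (mean-factor e _ (mean L z′ w) (error L z′ * error L w) pe ds s (F-mean s z′ w))))
      (mean-scale e (mean-factor e _ (mean L z w′) (error L z * error L w′) pe ds s (F-mean s z w′))))
      (mean-factor² e′ _ (mean L z′ w′) (error L z′ * error L w′) pe ds s (F-mean s z′ w′)))
  where
  e z′ w′ : ℕ
  e = suc e′
  z′ = z / suc e
  w′ = w / suc e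
  expand : ∀ n → ℤ.+ (e * e) ℤ.* (F L z n ℤ.* F L w n) ℤ.+ ℤ.+ e ℤ.* (sieveFactor e n ℤ.* (F L z′ n ℤ.* F L w n)) ℤ.+ ℤ.+ e ℤ.* (sieveFactor e n ℤ.* (F L z n ℤ.* F L w′ n))
    ℤ.+ sieveFactor e n ℤ.* sieveFactor e n ℤ.* (F L z′ n ℤ.* F L w′ n) ≡ F (e ∷ L) z n ℤ.* F (e ∷ L) w n
  expand n = trans (cong (λ k → k ℤ.* (F L z n ℤ.* F L w n) ℤ.+ ℤ.+ e ℤ.* (sieveFactor e n ℤ.* (F L z′ n ℤ.* F L w n)) ℤ.+ ℤ.+ e ℤ.* (sieveFactor e n ℤ.* (F L z n ℤ.* F L w′ n))
      ℤ.+ sieveFactor e n ℤ.* sieveFactor e n ℤ.* (F L z′ n ℤ.* F L w′ n)) (ℤₚ.pos-* e e)) (identity (ℤ.+ e) (sieveFactor e n) (F L z n) (F L z′ n) (F L w n) (F L w′ n))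
    where
    identity : ∀ e u A A′ B B′ → e ℤ.* e ℤ.* (A ℤ.* B) ℤ.+ e ℤ.* (u ℤ.* (A′ ℤ.* B)) ℤ.+ e ℤ.* (u ℤ.* (A ℤ.* B′)) ℤ.+ u ℤ.* u ℤ.* (A′ ℤ.* B′)
      ≡ (e ℤ.* A ℤ.+ u ℤ.* A′) ℤ.* (e ℤ.* B ℤ.+ u ℤ.* B′)
    identity = ℤ-solver.solve-∀
  total : ∀ a e m m′ → a * m + e * 0 + e * 0 + e * m′ ≡ a * m + e * m′
  total = solve-∀
  error-bound : e * e * (error L z * error L w)
      + e * (error L z′ * error L w + suc e * (error L z′ * error L w) + 1 * mean L z′ w * suc e)
      + e * (error L z * error L w′ + suc e * (error L z * error L w′) + 1 * mean L z w′ * suc e)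
      + (error L z′ * error L w′ + e′ * suc e * (error L z′ * error L w′) + e′ * mean L z′ w′ * suc e)
    ≤ error (e ∷ L) z * error (e ∷ L) w
  error-bound = lin (+-mono-≤ (+-mono-≤ (*-monoʳ-≤ (e * suc e) (mean≤error L z′ w)) (*-monoʳ-≤ (e * suc e) (mean≤error L z w′))) (*-monoʳ-≤ (e′ * suc e) (mean≤error L z′ w′)))
    ((2 * (e′ * e′) + 16 * e′ + 24) * (error L z′ * error L w′))
    (identity e′ (error L z) (error L z′) (error L w) (error L w′) (mean L z′ w) (mean L z w′) (mean L z′ w′))
    where
    identity : ∀ e′ A A′ B B′ m₁ m₂ m₃ →
      suc e′ * suc e′ * (A * B) + suc e′ * (A′ * B + suc (suc e′) * (A′ * B) + 1 * m₁ * suc (suc e′)) + suc e′ * (A * B′ + suc (suc e′) * (A * B′) + 1 * m₂ * suc (suc e′))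
        + (A′ * B′ + e′ * suc (suc e′) * (A′ * B′) + e′ * m₃ * suc (suc e′))
        + (suc e′ * suc (suc e′) * (A′ * B) + suc e′ * suc (suc e′) * (A * B′) + e′ * suc (suc e′) * (A′ * B′)) + (2 * (e′ * e′) + 16 * e′ + 24) * (A′ * B′)
      ≡ (suc e′ * A + (2 * suc e′ + 3) * A′) * (suc e′ * B + (2 * suc e′ + 3) * B′)
        + (suc e′ * suc (suc e′) * m₁ + suc e′ * suc (suc e′) * m₂ + e′ * suc (suc e′) * m₃)
    identity = solve-∀

-- The identity that makes Selberg's choice work: the mean square of F is Π times the value S of F
-- at an unsieved n, so dividing it by S² leaves the density Π / S.
mean-diagonal : ∀ L z → mean L z z ≡ Π L * S L z
mean-diagonal []      zero    = refl
mean-diagonal []      (suc z) = refl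
mean-diagonal (e ∷ L) z = trans (cong₂ (λ x y → e * e * x + e * y) (mean-diagonal L z) (mean-diagonal L (z / suc e))) (identity e (Π L) (S L z) (S L (z / suc e)))
  where
  identity : ∀ e P s t → e * e * (P * s) + e * (P * t) ≡ e * P * (e * s + t)
  identity = solve-∀

Π≤S : ∀ L z → 1 ≤ z → Π L ≤ S L z
Π≤S []      (suc z) _   = ≤-refl
Π≤S (e ∷ L) z       1≤z = ≤-trans (*-monoʳ-≤ e (Π≤S L z 1≤z)) (m≤m+n (e * S L z) _)

Π>0 : ∀ {L} → Sieving L → 1 ≤ Π L
Π>0 []             = ≤-refl
Π>0 (add _ 3≤e _ s) = *-mono-≤ (≤-trans (s≤s z≤n) 3≤e) (Π>0 s)

D₃ : List ℕ → ℕ → ℕ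
D₃ []      z = atLeastOne z
D₃ (e ∷ L) z = D₃ L z + 3 * D₃ L (z / suc e)

-- From 3 ≤ e follows 2 e + 3 ≤ 3 e; taking out one factor e for every prime leaves the coefficient
-- 3 of `D₃`.
error≤ΠD : ∀ {L} → Sieving L → ∀ z → error L z ≤ Π L * D₃ L z
error≤ΠD []                      z = ≤-reflexive (sym (+-identityʳ (atLeastOne z)))
error≤ΠD {e ∷ L} (add _ 3≤e _ s) z = lin (+-mono-≤ (+-mono-≤ (*-monoʳ-≤ e (error≤ΠD s z)) (*-monoʳ-≤ (3 * e) (error≤ΠD s (z / suc e)))) (*-monoˡ-≤ (error L (z / suc e)) 3≤e)) 0
  (identity e (error L z) (error L (z / suc e)) (Π L) (D₃ L z) (D₃ L (z / suc e)))
  where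
  identity : ∀ e x y P c c′ → e * x + (2 * e + 3) * y + (e * (P * c) + 3 * e * (P * c′) + e * y) + 0 ≡ e * P * (c + 3 * c′) + (e * x + 3 * e * y + 3 * y)
  identity = solve-∀

-- Every counted n contributes S² to the sum of F², which is at most Π S T plus the square of the
-- error. The error is at most Π · D₃, and one of its two factors Π is bounded by S.
selberg-sieve : ∀ {L} → Sieving L → ∀ z → 1 ≤ z → ∀ {Q : ℕ → Set} (Q? : ∀ n → Dec (Q n)) → (∀ n → Q n → Avoids L n) → ∀ a b T → Avoids L b →
  ∑ T (λ t → ⟦ Q? (a + b * t) ⟧) * S L z ≤ Π L * (T + D₃ L z * D₃ L z)
selberg-sieve {L} s z 1≤z {Q} Q? Q⇒ a b T av = *-cancelʳ-≤ (count * S L z) (Π L * (T + D₃ L z * D₃ L z)) (S L z) {{>-nonZero (≤-trans (Π>0 s) (Π≤S L z 1≤z))}}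
  (lin (+-mono-≤ (+-mono-≤ squares upper) (+-mono-≤ (*-mono-≤ (error≤ΠD s z) (error≤ΠD s z)) (*-monoˡ-≤ (Π L * (D₃ L z * D₃ L z)) (Π≤S L z 1≤z)))) 0
    (identity count (S L z) (Π L) T (D₃ L z) total (error L z)))
  where
  count total : ℕ
  count = ∑ T (λ t → ⟦ Q? (a + b * t) ⟧)
  total = ∑ T (λ t → ℤ.∣ F L z (a + b * t) ∣ * ℤ.∣ F L z (a + b * t) ∣)
  squares : count * (S L z * S L z) ≤ total
  squares = ≤-trans (≤-reflexive (sym (∑-*ʳ T (S L z * S L z) _))) (∑-mono T λ t _ → pointwise (a + b * t) (Q? (a + b * t)))
    where
    pointwise : ∀ n (q? : Dec (Q n)) → ⟦ q? ⟧ * (S L z * S L z) ≤ ℤ.∣ F L z n ∣ * ℤ.∣ F L z n ∣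
    pointwise n (no _)  = z≤n
    pointwise n (yes q) = ≤-reflexive (trans (+-identityʳ (S L z * S L z)) (cong (λ v → ℤ.∣ v ∣ * ℤ.∣ v ∣) (sym (F-avoids L z n (Q⇒ n q)))))
  upper : total ≤ Π L * S L z * T + error L z * error L z
  upper = ≤-trans (≤-reflexive (cong ℤ.∣_∣ total≡)) (≤-trans (ℤₚ.∣i+j∣≤∣i∣+∣j∣ (ℤ.+ (Π L * S L z) ℤ.* ℤ.+ T) _)
      (+-mono-≤ (≤-reflexive (ℤₚ.∣i*j∣≡∣i∣*∣j∣ (ℤ.+ (Π L * S L z)) (ℤ.+ T))) (subst (λ m → ℤ.∣ ∑ℤ T FF ℤ.- ℤ.+ m ℤ.* ℤ.+ T ∣ ≤ error L z * error L z) (mean-diagonal L z) (estimate (F-mean s z z) a b T av))))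
    where
    FF : ℕ → ℤ
    FF t = F L z (a + b * t) ℤ.* F L z (a + b * t)
    restore : ∀ x y → x ≡ y ℤ.+ (x ℤ.- y)
    restore = ℤ-solver.solve-∀
    total≡ : ℤ.+ total ≡ ℤ.+ (Π L * S L z) ℤ.* ℤ.+ T ℤ.+ (∑ℤ T FF ℤ.- ℤ.+ (Π L * S L z) ℤ.* ℤ.+ T)
    total≡ = trans (trans (sym (∑ℤ-pos T _)) (∑ℤ-cong T λ t → sym (x*x≡∣x∣*∣x∣ (F L z (a + b * t))))) (restore (∑ℤ T FF) (ℤ.+ (Π L * S L z) ℤ.* ℤ.+ T))
  identity : ∀ c s P T D t E → c * s * s + (t + (P * s * T + E * E) + (P * D * (P * D) + s * (P * (D * D)))) + 0
    ≡ P * (T + D * D) * s + (c * (s * s) + t + (E * E + P * (P * (D * D))))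
  identity = solve-∀

-- Divisor sums in the error term of the sieve

^-distribʳ-* : ∀ s m n → (m * n) ^ s ≡ m ^ s * n ^ s
^-distribʳ-* zero    m n = refl
^-distribʳ-* (suc s) m n = trans (cong (m * n *_) (^-distribʳ-* s m n)) (shuffle m n (m ^ s) (n ^ s))
  where
  shuffle : ∀ m n a b → m * n * (a * b) ≡ m * a * (n * b)
  shuffle = solve-∀

∃-prime-divisor : ∀ n → 2 ≤ n → ∃ λ p → Prime p × p ∣ n
∃-prime-divisor n@(suc _) 2≤n = go (PrimeFactorisation.factors f) (PrimeFactorisation.isFactorisation f) (PrimeFactorisation.factorsPrime f)
  where
  f : PrimeFactorisation n
  f = factorise n
  go : ∀ ps → n ≡ product ps → All Prime ps → ∃ λ p → Prime p × p ∣ n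
  go []       e _         = ⊥-elim (<⇒≱ 2≤n (≤-reflexive e))
  go (p ∷ ps) e (pp ∷ _) = p , pp , subst (p ∣_) (sym e) (m∣m*n (product ps))

∑-multiples : ∀ e G z → ∑ z (λ m → ⟦ suc e ∣? suc m ⟧ * G (suc m / suc e)) ≡ ∑ (z / suc e) (λ m → G (suc m))
∑-multiples e G z = conclude (go z)
  where
  Result : ℕ → Set
  Result z = ∃ λ c → c * suc e ≤ z × z < suc c * suc e × ∑ z (λ m → ⟦ suc e ∣? suc m ⟧ * G (suc m / suc e)) ≡ ∑ c (λ m → G (suc m))
  conclude : Result z → ∑ z (λ m → ⟦ suc e ∣? suc m ⟧ * G (suc m / suc e)) ≡ ∑ (z / suc e) (λ m → G (suc m))
  conclude (c , lo , hi , eq) = trans eq (cong (λ k → ∑ k (λ m → G (suc m))) (≤-antisym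
    (≤-trans (≤-reflexive (sym (m*n/n≡m c (suc e)))) (/-monoˡ-≤ (suc e) lo)) (s≤s⁻¹ (m<n*o⇒m/o<n hi))))
  go : ∀ z → Result z
  go zero    = 0 , z≤n , s≤s z≤n , refl
  go (suc z) = step (suc e ∣? suc z) (go z)
    where
    step : (d? : Dec (suc e ∣ suc z)) → Result z → ∃ λ c → c * suc e ≤ suc z × suc z < suc c * suc e ×
      ∑ z (λ m → ⟦ suc e ∣? suc m ⟧ * G (suc m / suc e)) + ⟦ d? ⟧ * G (suc z / suc e) ≡ ∑ c (λ m → G (suc m))
    step (no ¬d) (c , lo , hi , eq) = c , m≤n⇒m≤1+n lo , ≤∧≢⇒< hi (λ e′ → ¬d (divides (suc c) e′)) , trans (+-identityʳ _) eq
    step (yes (divides k e′)) (c , lo , hi , eq) = suc c , ≤-reflexive (sym sz≡) , subst (_< suc (suc c) * suc e) (sym sz≡) (m<n+m (suc c * suc e) (s≤s z≤n)) ,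
        cong₂ _+_ eq (trans (*-identityˡ _) (cong G (trans (cong (_/ suc e) sz≡) (m*n/n≡m (suc c) (suc e)))))
      where
      k≡ : k ≡ suc c
      k≡ = ≤-antisym (*-cancelʳ-≤ k (suc c) (suc e) (subst (_≤ suc c * suc e) e′ hi)) (*-cancelʳ-< (suc e) c k (subst (c * suc e <_) e′ (s≤s lo)))
      sz≡ : suc z ≡ suc c * suc e
      sz≡ = trans e′ (cong (_* suc e) k≡)

-- The coefficient of m in D₃ L z, which is 3 to the number of prime factors of m or zero.
coefficient : List ℕ → ℕ → ℕ
coefficient []      m = ⟦ m ≟ 1 ⟧
coefficient (e ∷ L) m = coefficient L m + 3 * (⟦ suc e ∣? m ⟧ * coefficient L (m / suc e))

D₃≡∑ : ∀ L z → D₃ L z ≡ ∑ z (λ m → coefficient L (suc m))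
D₃≡∑ []      zero    = refl
D₃≡∑ []      (suc z) = sym (trans (∑-head z _) (cong suc (∑-zero z λ m _ → refl)))
D₃≡∑ (e ∷ L) z       = trans (cong₂ (λ a b → a + 3 * b) (D₃≡∑ L z) (trans (D₃≡∑ L (z / suc e)) (sym (∑-multiples e (coefficient L) z))))
  (sym (trans (∑-+ z _ _) (cong (∑ z (λ m → coefficient L (suc m)) +_) (∑-*ˡ z 3 _))))

∣-quotient : ∀ {p q} n → Prime p → Prime (suc q) → p ≢ suc q → p ∣ n → suc q ∣ n → p ∣ n / suc q
∣-quotient {p} {q} n pp pq p≢q p∣n q∣n = [ id , (λ p∣q → ⊥-elim (p≢q (prime∣prime pp pq p∣q))) ]′
  (euclidsLemma (n / suc q) (suc q) pp (subst (p ∣_) (sym (m/n*n≡m q∣n)) p∣n))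

coefficient-support : ∀ {L} f m → Sieving L → Prime (suc f) → All (f ≢_) L → suc f ∣ m → coefficient L m ≡ 0
coefficient-support f m [] pf [] d = ⟦⟧-no (m ≟ 1) λ m≡1 → <⇒≱ (prime≥2 pf) (∣⇒≤ (subst (suc f ∣_) m≡1 d))
coefficient-support {e ∷ L} f m (add pe _ _ s) pf (f≢e ∷ fs) d = cong₂ (λ a b → a + 3 * b) (coefficient-support f m s pf fs d) (multiple (suc e ∣? m))
  where
  multiple : (d? : Dec (suc e ∣ m)) → ⟦ d? ⟧ * coefficient L (m / suc e) ≡ 0
  multiple (no _)  = refl
  multiple (yes g) = trans (+-identityʳ _) (coefficient-support f (m / suc e) s pf fs (∣-quotient m pf pe (f≢e ∘ suc-injective) d g))

-- A nonzero coefficient is 3 to the number of prime factors of m, and each of these factors is at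
-- least 3^s.
coefficient-bound : ∀ {L} s m → Sieving L → All (λ e → 3 ^ s ≤ suc e) L → 1 ≤ m → coefficient L m ^ s ≤ m
coefficient-bound s m [] [] 1≤m = ≤-trans (^-monoˡ-≤ s (⟦⟧≤1 (m ≟ 1))) (≤-trans (≤-reflexive (^-zeroˡ s)) 1≤m)
coefficient-bound {e ∷ L} s m (add pe _ ds sv) (b ∷ bs) 1≤m = go (suc e ∣? m)
  where
  go : (d? : Dec (suc e ∣ m)) → (coefficient L m + 3 * (⟦ d? ⟧ * coefficient L (m / suc e))) ^ s ≤ m
  go (no _)  = ≤-trans (≤-reflexive (cong (_^ s) (+-identityʳ (coefficient L m)))) (coefficient-bound s m sv bs 1≤m)
  go (yes d) = begin
    (coefficient L m + 3 * (1 * coefficient L (m / suc e))) ^ s ≡⟨ cong₂ (λ a b → (a + 3 * b) ^ s) (coefficient-support e m sv pe ds d) (*-identityˡ (coefficient L (m / suc e))) ⟩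
    (3 * coefficient L (m / suc e)) ^ s                         ≡⟨ ^-distribʳ-* s 3 (coefficient L (m / suc e)) ⟩
    3 ^ s * coefficient L (m / suc e) ^ s                       ≤⟨ *-mono-≤ b (coefficient-bound s (m / suc e) sv bs (m≥n⇒m/n>0 (∣⇒≤ {{>-nonZero 1≤m}} d))) ⟩
    suc e * (m / suc e)                                         ≡⟨ m*[n/m]≡n d ⟩
    m                                                           ∎
    where open ≤-Reasoning

-- No coefficient exceeds y, because its s-th power is at most z ≤ y^s. So for z = y^s the divisor
-- sum is at most z^(1 + 1/s), a negligible loss for large s.
D₃-bound : ∀ {L} s y z → 1 ≤ s → Sieving L → All (λ e → 3 ^ s ≤ suc e) L → z ≤ y ^ s → D₃ L z ≤ z * y
D₃-bound {L} s y z 1≤s sv bs z≤ = ≤-trans (≤-reflexive (D₃≡∑ L z)) (≤-trans (∑-mono z λ m m<z → ≮⇒≥ λ y<c →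
    <⇒≱ (^-monoˡ-< s {{>-nonZero 1≤s}} y<c) (≤-trans (coefficient-bound s (suc m) sv bs (s≤s z≤n)) (≤-trans m<z z≤))) (≤-reflexive (∑-const z y)))

-- Smooth numbers and the main term of the sieve

Smooth : List ℕ → ℕ → Set
Smooth L n = ∀ {p} → p < suc n → Prime p × p ∣ n → Any (λ e → p ≡ suc e) L

smooth? : ∀ L n → Dec (Smooth L n)
smooth? L n = allUpTo? (λ p → (prime? p ×-dec (p ∣? n)) →-dec any? (λ e → p ≟ suc e) L) (suc n)

quot : ℕ → ℕ → ℕ
quot M zero    = 0
quot M (suc n) = M / suc n

quot-quot : ∀ M e k → 1 ≤ k → quot (M / suc e) k ≡ quot M (k * suc e)
quot-quot M e (suc k) _ = trans (m/n/o≡m/[n*o] M (suc e) (suc k)) (/-congʳ {m = M} (*-comm (suc e) (suc k)))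

*quot≤ : ∀ M e n → suc e * quot (M / suc e) (suc n) ≤ quot M (suc n)
*quot≤ M e n = ≤-trans (≤-reflexive (trans (cong (suc e *_) (trans (m/n/o≡m/[n*o] M (suc e) (suc n)) (trans (/-congʳ {m = M} (*-comm (suc e) (suc n))) (sym (m/n/o≡m/[n*o] M (suc n) (suc e)))))) (*-comm (suc e) _)))
  (m/n*n≤m (M / suc n) (suc e))

-- Up to rounding, M times the sum of 1 / n over the n ≤ z all of whose prime factors belong to L.
smoothSum : List ℕ → ℕ → ℕ → ℕ
smoothSum L z M = ∑ z λ n → ⟦ smooth? L (suc n) ⟧ * quot M (suc n)

smoothSum-step : ∀ e L z M → Prime (suc e) → smoothSum (e ∷ L) z M ≤ smoothSum L z M + smoothSum (e ∷ L) (z / suc e) (M / suc e)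
smoothSum-step e L z M pe = ≤-trans (∑-mono z λ n _ → pointwise n) (≤-reflexive (trans (∑-+ z _ _) (cong (smoothSum L z M +_) (∑-multiples e (λ k → ⟦ smooth? (e ∷ L) k ⟧ * quot (M / suc e) k) z))))
  where
  pointwise : ∀ n → ⟦ smooth? (e ∷ L) (suc n) ⟧ * quot M (suc n) ≤
    ⟦ smooth? L (suc n) ⟧ * quot M (suc n) + ⟦ suc e ∣? suc n ⟧ * (⟦ smooth? (e ∷ L) (suc n / suc e) ⟧ * quot (M / suc e) (suc n / suc e))
  pointwise n = go (smooth? (e ∷ L) (suc n)) (smooth? L (suc n)) (suc e ∣? suc n) (smooth? (e ∷ L) (suc n / suc e))
    where
    go : (a? : Dec (Smooth (e ∷ L) (suc n))) (b? : Dec (Smooth L (suc n))) (d? : Dec (suc e ∣ suc n)) (c? : Dec (Smooth (e ∷ L) (suc n / suc e))) →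
      ⟦ a? ⟧ * quot M (suc n) ≤ ⟦ b? ⟧ * quot M (suc n) + ⟦ d? ⟧ * (⟦ c? ⟧ * quot (M / suc e) (suc n / suc e))
    go (no _)  b? d? c? = z≤n
    go (yes a) b? (yes d) c? = ≤-trans (≤-reflexive (sym value)) (m≤n+m _ (⟦ b? ⟧ * quot M (suc n)))
      where
      k≥1 : 1 ≤ suc n / suc e
      k≥1 = m≥n⇒m/n>0 (∣⇒≤ d)
      c : Smooth (e ∷ L) (suc n / suc e)
      c {p} p< (pp , p∣) = a (≤-<-trans (≤-trans (s≤s⁻¹ p<) (m/n≤m (suc n) (suc e))) ≤-refl) (pp , ∣-trans p∣ (m/n∣m d))
      value : 1 * (⟦ c? ⟧ * quot (M / suc e) (suc n / suc e)) ≡ 1 * quot M (suc n)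
      value = cong (1 *_) (trans (cong (_* quot (M / suc e) (suc n / suc e)) (⟦⟧-yes c? c)) (trans (*-identityˡ _)
        (trans (quot-quot M e (suc n / suc e) k≥1) (cong (quot M) (m/n*n≡m d)))))
    go (yes a) b? (no p∤n) c? = ≤-trans (≤-reflexive (cong (_* quot M (suc n)) (sym (⟦⟧-yes b? b)))) (m≤m+n _ 0)
      where
      b : Smooth L (suc n)
      b {p} p< (pp , p∣n) = drop (a p< (pp , p∣n))
        where
        drop : Any (λ f → p ≡ suc f) (e ∷ L) → Any (λ f → p ≡ suc f) L
        drop (here p≡)  = ⊥-elim (p∤n (subst (_∣ suc n) p≡ p∣n))
        drop (there an) = an

smoothSum-divide : ∀ e L z M → suc e * smoothSum L z (M / suc e) ≤ smoothSum L z M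
smoothSum-divide e L z M = ≤-trans (≤-reflexive (sym (∑-*ˡ z (suc e) _))) (∑-mono z λ n _ →
  ≤-trans (≤-reflexive (shuffle (suc e) ⟦ smooth? L (suc n) ⟧ (quot (M / suc e) (suc n)))) (*-monoʳ-≤ ⟦ smooth? L (suc n) ⟧ (*quot≤ M e n)))
  where
  shuffle : ∀ a b c → a * (b * c) ≡ b * (a * c)
  shuffle = solve-∀

-- Write n = p^j k with p not dividing k. The terms with j ≥ 1 contribute at most 1/p + 1/p² + ... =
-- 1/e times the sum for z / p; the induction, whose depth `fuel` bounds, adds up this series one
-- power at a time.
smoothSum-recursion : ∀ e L → Prime (suc e) → ∀ fuel z M → z ≤ fuel → e * smoothSum (e ∷ L) z M ≤ e * smoothSum L z M + smoothSum L (z / suc e) M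
smoothSum-recursion e L pe fuel zero M _ = ≤-trans (≤-reflexive (*-zeroʳ e)) z≤n
smoothSum-recursion e L pe (suc fuel) (suc z) M z≤ = lin (+-mono-≤ (+-mono-≤ (*-monoʳ-≤ e (smoothSum-step e L (suc z) M pe))
    (smoothSum-recursion e L pe fuel z′ (M / suc e) (≤-trans z′≤z (s≤s⁻¹ z≤))))
    (+-mono-≤ (∑-extend (λ n → ⟦ smooth? L (suc n) ⟧ * quot (M / suc e) (suc n)) (m/n≤m z′ (suc e))) (smoothSum-divide e L z′ M))) 0
  (identity e (smoothSum (e ∷ L) (suc z) M) (smoothSum L (suc z) M) (smoothSum (e ∷ L) z′ (M / suc e)) (smoothSum L z′ (M / suc e)) (smoothSum L (z′ / suc e) (M / suc e)) (smoothSum L z′ M))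
  where
  z′ : ℕ
  z′ = suc z / suc e
  z′≤z : z′ ≤ z
  z′≤z = s≤s⁻¹ (m/n<m (suc z) (suc e) (prime≥2 pe))
  identity : ∀ e A B D E G H → e * A + (e * (B + D) + (e * E + G) + (E + H)) + 0 ≡ e * B + H + (e * A + e * D + (G + suc e * E))
  identity = solve-∀

-- S / Π is the sum of 1 / φ(m) over squarefree m ≤ z built from L, and 1 / φ(m) is the sum of 1 / n
-- over all n with the same prime factors as m. The induction makes this comparison prime by prime.
smoothSum-bound : ∀ {L} → Sieving L → ∀ z M → Π L * smoothSum L z M ≤ S L z * M
smoothSum-bound [] zero    M = z≤n
smoothSum-bound [] (suc z) M = ≤-trans (≤-reflexive (*-identityˡ _)) (≤-trans (≤-reflexive (trans (∑-head z _) (trans (cong (⟦ smooth? [] 1 ⟧ * quot M 1 +_)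
    (∑-zero z λ n _ → cong (_* quot M (suc (suc n))) (⟦⟧-no (smooth? [] (suc (suc n))) (rough n)))) (+-identityʳ _))))
  (≤-trans (*-monoˡ-≤ (quot M 1) (⟦⟧≤1 (smooth? [] 1))) (*-monoʳ-≤ 1 (m/n≤m M 1))))
  where
  rough : ∀ n → ¬ Smooth [] (suc (suc n))
  rough n sm = none (sm (s≤s (∣⇒≤ (proj₂ (proj₂ pd)))) (proj₂ pd))
    where
    pd : ∃ λ p → Prime p × p ∣ suc (suc n)
    pd = ∃-prime-divisor (suc (suc n)) (s≤s (s≤s z≤n))
    none : ¬ Any (λ e → proj₁ pd ≡ suc e) []
    none ()
smoothSum-bound {e ∷ L} (add pe _ _ s) z M = lin (+-mono-≤ (*-monoʳ-≤ (Π L) (smoothSum-recursion e L pe z z M ≤-refl))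
    (+-mono-≤ (*-monoʳ-≤ e (smoothSum-bound s z M)) (smoothSum-bound s (z / suc e) M))) 0
  (identity e (Π L) (smoothSum (e ∷ L) z M) (smoothSum L z M) (smoothSum L (z / suc e) M) (S L z) (S L (z / suc e)) M)
  where
  identity : ∀ e P A B C s t M → e * P * A + (P * (e * B + C) + (e * (s * M) + t * M)) + 0 ≡ (e * s + t) * M + (P * (e * A) + (e * (P * B) + P * C))
  identity = solve-∀

sieve-count : ∀ {L} → Sieving L → ∀ z → 1 ≤ z → ∀ {Q : ℕ → Set} (Q? : ∀ n → Dec (Q n)) → (∀ n → Q n → Avoids L n) → ∀ a b T M → Avoids L b →
  ∑ T (λ t → ⟦ Q? (a + b * t) ⟧) * smoothSum L z M ≤ (T + D₃ L z * D₃ L z) * M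
sieve-count {L} s z 1≤z Q? Q⇒ a b T M av = *-cancelˡ-≤ (Π L) {{>-nonZero (Π>0 s)}}
  (lin (+-mono-≤ (*-monoʳ-≤ count (smoothSum-bound s z M)) (*-monoˡ-≤ M (selberg-sieve s z 1≤z Q? Q⇒ a b T av))) 0
    (identity (Π L) count (smoothSum L z M) (S L z) M (T + D₃ L z * D₃ L z)))
  where
  count : ℕ
  count = ∑ T (λ t → ⟦ Q? (a + b * t) ⟧)
  identity : ∀ P c h s M X → P * (c * h) + (c * (s * M) + P * X * M) + 0 ≡ P * (X * M) + (c * (P * h) + c * s * M)
  identity = solve-∀

-- The sieving primes: primes up to z that do not divide q

sievePrimes : ℕ → ℕ → List ℕ
sievePrimes q zero    = []
sievePrimes q (suc e) with prime? (suc e) ×-dec ¬? (suc e ∣? q)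
... | yes _ = e ∷ sievePrimes q e
... | no  _ = sievePrimes q e

sievePrimes-< : ∀ q z → All (_< z) (sievePrimes q z)
sievePrimes-< q zero    = []
sievePrimes-< q (suc e) with prime? (suc e) ×-dec ¬? (suc e ∣? q)
... | yes _ = ≤-refl ∷ All.map m<n⇒m<1+n (sievePrimes-< q e)
... | no  _ = All.map m<n⇒m<1+n (sievePrimes-< q e)

sievePrimes-avoids : ∀ q z → Avoids (sievePrimes q z) q
sievePrimes-avoids q zero    = []
sievePrimes-avoids q (suc e) with prime? (suc e) ×-dec ¬? (suc e ∣? q)
... | yes (_ , ∤) = ∤ ∷ sievePrimes-avoids q e
... | no  _       = sievePrimes-avoids q e

sievePrimes-sieving : ∀ q z → (∀ e → Prime (suc e) → ¬ (suc e ∣ q) → 3 ≤ e) → Sieving (sievePrimes q z)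
sievePrimes-sieving q zero    h = []
sievePrimes-sieving q (suc e) h with prime? (suc e) ×-dec ¬? (suc e ∣? q)
... | yes (pp , ∤) = add pp (h e pp ∤) (All.map (λ lt eq → <-irrefl (sym eq) lt) (sievePrimes-< q e)) (sievePrimes-sieving q e h)
... | no  _        = sievePrimes-sieving q e h

sievePrimes-complete : ∀ q z e → e < z → Prime (suc e) → ¬ (suc e ∣ q) → Any (λ f → suc e ≡ suc f) (sievePrimes q z)
sievePrimes-complete q (suc f) e e<z pp ∤ with prime? (suc f) ×-dec ¬? (suc f ∣? q) | e ≟ f
... | yes _  | yes refl = here refl
... | yes _  | no e≢f   = there (sievePrimes-complete q f e (≤∧≢⇒< (s≤s⁻¹ e<z) e≢f) pp ∤)
... | no ¬pf | yes refl = ⊥-elim (¬pf (pp , ∤))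
... | no _   | no e≢f   = sievePrimes-complete q f e (≤∧≢⇒< (s≤s⁻¹ e<z) e≢f) pp ∤

-- Inert primes in a cell

∑-grid : ∀ T q g → ∑ (T * q) g ≡ ∑ T (λ t → ∑ q (λ a → g (t * q + a)))
∑-grid zero    q g = refl
∑-grid (suc T) q g = trans (cong (λ n → ∑ n g) (+-comm q (T * q))) (trans (∑-split (T * q) q g) (cong (_+ ∑ q (λ a → g (T * q + a))) (∑-grid T q g)))

module ClassSieve (m w q : ℕ) {{q≢0 : NonZero q}} (q≡ : q ≡ w * (2 * (2 * suc m))) (s : ℕ) (1≤s : 1 ≤ s)
  (large : ∀ e → Prime (suc e) → ¬ (suc e ∣ q) → 3 ≤ e × 3 ^ s ≤ suc e) where
  open Character m hiding (L)
  open Classes w q q≡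
  open Modular q

  D≤q : D ≤ q
  D≤q = ∣⇒≤ D∣q

  inert-oddClass : ∀ n → Inert d n → q < n → OddClass n
  inert-oddClass n (pn , nonsplit) q<n = coprime , Reciprocity.inert-odd (n / 2) n {{prime⇒nonZero pn}} n≡ pn 1≤h
      (λ n∣2 → <⇒≱ (≤-<-trans (≤-trans (*-monoʳ-≤ 2 {1} {d} (s≤s z≤n)) D≤q) q<n) (∣⇒≤ n∣2))
      (λ n∣d → <⇒≱ (≤-<-trans (≤-trans (m≤m+n d (d + 0)) D≤q) q<n) (∣⇒≤ n∣d)) nonsplit
    where
    coprime : Coprime n q
    coprime {i} (i∣n , i∣q) = [ id , (λ i≡n → ⊥-elim (<⇒≱ q<n (∣⇒≤ (subst (_∣ q) i≡n i∣q)))) ]′ (prime⇒irreducible pn i∣n)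
    n≡ : n ≡ suc (n / 2 + n / 2)
    n≡ = trans (odd-form n (unit-odd coprime)) (cong suc (trans (*-comm (n / 2) 2) (cong (n / 2 +_) (+-identityʳ (n / 2)))))
    1≤h : 1 ≤ n / 2
    1≤h = m≥n⇒m/n>0 (prime≥2 pn)

  oddClass-% : ∀ {n} → OddClass n → OddClass (n % q)
  oddClass-% {n} (u , e) = coprime-% u , trans (χ-% n) e

  unit-+ : ∀ j n → Unit n → Unit (j * q + n)
  unit-+ j n u (i∣j+n , i∣q) = u (∣m+n∣m⇒∣n i∣j+n (∣-trans i∣q (n∣m*n j)) , i∣q)

  module _ (y : ℕ) (1≤y : 1 ≤ y) where
    z : ℕ
    z = y ^ s

    1≤z : 1 ≤ z
    1≤z = m^n>0 y {{>-nonZero 1≤y}} s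

    L : List ℕ
    L = sievePrimes q z

    sieving : Sieving L
    sieving = sievePrimes-sieving q z (λ e pe ∤ → proj₁ (large e pe ∤))

    -- A prime above z is divisible by no sieving prime, and a prime above q is a unit modulo q.
    Selected : ℕ → Set
    Selected n = Inert d n × z + q < n

    selected? : ∀ n → Dec (Selected n)
    selected? n = inert? d n ×-dec (z + q <? n)

    selected-avoids : ∀ n → Selected n → Avoids L n
    selected-avoids n ((pn , _) , z+q<n) = All.map (λ {e} (ep , e<z) d → <⇒≱ (≤-<-trans (≤-trans e<z (m≤m+n z q)) z+q<n)
      (≤-reflexive (sym (prime∣prime ep pn d)))) (primes L sieving (sievePrimes-< q z))
      where
      primes : ∀ L → Sieving L → All (_< z) L → All (λ e → Prime (suc e) × e < z) L
      primes [] [] [] = []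
      primes (e ∷ L) (add pe _ _ s) (lt ∷ lts) = (pe , lt) ∷ primes L s lts

    large-primes : All (λ e → 3 ^ s ≤ suc e) L
    large-primes = go L sieving (sievePrimes-avoids q z)
      where
      go : ∀ L → Sieving L → Avoids L q → All (λ e → 3 ^ s ≤ suc e) L
      go [] [] [] = []
      go (e ∷ L) (add pe _ _ sv) (∤ ∷ av) = proj₂ (large e pe ∤) ∷ go L sv av

    D₃≤ : D₃ L z ≤ z * y
    D₃≤ = D₃-bound s y z 1≤s sieving large-primes ≤-refl

    count : ℕ → ℕ → ℕ
    count k₀ T = ∑ (T * q) λ i → ⟦ selected? (k₀ * q + i) ⟧

    class-bound : ∀ k₀ T M a → a < q → ∑ T (λ t → ⟦ selected? (k₀ * q + a + q * t) ⟧) * smoothSum L z M ≤ ⟦ oddClass? a ⟧ * ((T + z * y * (z * y)) * M)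
    class-bound k₀ T M a a<q = go (oddClass? a)
      where
      go : (o? : Dec (OddClass a)) → ∑ T (λ t → ⟦ selected? (k₀ * q + a + q * t) ⟧) * smoothSum L z M ≤ ⟦ o? ⟧ * ((T + z * y * (z * y)) * M)
      go (yes _) = ≤-trans (sieve-count sieving z 1≤z selected? selected-avoids (k₀ * q + a) q T M (sievePrimes-avoids q z))
        (≤-trans (*-monoˡ-≤ M (+-monoʳ-≤ T (*-mono-≤ D₃≤ D₃≤))) (≤-reflexive (sym (+-identityʳ _))))
      go (no ¬o) = ≤-trans (≤-reflexive (cong (_* smoothSum L z M) (∑-zero T λ t _ → ⟦⟧-no (selected? (k₀ * q + a + q * t)) λ { (inert , big) →
          ¬o (subst OddClass (residue t) (oddClass-% (inert-oddClass _ inert (≤-<-trans (m≤n+m q z) big)))) }))) z≤n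
        where
        residue : ∀ t → (k₀ * q + a + q * t) % q ≡ a
        residue t = trans (cong (_% q) (shuffle k₀ q a t)) (trans ([m+kn]%n≡m%n a (k₀ + t) q) (m<n⇒m%n≡m a<q))
          where
          shuffle : ∀ k q a t → k * q + a + q * t ≡ a + (k + t) * q
          shuffle = solve-∀

    count-bound : ∀ k₀ T M → count k₀ T * smoothSum L z M ≤ oddClasses * ((T + z * y * (z * y)) * M)
    count-bound k₀ T M = begin
      count k₀ T * smoothSum L z M
        ≡⟨ cong (_* smoothSum L z M) (trans (∑-grid T q _) (trans (∑-swap T q _) (∑-cong q λ a _ → ∑-cong T λ t _ → cong (λ n → ⟦ selected? n ⟧) (shuffle k₀ q a t)))) ⟩
      ∑ q (λ a → ∑ T (λ t → ⟦ selected? (k₀ * q + a + q * t) ⟧)) * smoothSum L z M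
        ≡⟨ ∑-*ʳ q (smoothSum L z M) _ ⟨
      ∑ q (λ a → ∑ T (λ t → ⟦ selected? (k₀ * q + a + q * t) ⟧) * smoothSum L z M)
        ≤⟨ ∑-mono q (class-bound k₀ T M) ⟩
      ∑ q (λ a → ⟦ oddClass? a ⟧ * ((T + z * y * (z * y)) * M))
        ≡⟨ ∑-*ʳ q _ _ ⟩
      oddClasses * ((T + z * y * (z * y)) * M) ∎
      where
      open ≤-Reasoning
      shuffle : ∀ k q a t → k * q + (t * q + a) ≡ k * q + a + q * t
      shuffle = solve-∀

    units-shift : ∑ q (λ a → ⟦ unit? (suc a) ⟧) ≡ units
    units-shift = +-cancelˡ-≡ ⟦ unit? 0 ⟧ _ _ (begin
      ⟦ unit? 0 ⟧ + ∑ q (λ a → ⟦ unit? (suc a) ⟧) ≡⟨ ∑-head q (λ a → ⟦ unit? a ⟧) ⟨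
      units + ⟦ unit? q ⟧                         ≡⟨ cong (units +_) (⟦⟧-cong (unit? q) (unit? 0) (λ u (_ , i∣q) → u (i∣q , i∣q)) (λ u (i∣q , _) → u (_ ∣0 , i∣q))) ⟩
      units + ⟦ unit? 0 ⟧                         ≡⟨ +-comm units ⟦ unit? 0 ⟧ ⟩
      ⟦ unit? 0 ⟧ + units                         ∎)
      where open ≡-Reasoning

    1<q : 1 < q
    1<q = ≤-trans (*-monoʳ-≤ 2 {1} {d} (s≤s z≤n)) D≤q

    units>0 : 1 ≤ units
    units>0 = ≤-trans (≤-reflexive (sym (⟦⟧-yes (unit? 1) (Coprimality.1-coprimeTo q)))) (∑-term q 1 (λ n → ⟦ unit? n ⟧) 1<q)

    unit-smooth : ∀ n → suc n ≤ z → Unit (suc n) → Smooth L (suc n)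
    unit-smooth n n<z u {zero}  p< (pp , p∣n) = ⊥-elim (<⇒≱ (prime≥2 pp) z≤n)
    unit-smooth n n<z u {suc e} p< (pp , p∣n) = sievePrimes-complete q z e (≤-trans (s≤s⁻¹ p<) n<z) pp
      λ p∣q → <⇒≱ (prime≥2 pp) (≤-reflexive (u (p∣n , p∣q)))

    -- Among the q integers n with j q < n ≤ (j + 1) q there are `units` coprime to q. These have
    -- only sieving primes as factors since n ≤ z, and q M / n is at least M / (j + 1).
    smoothSum-lower : ∀ J M → J * q ≤ z → units * ∑ J (λ j → M / suc j) ≤ smoothSum L z (q * M)
    smoothSum-lower J M J*q≤z = begin
      units * ∑ J (λ j → M / suc j)                                                       ≡⟨ ∑-*ˡ J units _ ⟨
      ∑ J (λ j → units * (M / suc j))                                                     ≡⟨ ∑-cong J (λ j _ → trans (cong (_* (M / suc j)) (sym units-shift)) (sym (∑-*ʳ q (M / suc j) _))) ⟩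
      ∑ J (λ j → ∑ q (λ a → ⟦ unit? (suc a) ⟧ * (M / suc j)))                             ≤⟨ ∑-mono J (λ j j<J → ∑-mono q λ a a<q → pointwise j a j<J a<q) ⟩
      ∑ J (λ j → ∑ q (λ a → ⟦ smooth? L (suc (j * q + a)) ⟧ * quot (q * M) (suc (j * q + a)))) ≡⟨ ∑-grid J q _ ⟨
      ∑ (J * q) (λ n → ⟦ smooth? L (suc n) ⟧ * quot (q * M) (suc n))                      ≤⟨ ∑-extend (λ n → ⟦ smooth? L (suc n) ⟧ * quot (q * M) (suc n)) J*q≤z ⟩
      smoothSum L z (q * M)                                                               ∎
      where
      open ≤-Reasoning
      pointwise : ∀ j a → j < J → a < q → ⟦ unit? (suc a) ⟧ * (M / suc j) ≤ ⟦ smooth? L (suc (j * q + a)) ⟧ * quot (q * M) (suc (j * q + a))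
      pointwise j a j<J a<q = *-mono-≤ (⟦⟧-mono (unit? (suc a)) (smooth? L (suc (j * q + a))) λ u → unit-smooth (j * q + a)
            (≤-trans small (≤-trans (*-monoˡ-≤ q j<J) J*q≤z)) (subst Unit (+-suc (j * q) a) (unit-+ j (suc a) u)))
          (≤-trans (≤-reflexive (sym (m*n/m*o≡n/o q M (suc j) {{_}} {{q*j≢0}}))) (/-monoʳ-≤ (q * M) {{q*j≢0}} {{_}} small′))
        where
        q*j≢0 : NonZero (q * suc j)
        q*j≢0 = m*n≢0 q (suc j)
        small : suc (j * q + a) ≤ suc j * q
        small = ≤-trans (≤-reflexive (sym (+-suc (j * q) a))) (≤-trans (+-monoʳ-≤ (j * q) a<q) (≤-reflexive (+-comm (j * q) q)))
        small′ : suc (j * q + a) ≤ q * suc j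
        small′ = ≤-trans small (≤-reflexive (*-comm (suc j) q))

    -- The number of odd classes is at most half of `units`, which cancels against the factor
    -- `units` of `smoothSum-lower`. What remains is the sieve bound for all integers, improved by
    -- the factor 2 on the left.
    class-sieve : ∀ k₀ T J M → J * q ≤ z → 2 * count k₀ T * ∑ J (λ j → M / suc j) ≤ (T + z * y * (z * y)) * (q * M)
    class-sieve k₀ T J M J*q≤z = *-cancelˡ-≤ units {{>-nonZero units>0}} (lin (+-mono-≤ (*-monoʳ-≤ (2 * count k₀ T) (smoothSum-lower J M J*q≤z))
        (+-mono-≤ (*-monoʳ-≤ 2 (count-bound k₀ T (q * M))) (*-monoˡ-≤ ((T + z * y * (z * y)) * (q * M)) half-classes))) 0
      (identity units (count k₀ T) (∑ J (λ j → M / suc j)) (smoothSum L z (q * M)) oddClasses ((T + z * y * (z * y)) * (q * M))))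
      where
      identity : ∀ u c h s o X → u * (2 * c * h) + (2 * c * s + (2 * (o * X) + u * X)) + 0 ≡ u * X + (2 * c * (u * h) + (2 * (c * s) + 2 * o * X))
      identity = solve-∀

-- Harmonic sums in terms of ι

module Harmonic (R : ℕ) .{{_ : NonZero R}} where
  open Logarithm R

  R^≢0 : ∀ k → NonZero (R ^ k)
  R^≢0 k = >-nonZero (R^>0 k)

  floorPower : ℕ → ℕ
  floorPower k = _/_ (A ^ k) (R ^ k) {{R^≢0 k}}

  floorPower-lower : ∀ k → floorPower k * R ^ k ≤ A ^ k
  floorPower-lower k = m/n*n≤m (A ^ k) (R ^ k) {{R^≢0 k}}

  floorPower-upper : ∀ k → A ^ k ≤ suc (floorPower k) * R ^ k
  floorPower-upper k = ≤-trans (≤-reflexive (m≡m%n+[m/n]*n (A ^ k) (R ^ k) {{R^≢0 k}})) (+-monoˡ-≤ (floorPower k * R ^ k) (<⇒≤ (m%n<n (A ^ k) (R ^ k) {{R^≢0 k}})))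

  floorPower>0 : ∀ k → 1 ≤ floorPower k
  floorPower>0 k = m≥n⇒m/n>0 {{R^≢0 k}} (R^≤A^ k)

  floorPower-max : ∀ k n → n * R ^ k ≤ A ^ k → n ≤ floorPower k
  floorPower-max k n p = ≤-trans (≤-reflexive (sym (m*n/n≡m n (R ^ k) {{R^≢0 k}}))) (/-monoˡ-≤ (R ^ k) {{R^≢0 k}} p)

  floorPower-mono : ∀ k → floorPower k ≤ floorPower (suc k)
  floorPower-mono k = floorPower-max (suc k) (floorPower k) (≤-trans (≤-reflexive (shuffle (floorPower k) R (R ^ k))) (*-mono-≤ (n≤1+n R) (floorPower-lower k)))
    where
    shuffle : ∀ f R r → f * (R * r) ≡ R * (f * r)
    shuffle = solve-∀

  module _ (J : ℕ) where
    partialSum : ℕ → ℕ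
    partialSum n = ∑ n λ j → J / suc j

    -- The terms between a and b are all at least J / b. Adding 1 to each term, which is why the
    -- index itself is added to the partial sums, makes up for the rounding of the quotients.
    block : ∀ a b → a ≤ b → 1 ≤ b → ∃ λ Δ → partialSum b + b ≡ partialSum a + a + Δ × b * J ≤ Δ * b + a * J
    block a b@(suc b′) a≤b _ = Δ , total , (begin
      b * J                       ≡⟨ cong (_* J) (m+[n∸m]≡n a≤b) ⟨
      (a + e) * J                 ≤⟨ lin (*-monoʳ-≤ e J≤) 0 (identity a e J b (J / b)) ⟩
      e * (J / b + 1) * b + a * J ≤⟨ +-monoˡ-≤ (a * J) (*-monoˡ-≤ b enough) ⟩
      Δ * b + a * J               ∎)
      where
      open ≤-Reasoning
      e Δ : ℕ
      e = b ∸ a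
      Δ = ∑ e (λ i → J / suc (a + i)) + e
      total : partialSum b + b ≡ partialSum a + a + Δ
      total = trans (cong₂ _+_ (trans (cong partialSum (sym (m+[n∸m]≡n a≤b))) (∑-split a e _)) (sym (m+[n∸m]≡n a≤b)))
        (shuffle (partialSum a) (∑ e (λ i → J / suc (a + i))) a e)
        where
        shuffle : ∀ p s a e → p + s + (a + e) ≡ p + a + (s + e)
        shuffle = solve-∀
      J≤ : J ≤ (J / b + 1) * b
      J≤ = ≤-trans (≤-reflexive (m≡m%n+[m/n]*n J b)) (≤-trans (+-monoˡ-≤ (J / b * b) (<⇒≤ (m%n<n J b))) (≤-reflexive (shuffle b (J / b))))
        where
        shuffle : ∀ b q → b + q * b ≡ (q + 1) * b
        shuffle = solve-∀
      enough : e * (J / b + 1) ≤ Δ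
      enough = ≤-trans (≤-reflexive (trans (*-distribˡ-+ e (J / b) 1) (cong₂ _+_ (sym (∑-const e (J / b))) (*-identityʳ e))))
        (+-monoˡ-≤ e (∑-mono e λ i i<e → /-monoʳ-≤ J (≤-trans (≤-reflexive (sym (+-suc a i))) (≤-trans (+-monoʳ-≤ a i<e) (≤-reflexive (m+[n∸m]≡n a≤b))))))
      identity : ∀ a e J b q → (a + e) * J + e * ((q + 1) * b) + 0 ≡ e * (q + 1) * b + a * J + e * J
      identity = solve-∀

    -- The multiple of R ^ k pays for rounding ρ^k down.
    levels : ∀ k → A ^ k * (k * J) + 2 * A * R * J * R ^ k ≤ A ^ k * (A * (partialSum (floorPower k) + floorPower k) + 2 * A * R * J)
    levels zero    = ≤-trans (≤-reflexive (*-identityʳ (2 * A * R * J))) (≤-trans (m≤n+m (2 * A * R * J) _) (≤-reflexive (sym (*-identityˡ _))))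
    levels (suc k) = go (block a b (floorPower-mono k) (floorPower>0 (suc k)))
      where
      a b u r Q : ℕ
      a = floorPower k
      b = floorPower (suc k)
      u = A ^ k
      r = R ^ k
      Q = partialSum a + a
      Au≤ : A * u ≤ suc b * (R * r)
      Au≤ = floorPower-upper (suc k)
      u≤2br : u ≤ 2 * b * r
      u≤2br = *-cancelˡ-≤ R (≤-trans (*-monoˡ-≤ u (n≤1+n R)) (≤-trans Au≤ (lin (*-monoˡ-≤ (R * r) (floorPower>0 (suc k))) 0 (identity b R r))))
        where
        identity : ∀ b R r → suc b * (R * r) + b * (R * r) + 0 ≡ R * (2 * b * r) + 1 * (R * r)
        identity = solve-∀
      key : A * u * a ≤ R * u * b + 2 * R * r * b
      key = *-cancelˡ-≤ r {{>-nonZero (R^>0 k)}} (lin (+-mono-≤ (+-mono-≤ (*-monoʳ-≤ (A * u) (floorPower-lower k)) (*-monoˡ-≤ u Au≤)) (*-monoʳ-≤ (R * r) u≤2br)) 0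
          (identity A u r a b R))
        where
        identity : ∀ A u r a b R → r * (A * u * a) + (A * u * u + suc b * (R * r) * u + R * r * (2 * b * r)) + 0
          ≡ r * (R * u * b + 2 * R * r * b) + (A * u * (a * r) + A * u * u + R * r * u)
        identity = solve-∀
      go : (∃ λ Δ → partialSum b + b ≡ partialSum a + a + Δ × b * J ≤ Δ * b + a * J) →
        A * u * (suc k * J) + 2 * A * R * J * (R * r) ≤ A * u * (A * (partialSum b + b) + 2 * A * R * J)
      go (Δ , total , big) = subst (λ t → A * u * (suc k * J) + 2 * A * R * J * (R * r) ≤ A * u * (A * t + 2 * A * R * J)) (sym total)
        (lin (+-mono-≤ (*-monoʳ-≤ A (levels k)) (*-monoʳ-≤ A gain)) 0 (identity₁ R u k J r Q Δ))
        where
        gain : u * J ≤ A * u * Δ + 2 * R * J * r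
        gain = *-cancelˡ-≤ b {{>-nonZero (floorPower>0 (suc k))}} (lin (+-mono-≤ (*-monoʳ-≤ (A * u) big) (*-monoʳ-≤ J key)) 0 (identity₂ R u b J Δ r a))
          where
          identity₂ : ∀ R u b J Δ r a → b * (u * J) + (suc R * u * (Δ * b + a * J) + J * (R * u * b + 2 * R * r * b)) + 0
            ≡ b * (suc R * u * Δ + 2 * R * J * r) + (suc R * u * (b * J) + J * (suc R * u * a))
          identity₂ = solve-∀
        identity₁ : ∀ R u k J r Q Δ → suc R * u * (suc k * J) + 2 * suc R * R * J * (R * r)
            + (suc R * (u * (suc R * Q + 2 * suc R * R * J)) + suc R * (suc R * u * Δ + 2 * R * J * r)) + 0
          ≡ suc R * u * (suc R * (Q + Δ) + 2 * suc R * R * J) + (suc R * (u * (k * J) + 2 * suc R * R * J * r) + suc R * (u * J))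
        identity₁ = solve-∀

  -- From ρ^k to ρ^(k + 1) the harmonic sum grows by about 1 - 1/ρ = 1/A or more, and there are
  -- `ι J` such levels up to J.
  harmonic : ∀ J → 1 ≤ J → J * ι J ≤ A * partialSum J J + A * (1 + 2 * R) * J
  harmonic J 1≤J = *-cancelˡ-≤ (A ^ N) {{>-nonZero (A^>0 N)}} (lin (+-mono-≤ (levels J N) (*-monoʳ-≤ (A ^ N) (*-monoʳ-≤ A
      (+-mono-≤ (∑-extend (λ j → J / suc j) f≤J) f≤J)))) (2 * A * R * J * R ^ N)
      (identity (A ^ N) N J A R (R ^ N) (partialSum J (floorPower N)) (floorPower N) (partialSum J J)))
    where
    N : ℕ
    N = ι J
    f≤J : floorPower N ≤ J
    f≤J = *-cancelʳ-≤ (floorPower N) J (R ^ N) {{R^≢0 N}} (≤-trans (floorPower-lower N) (ι-lower J 1≤J))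
    identity : ∀ u N J A R r p f P → u * (J * N) + (u * (A * (p + f) + 2 * A * R * J) + u * (A * (P + J))) + 2 * A * R * J * r
      ≡ u * (A * P + A * (1 + 2 * R) * J) + (u * (N * J) + 2 * A * R * J * r + u * (A * (p + f)))
    identity = solve-∀

ratio-extend : ∀ R n a b → a ≤ b → n * R ^ a ≤ suc R ^ a → n * R ^ b ≤ suc R ^ b
ratio-extend R n a b a≤b p = begin
  n * R ^ b                       ≡⟨ cong (λ k → n * R ^ k) (m+[n∸m]≡n a≤b) ⟨
  n * R ^ (a + (b ∸ a))           ≡⟨ cong (n *_) (^-distribˡ-+-* R a (b ∸ a)) ⟩
  n * (R ^ a * R ^ (b ∸ a))       ≡⟨ *-assoc n (R ^ a) (R ^ (b ∸ a)) ⟨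
  n * R ^ a * R ^ (b ∸ a)         ≤⟨ *-mono-≤ p (^-monoˡ-≤ (b ∸ a) (n≤1+n R)) ⟩
  suc R ^ a * suc R ^ (b ∸ a)     ≡⟨ ^-distribˡ-+-* (suc R) a (b ∸ a) ⟨
  suc R ^ (a + (b ∸ a))           ≡⟨ cong (suc R ^_) (m+[n∸m]≡n a≤b) ⟩
  suc R ^ b                       ∎
  where open ≤-Reasoning

-- The sieve applied to one cell

module Cells (m R : ℕ) {{R≢0 : NonZero R}} where
  open Logarithm R
  open Harmonic R

  InCell : ℕ → ℕ → Set
  InCell i P = Inert (suc m) P × ι P ≡ i

  inCell? : ∀ i P → Dec (InCell i P)
  inCell? i P = inert? (suc m) P ×-dec (ι P ≟ i)

  cell : ℕ → ℕ → ℕ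
  cell i N = ∑ N λ P → ⟦ inCell? i P ⟧

  module Parameters (v : ℕ) (1≤v : 1 ≤ v) where
    -- The sieve level is z = y^s with y^(2s + 3) at most ρ^i. Then the sieve error (z y)² stays
    -- below ρ^i by a factor y, while 2 log z is about 2s / (2s + 3) of log ρ^i; s depends on v so
    -- that this loss fits into 1 + 1/v. With w = K! every prime not dividing q exceeds K. `Y₀` is
    -- the size of y at which the roundings become harmless, and `G₀` collects the constants lost in
    -- the logarithms.
    s K w q Y₀ c C₀ G₀ i₀ : ℕ
    s = 2 * v + 1
    K = 3 ^ s + 4
    w = K !
    q = w * (2 * (2 * suc m))
    Y₀ = 8 * v * R * (1 + 2 * q) + (q + 2)
    c = A * (1 + 2 * R)
    C₀ = suc (ι (2 * q)) + s * suc (ι 2)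
    G₀ = (2 * s + 3) * (4 * v + 1) + 8 * suc v * (C₀ + c)
    i₀ = (G₀ + suc (suc (ι Y₀ + ι 2))) * (2 * s + 3)

    instance
      q≢0 : NonZero q
      q≢0 = m*n≢0 w (2 * (2 * suc m)) {{K !≢0}}

      n≢0 : NonZero (2 * s + 3)
      n≢0 = >-nonZero (≤-trans (s≤s z≤n) (m≤n+m 3 (2 * s)))

    1≤s : 1 ≤ s
    1≤s = m≤n+m 1 (2 * v)

    large : ∀ e → Prime (suc e) → ¬ (suc e ∣ q) → 3 ≤ e × 3 ^ s ≤ suc e
    large e pe ∤q = s≤s⁻¹ (≤-trans (m≤n+m 4 (3 ^ s)) (<⇒≤ K<p)) , ≤-trans (m≤m+n (3 ^ s) 4) (<⇒≤ K<p)
      where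
      K<p : K < suc e
      K<p = ≰⇒> λ p≤K → ∤q (∣-trans (∣-trans (m∣m*n (e !)) (m≤n⇒m!∣n! p≤K)) (m∣m*n (2 * (2 * suc m))))

    open ClassSieve m w q refl s 1≤s large hiding (z; 1≤z; L)

    module Bound (i : ℕ) (i₀≤i : i₀ ≤ i) where
      g y z J u r x k₀ f T X : ℕ
      g = i / (2 * s + 3)
      y = floorPower g
      z = y ^ s
      J = z / q
      u = A ^ i
      r = R ^ i
      x = floorPower i
      k₀ = x / q
      f = floorPower (suc i)
      T = suc ((f ∸ k₀ * q) / q)
      X = T + z * y * (z * y)

      1≤y : 1 ≤ y
      1≤y = floorPower>0 g

      g≥ : G₀ + suc (suc (ι Y₀ + ι 2)) ≤ g
      g≥ = ≤-trans (≤-reflexive (sym (m*n/n≡m (G₀ + suc (suc (ι Y₀ + ι 2))) (2 * s + 3)))) (/-monoˡ-≤ (2 * s + 3) i₀≤i)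

      g≤ι : g ≤ suc (ι 2) + ι y
      g≤ι = ≤-trans (ι-max (suc y) g (floorPower-upper g)) (≤-trans (ι-mono (s≤s z≤n) (≤-trans (+-monoˡ-≤ y 1≤y) (≤-reflexive (cong (y +_) (sym (+-identityʳ y))))))
        (ι-sub 2 y (s≤s z≤n) 1≤y))

      Y₀≤y : Y₀ ≤ y
      Y₀≤y = ≮⇒≥ λ y<Y₀ → <⇒≱ (≤-trans (m≤n+m (suc (suc (ι Y₀ + ι 2))) G₀) g≥)
        (≤-trans g≤ι (≤-trans (+-monoʳ-≤ (suc (ι 2)) (ι-mono 1≤y (<⇒≤ y<Y₀))) (≤-reflexive (cong suc (+-comm (ι 2) (ι Y₀))))))

      q+2≤y : q + 2 ≤ y
      q+2≤y = ≤-trans (m≤n+m (q + 2) (8 * v * R * (1 + 2 * q))) Y₀≤y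

      y≤z : y ≤ z
      y≤z = ≤-trans (≤-reflexive (sym (^-identityʳ y))) (^-monoʳ-≤ y {{>-nonZero 1≤y}} 1≤s)

      power : y ^ (2 * s + 3) * r ≤ u
      power = ratio-extend R (y ^ (2 * s + 3)) (g * (2 * s + 3)) i (m/n*n≤m i (2 * s + 3)) (begin
        y ^ n * R ^ (g * n)     ≡⟨ cong (y ^ n *_) (^-*-assoc R g n) ⟨
        y ^ n * (R ^ g) ^ n     ≡⟨ ^-distribʳ-* n y (R ^ g) ⟨
        (y * R ^ g) ^ n         ≤⟨ ^-monoˡ-≤ n (floorPower-lower g) ⟩
        (A ^ g) ^ n             ≡⟨ ^-*-assoc A g n ⟩
        A ^ (g * n)             ∎)
        where
        open ≤-Reasoning
        n = 2 * s + 3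

      square-power : z * y * (z * y) * y ≡ y ^ (2 * s + 3)
      square-power = trans (shuffle z y) (trans (cong₂ _*_ (sym (^-distribˡ-+-* y s s)) refl) (trans (sym (^-distribˡ-+-* y (s + s) 3)) (cong (y ^_) (cong (_+ 3) (cong (s +_) (sym (+-identityʳ s)))))))
        where
        shuffle : ∀ z y → z * y * (z * y) * y ≡ z * z * (y * (y * (y * 1)))
        shuffle = solve-∀

      y≤power : y ≤ y ^ (2 * s + 3)
      y≤power = ≤-trans (m≤n*m y (z * y * (z * y)) {{>-nonZero (*-mono-≤ (*-mono-≤ 1≤z 1≤y) (*-mono-≤ 1≤z 1≤y))}}) (≤-reflexive square-power)
        where
        1≤z : 1 ≤ z
        1≤z = ≤-trans 1≤y y≤z

      z+q<power : z + q < y ^ (2 * s + 3)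
      z+q<power = begin-strict
        z + q                    ≤⟨ +-monoʳ-≤ z (m≤n*m q z {{>-nonZero (≤-trans 1≤y y≤z)}}) ⟩
        z + z * q                <⟨ m<m+n (z + z * q) (≤-trans 1≤y y≤z) ⟩
        z + z * q + z            ≡⟨ identity z q ⟩
        z * (q + 2)              ≤⟨ *-monoʳ-≤ z q+2≤y ⟩
        z * y                    ≤⟨ m≤m*n (z * y) (z * y * y) {{>-nonZero (*-mono-≤ (*-mono-≤ (≤-trans 1≤y y≤z) 1≤y) 1≤y)}} ⟩
        z * y * (z * y * y)      ≡⟨ *-assoc (z * y) (z * y) y ⟨
        z * y * (z * y) * y      ≡⟨ square-power ⟩
        y ^ (2 * s + 3)          ∎
        where
        open ≤-Reasoning
        identity : ∀ z q → z + z * q + z ≡ z * (q + 2)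
        identity = solve-∀

      cell-lower : ∀ {P} → InCell i P → u ≤ P * r
      cell-lower {P} ((pp , _) , refl) = ι-lower P (≤-trans (s≤s z≤n) (prime≥2 pp))

      cell-≥x : ∀ {P} → InCell i P → x ≤ P
      cell-≥x {P} ic = *-cancelʳ-≤ x P r {{R^≢0 i}} (≤-trans (floorPower-lower i) (cell-lower ic))

      cell-≤f : ∀ {P} → InCell i P → P ≤ f
      cell-≤f {P} (_ , ιP≡i) = floorPower-max (suc i) P (<⇒≤ (ι-upper P (suc i) (s≤s (≤-reflexive ιP≡i))))

      k₀q≤x : k₀ * q ≤ x
      k₀q≤x = m/n*n≤m x q

      x≤f : x ≤ f
      x≤f = floorPower-mono i

      in-range : ∀ {P} → InCell i P → P < k₀ * q + T * q
      in-range {P} ic = ≤-<-trans (cell-≤f ic) (subst (_< k₀ * q + T * q) (m+[n∸m]≡n (≤-trans k₀q≤x x≤f)) (+-monoʳ-< (k₀ * q) (begin-strict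
        f ∸ k₀ * q                                                 ≡⟨ m≡m%n+[m/n]*n (f ∸ k₀ * q) q ⟩
        (f ∸ k₀ * q) % q + (f ∸ k₀ * q) / q * q                    <⟨ +-monoˡ-< ((f ∸ k₀ * q) / q * q) (m%n<n (f ∸ k₀ * q) q) ⟩
        T * q                                                      ∎)))
        where open ≤-Reasoning

      cell-selected : ∀ P → InCell i P → Selected y 1≤y P
      cell-selected P ic = proj₁ ic , <-≤-trans z+q<power (*-cancelʳ-≤ (y ^ (2 * s + 3)) P r {{R^≢0 i}} (≤-trans power (cell-lower ic)))

      C : ℕ
      C = count y 1≤y k₀ T

      cell≤C : ∀ N → cell i N ≤ C
      cell≤C N = begin
        cell i N                                                       ≤⟨ ∑-extend (λ P → ⟦ inCell? i P ⟧) (m≤n+m N N′) ⟩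
        cell i (N′ + N)                                                ≡⟨ ∑-split N′ N _ ⟩
        cell i N′ + ∑ N (λ j → ⟦ inCell? i (N′ + j) ⟧)                 ≡⟨ cong₂ _+_ (∑-split (k₀ * q) (T * q) _) (∑-zero N λ j _ → ⟦⟧-no (inCell? i (N′ + j)) λ ic → <⇒≱ (in-range ic) (m≤m+n N′ j)) ⟩
        cell i (k₀ * q) + ∑ (T * q) (λ j → ⟦ inCell? i (k₀ * q + j) ⟧) + 0
          ≡⟨ trans (+-identityʳ _) (cong (_+ ∑ (T * q) (λ j → ⟦ inCell? i (k₀ * q + j) ⟧)) (∑-zero (k₀ * q) λ P P< → ⟦⟧-no (inCell? i P) λ ic → <⇒≱ P< (≤-trans k₀q≤x (cell-≥x ic)))) ⟩
        ∑ (T * q) (λ j → ⟦ inCell? i (k₀ * q + j) ⟧)                   ≤⟨ ∑-mono (T * q) (λ j _ → ⟦⟧-mono (inCell? i (k₀ * q + j)) (selected? y 1≤y (k₀ * q + j)) (cell-selected (k₀ * q + j))) ⟩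
        C                                                              ∎
        where
        open ≤-Reasoning
        N′ = k₀ * q + T * q

      -- The cell has length ρ^(i + 1) - ρ^i = ρ^i / R; rounding its ends and covering it by whole
      -- blocks of length q adds at most 1 + 2 q.
      length : q * T * (R * r) ≤ u + (1 + 2 * q) * (R * r)
      length = lin (+-mono-≤ (+-mono-≤ (*-monoˡ-≤ (R * r) range) (floorPower-lower (suc i))) (*-monoʳ-≤ R (floorPower-upper i))) 0 (identity (q * T) R r u x f q)
        where
        identity : ∀ t R r u x f q → t * (R * r) + ((f + 2 * q) * (R * r) + suc R * u + R * (suc x * r)) + 0 ≡ u + (1 + 2 * q) * (R * r) + ((t + x) * (R * r) + f * (R * r) + R * u)
        identity = solve-∀
        range : q * T + x ≤ f + 2 * q
        range = lin (+-mono-≤ (+-mono-≤ (m/n*n≤m (f ∸ k₀ * q) q) (≤-reflexive (m≡m%n+[m/n]*n x q))) (+-mono-≤ (<⇒≤ (m%n<n x q)) (≤-reflexive (m+[n∸m]≡n (≤-trans k₀q≤x x≤f))))) 0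
            (identity′ q ((f ∸ k₀ * q) / q) x f (f ∸ k₀ * q) k₀ (x % q))
          where
          identity′ : ∀ q t x f e k p → q * suc t + x + (e + (p + k * q) + (q + f)) + 0 ≡ f + 2 * q + (t * q + x + (p + (k * q + e)))
          identity′ = solve-∀

      -- The two extra units of u pay for the rounding of the length and for the sieve error; each
      -- is small because y ≥ `Y₀`.
      X-bound : 8 * v * (q * X) * (R * r) ≤ (8 * v + 2) * u
      X-bound = lin (+-mono-≤ (*-monoʳ-≤ (8 * v) length) (+-mono-≤ (≤-trans (*-monoˡ-≤ r (≤-trans (m≤m+n (8 * v * R * (1 + 2 * q)) (q + 2)) (≤-trans Y₀≤y y≤power))) power)
          (≤-trans (*-monoˡ-≤ (z * y * (z * y) * r) 8vRq≤y) (≤-trans (≤-reflexive (trans (shuffle y (z * y * (z * y)) r) (cong (_* r) square-power))) power)))) 0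
          (identity v q T R r u (z * y * (z * y)))
        where
        shuffle : ∀ y a r → y * (a * r) ≡ a * y * r
        shuffle = solve-∀
        8vRq≤y : 8 * v * R * q ≤ y
        8vRq≤y = ≤-trans (≤-trans (*-monoʳ-≤ (8 * v * R) (≤-trans (m≤m+n q (q + 0)) (n≤1+n (2 * q)))) (m≤m+n (8 * v * R * (1 + 2 * q)) (q + 2))) Y₀≤y
        identity : ∀ v q T R r u Z → 8 * v * (q * (T + Z)) * (R * r) + (8 * v * (u + (1 + 2 * q) * (R * r)) + (u + u)) + 0
          ≡ (8 * v + 2) * u + (8 * v * (q * T * (R * r)) + (8 * v * R * (1 + 2 * q) * r + 8 * v * R * q * (Z * r)))
        identity = solve-∀

      1≤J : 1 ≤ J
      1≤J = m≥n⇒m/n>0 (≤-trans (≤-trans (m≤m+n q 2) q+2≤y) y≤z)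

      sieved : 2 * C * ι J ≤ A * (X * q) + 2 * C * c
      sieved = *-cancelˡ-≤ J {{>-nonZero 1≤J}} (lin (+-mono-≤ (*-monoʳ-≤ (2 * C) (harmonic J 1≤J)) (*-monoʳ-≤ A (class-sieve y 1≤y k₀ T J J (m/n*n≤m z q)))) 0
        (identity J C (ι J) A (partialSum J J) R X q))
        where
        identity : ∀ J C l A P R X q → J * (2 * C * l) + (2 * C * (A * P + A * (1 + 2 * R) * J) + A * (X * (q * J))) + 0
          ≡ J * (A * (X * q) + 2 * C * (A * (1 + 2 * R))) + (2 * C * (J * l) + A * (2 * C * P))
        identity = solve-∀

      ι-J : s * g ≤ ι J + C₀
      ι-J = lin (+-mono-≤ (*-monoʳ-≤ s g≤ι) (+-mono-≤ (ι-pow-super y s 1≤y) (≤-trans (ι-mono (≤-trans 1≤y y≤z) z≤) (ι-sub (2 * q) J 1≤2q 1≤J)))) 0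
          (identity s g (ι 2) (ι y) (ι z) (ι (2 * q)) (ι J))
        where
        1≤2q : 1 ≤ 2 * q
        1≤2q = ≤-trans (>-nonZero⁻¹ q) (m≤m+n q (q + 0))
        z≤ : z ≤ 2 * q * J
        z≤ = ≤-trans (≤-reflexive (m≡m%n+[m/n]*n z q)) (≤-trans (+-monoˡ-≤ (J * q) (<⇒≤ (m%n<n z q))) (lin (*-monoʳ-≤ q 1≤J) 0 (identity′ q J)))
          where
          identity′ : ∀ q J → q + J * q + q * J + 0 ≡ 2 * q * J + q * 1
          identity′ = solve-∀
        identity : ∀ s g t ly lz lq lJ → s * g + (s * (suc t + ly) + (lz + (suc lq + lJ))) + 0 ≡ lJ + (suc lq + s * suc t) + (s * g + (s * ly + lz))
        identity = solve-∀

      -- `ι J` is nearly s g, and i + 1 is at most (2s + 3) (g + 1). Since 8 (v + 1) s exceeds (2s +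
      -- 3) (4v + 1) by 3, a surplus of 3 g remains, of which one g absorbs the constants in `G₀`.
      index : suc i * (4 * v + 1) + 8 * suc v * c ≤ 8 * suc v * ι J
      index = lin (+-mono-≤ (*-monoˡ-≤ (4 * v + 1) i<) (+-mono-≤ (*-monoʳ-≤ (8 * suc v) ι-J) (≤-trans (m≤m+n G₀ _) g≥))) (2 * g)
          (identity v (suc i) g (ι J) C₀ c)
        where
        i< : suc i ≤ suc g * (2 * s + 3)
        i< = ≤-trans (≤-reflexive (cong suc (m≡m%n+[m/n]*n i (2 * s + 3)))) (+-monoˡ-≤ (g * (2 * s + 3)) (m%n<n i (2 * s + 3)))
        identity : ∀ v I g l C c → I * (4 * v + 1) + 8 * suc v * c + (suc g * (2 * (2 * v + 1) + 3) * (4 * v + 1) + (8 * suc v * (l + C) + g)) + 2 * g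
          ≡ 8 * suc v * l + (I * (4 * v + 1) + (8 * suc v * ((2 * v + 1) * g) + ((2 * (2 * v + 1) + 3) * (4 * v + 1) + 8 * suc v * (C + c))))
        identity = solve-∀

      -- `X-bound` loses the factor (4v + 1) / 4v and `index` the factor 4 (v + 1) / (4v + 1); their
      -- product is exactly (v + 1) / v.
      cell-bound : ∀ N → v * (cell i N * suc i) * (R * r) ≤ suc v * (A * u)
      cell-bound N = ≤-trans (*-monoˡ-≤ (R * r) (*-monoʳ-≤ v (*-monoˡ-≤ (suc i) (cell≤C N)))) (*-cancelˡ-≤ (2 * (4 * v + 1)) {{>-nonZero (≤-trans (s≤s z≤n) (*-monoʳ-≤ 2 (m≤n+m 1 (4 * v))))}}
        (lin (+-mono-≤ (*-monoʳ-≤ (2 * v * (R * r)) (+-mono-≤ (*-monoʳ-≤ C index) (*-monoʳ-≤ (4 * suc v) sieved))) (*-monoʳ-≤ (suc v * A) X-bound)) 0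
          (identity v C (suc i) R r A u X q c (ι J))))
        where
        identity : ∀ v C I R r A u X q c l → 2 * (4 * v + 1) * (v * (C * I) * (R * r)) + (2 * v * (R * r) * (C * (8 * suc v * l) + 4 * suc v * (A * (X * q) + 2 * C * c)) + suc v * A * ((8 * v + 2) * u)) + 0
          ≡ 2 * (4 * v + 1) * (suc v * (A * u)) + (2 * v * (R * r) * (C * (I * (4 * v + 1) + 8 * suc v * c) + 4 * suc v * (2 * C * l)) + suc v * A * (8 * v * (q * X) * (R * r)))
        identity = solve-∀

  -- The bound reads (i + 1) · cell ≤ (1 + 1/v) ρ^(i + 1). With logarithms to the base ρ a cell
  -- therefore adds at most (1 + 1/v) ρ to the sum of log P / P.
  cells-bound : ∀ v → 1 ≤ v → ∃ λ i₀ → ∀ i → i₀ ≤ i → ∀ N → v * (cell i N * suc i) * (R * R ^ i) ≤ suc v * (A * A ^ i)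
  cells-bound v 1≤v = i₀ , λ i i₀≤i N → Bound.cell-bound i i₀≤i N
    where open Parameters v 1≤v

-- Density

-- The pairs at distance M or M + 1 form a cycle of odd length on 2M + 1 consecutive indices.
window : ∀ M (u : ℕ → ℕ) → (∀ j → u j ≤ 1) → (∀ j → u j + u (M + j) ≤ 1) → (∀ j → u j + u (suc M + j) ≤ 1) → ∑ (suc (M + M)) u ≤ M
window M u u≤1 near far = go (u M) refl (u≤1 M)
  where
  paired : ∀ (f g : ℕ → ℕ) → (∀ j → f j + g j ≤ 1) → ∑ M f + ∑ M g ≤ M
  paired f g h = ≤-trans (≤-reflexive (sym (∑-+ M f g))) (≤-trans (∑-mono M λ j _ → h j) (≤-reflexive (trans (∑-const M 1) (*-identityʳ M))))
  go : ∀ x → u M ≡ x → x ≤ 1 → ∑ (suc (M + M)) u ≤ M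
  go zero uM _ = ≤-trans (≤-reflexive (trans (cong (λ n → ∑ n u) (sym (+-suc M M))) (trans (∑-split M (suc M) u) (cong (∑ M u +_) (trans (∑-head M _)
      (cong₂ _+_ (trans (cong u (+-identityʳ M)) uM) (∑-cong M λ j _ → cong u (+-suc M j)))))))) (paired u (λ j → u (suc M + j)) far)
  go (suc zero) uM _ = ≤-trans (≤-reflexive (trans (cong₂ _+_ (∑-split M M u) last) (+-identityʳ _))) (paired u (λ j → u (M + j)) near)
    where
    last : u (M + M) ≡ 0
    last = n≤0⇒n≡0 (s≤s⁻¹ (subst (λ x → x + u (M + M) ≤ 1) uM (near M)))
  go (suc (suc x)) uM (s≤s ())

window-density : ∀ M W (u : ℕ → ℕ) → (∀ j → u j ≤ 1) → (∀ j → u j + u (M + j) ≤ 1) → (∀ j → u j + u (suc M + j) ≤ 1) → ∑ (W * suc (M + M)) u ≤ W * M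
window-density M W u u≤1 near far = ≤-trans (≤-reflexive (∑-grid W (suc (M + M)) u)) (≤-trans (∑-mono W λ t _ → window M (λ j → u (t * suc (M + M) + j)) (λ j → u≤1 _)
    (λ j → subst (λ k → u (t * suc (M + M) + j) + u k ≤ 1) (shuffle M (t * suc (M + M)) j) (near _))
    (λ j → subst (λ k → u (t * suc (M + M) + j) + u k ≤ 1) (shuffle (suc M) (t * suc (M + M)) j) (far _)))
  (≤-reflexive (∑-const W M)))
  where
  shuffle : ∀ M b j → M + (b + j) ≡ b + (M + j)
  shuffle = solve-∀

∑-blocks : ∀ B K {{_ : NonZero K}} (u : ℕ → ℕ) → ∑ (B * K) (λ i → u (i / K)) ≡ K * ∑ B u
∑-blocks B K u = trans (∑-grid B K _) (trans (∑-cong B λ t _ → trans (∑-cong K λ a a<K → cong u (div≡ t a a<K)) (∑-const K (u t))) (∑-*ˡ B K u))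
  where
  div≡ : ∀ t a → a < K → (t * K + a) / K ≡ t
  div≡ t a a<K = trans (cong (_/ K) (+-comm (t * K) a)) (trans ([m+kn]/n≡m/n+k a t K) (cong (_+ t) (m<n⇒m/n≡0 a<K)))

-- This is (1 - 1/(R + 1))^n ≥ 1 - n/(R + 1), an upper bound for powers of ρ.
bernoulli⁻ : ∀ R n → suc R ^ n * suc R ≤ R ^ n * suc R + n * suc R ^ n
bernoulli⁻ R zero    = m≤m+n _ 0
bernoulli⁻ R (suc n) = lin (+-mono-≤ (*-monoʳ-≤ R (bernoulli⁻ R n)) z≤n) (n * suc R ^ n) (identity R n (suc R ^ n) (R ^ n))
  where
  identity : ∀ R n u r → suc R * u * suc R + (R * (r * suc R + n * u) + 0) + n * u ≡ R * r * suc R + suc n * (suc R * u) + (R * (u * suc R) + 0)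
  identity = solve-∀

-- Choice of the blocks and of the error parameters for an interval (a, b)

module Choice (a₁ a₂ b₁ b₂ : ℕ) (1≤a₂ : 1 ≤ a₂) (1≤b₂ : 1 ≤ b₂) (1<a : a₂ < a₁) (a<b : a₁ * b₂ < b₁ * a₂) where
  -- Integrality gives b / a ≥ 1 + 1/k. Primes M or M + 1 blocks of K cells apart have a quotient
  -- between ρ^(K (M - 1)) = ρ^(K E) and ρ^(K (M + 2)) = ρ^(K n), so a spread of ρ^(3K) has to fit
  -- into b / a. For this s is so large that (1 + 1/3k)^s exceeds a. Then v is chosen for `margin`,
  -- and R, larger than v, for `fine`.
  k s E M n v R : ℕ
  k = a₁ * b₂
  s = 3 * k * a₁
  E = 3 * s
  M = suc E
  n = E + 3
  v = 8 * M + 4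
  R = v + 2 + n * suc (3 * k)

  instance
    R≢0 : NonZero R
    R≢0 = >-nonZero (≤-trans (s≤s z≤n) (≤-trans (m≤n+m 2 v) (m≤m+n (v + 2) _)))

  1≤a₁ : 1 ≤ a₁
  1≤a₁ = ≤-trans (s≤s z≤n) 1<a

  1≤k : 1 ≤ k
  1≤k = *-mono-≤ 1≤a₁ 1≤b₂

  1≤s : 1 ≤ s
  1≤s = *-mono-≤ (*-mono-≤ {1} {3} (s≤s z≤n) 1≤k) 1≤a₁

  open Logarithm R

  Below : ℕ → Set
  Below j = a₂ * A ^ (j * E) < a₁ * R ^ (j * E)

  below? : ∀ j → Dec (Below j)
  below? j = a₂ * A ^ (j * E) <? a₁ * R ^ (j * E)

  open Greatest below? using (greatest; greatest-holds; greatest-max)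

  1≤E : 1 ≤ E
  1≤E = *-mono-≤ {1} {3} (s≤s z≤n) 1≤s

  below-bounded : ∀ j → Below j → j ≤ ι a₁
  below-bounded j bl = ≤-trans (≤-trans (≤-reflexive (sym (*-identityʳ j))) (*-monoʳ-≤ j 1≤E))
    (ι-max a₁ (j * E) (≤-trans (m≤n*m (A ^ (j * E)) a₂ {{>-nonZero 1≤a₂}}) (<⇒≤ bl)))

  K′ K : ℕ
  K′ = greatest (ι a₁)
  K = suc K′

  K′-below : Below K′
  K′-below = greatest-holds (ι a₁) (subst₂ _<_ (sym (*-identityʳ a₂)) (sym (*-identityʳ a₁)) 1<a)

  K-above : a₁ * R ^ (K * E) ≤ a₂ * A ^ (K * E)
  K-above = ≮⇒≥ λ bl → <-irrefl refl (greatest-max (ι a₁) K (below-bounded K bl) bl)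

  -- ρ^(3K′) ≤ 1 + 1/3k, since otherwise ρ^(3K′s) would exceed a.
  coarse : A ^ (3 * K′) * (3 * k) ≤ suc (3 * k) * R ^ (3 * K′)
  coarse = ≮⇒≥ λ lt → <-irrefl refl (begin-strict
    (3 * k) ^ s * (a₂ * A ^ (K′ * E))          <⟨ *-monoʳ-< ((3 * k) ^ s) {{>-nonZero (m^n>0 (3 * k) {{3k≢0}} s)}} K′-below ⟩
    (3 * k) ^ s * (a₁ * R ^ (K′ * E))          ≡⟨ *-assoc ((3 * k) ^ s) a₁ (R ^ (K′ * E)) ⟨
    (3 * k) ^ s * a₁ * R ^ (K′ * E)            ≤⟨ *-monoˡ-≤ (R ^ (K′ * E)) growth ⟩
    suc (3 * k) ^ s * R ^ (K′ * E)             ≡⟨ trans (cong (λ e → suc (3 * k) ^ s * R ^ e) exponent) (trans (cong (suc (3 * k) ^ s *_) (sym (^-*-assoc R (3 * K′) s))) (sym (^-distribʳ-* s (suc (3 * k)) (R ^ (3 * K′))))) ⟩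
    (suc (3 * k) * R ^ (3 * K′)) ^ s           ≤⟨ ^-monoˡ-≤ s (<⇒≤ lt) ⟩
    (A ^ (3 * K′) * (3 * k)) ^ s               ≡⟨ trans (^-distribʳ-* s (A ^ (3 * K′)) (3 * k)) (trans (cong (_* (3 * k) ^ s) (trans (^-*-assoc A (3 * K′) s) (cong (A ^_) (sym exponent)))) (*-comm (A ^ (K′ * E)) ((3 * k) ^ s))) ⟩
    (3 * k) ^ s * A ^ (K′ * E)                 ≤⟨ *-monoʳ-≤ ((3 * k) ^ s) (m≤n*m (A ^ (K′ * E)) a₂ {{>-nonZero 1≤a₂}}) ⟩
    (3 * k) ^ s * (a₂ * A ^ (K′ * E))          ∎)
    where
    open ≤-Reasoning
    3k≢0 : NonZero (3 * k)
    3k≢0 = >-nonZero (*-mono-≤ {1} {3} (s≤s z≤n) 1≤k)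
    exponent : K′ * E ≡ 3 * K′ * s
    exponent = shuffle K′ s
      where
      shuffle : ∀ j s → j * (3 * s) ≡ 3 * j * s
      shuffle = solve-∀
    growth : (3 * k) ^ s * a₁ ≤ suc (3 * k) ^ s
    growth = *-cancelʳ-≤ _ _ (3 * k) {{3k≢0}} (≤-trans (lin z≤n ((3 * k) ^ s * (3 * k)) (identity ((3 * k) ^ s) (3 * k) a₁)) (bernoulli (3 * k) s))
      where
      identity : ∀ u t a → u * a * t + 0 + u * t ≡ u * (t + t * a) + 0
      identity = solve-∀

  fine : A ^ n * (3 * k) ≤ suc (3 * k) * R ^ n
  fine = *-cancelʳ-≤ (A ^ n * (3 * k)) (suc (3 * k) * R ^ n) A (lin (+-mono-≤ (*-monoʳ-≤ (suc (3 * k)) (bernoulli⁻ R n)) (*-monoˡ-≤ (A ^ n) large)) 0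
      (identity (3 * k) (A ^ n) A (R ^ n) n))
    where
    large : n * suc (3 * k) ≤ A
    large = m≤n⇒m≤1+n (m≤n+m (n * suc (3 * k)) (v + 2))
    identity : ∀ t u A r n → u * t * A + (suc t * (r * A + n * u) + A * u) + 0 ≡ suc t * r * A + (suc t * (u * A) + n * suc t * u)
    identity = solve-∀

  -- Since K = K′ + 1, the power ρ^(K (E + 3)) is ρ^(K′ E) · ρ^(3 K′) · ρ^n. The first factor is
  -- less than a, the others are at most 1 + 1/3k, and (1 + 1/3k)² ≤ 1 + 1/k.
  K-below : b₂ * A ^ (K * (E + 3)) ≤ b₁ * R ^ (K * (E + 3))
  K-below = *-cancelˡ-≤ (a₂ * (3 * k * (3 * k))) {{>-nonZero (*-mono-≤ 1≤a₂ (*-mono-≤ 1≤3k 1≤3k))}} (begin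
    a₂ * (3 * k * (3 * k)) * (b₂ * A ^ (K * n))                                         ≡⟨ cong (λ t → a₂ * (3 * k * (3 * k)) * (b₂ * t)) (power A) ⟩
    a₂ * (3 * k * (3 * k)) * (b₂ * (A ^ (K′ * E) * A ^ (3 * K′) * A ^ n))               ≡⟨ e₁ a₂ (3 * k) b₂ (A ^ (K′ * E)) (A ^ (3 * K′)) (A ^ n) ⟩
    b₂ * (a₂ * A ^ (K′ * E)) * ((A ^ (3 * K′) * (3 * k)) * (A ^ n * (3 * k)))           ≤⟨ *-mono-≤ (*-monoʳ-≤ b₂ (<⇒≤ K′-below)) (*-mono-≤ coarse fine) ⟩
    b₂ * (a₁ * R ^ (K′ * E)) * ((suc (3 * k) * R ^ (3 * K′)) * (suc (3 * k) * R ^ n))   ≡⟨ e₂ b₂ a₁ (suc (3 * k)) (R ^ (K′ * E)) (R ^ (3 * K′)) (R ^ n) ⟩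
    a₁ * b₂ * (suc (3 * k) * suc (3 * k)) * (R ^ (K′ * E) * R ^ (3 * K′) * R ^ n)       ≤⟨ *-monoˡ-≤ _ gap ⟩
    a₂ * (3 * k * (3 * k)) * b₁ * (R ^ (K′ * E) * R ^ (3 * K′) * R ^ n)                 ≡⟨ trans (*-assoc (a₂ * (3 * k * (3 * k))) b₁ _) (cong (λ t → a₂ * (3 * k * (3 * k)) * (b₁ * t)) (sym (power R))) ⟩
    a₂ * (3 * k * (3 * k)) * (b₁ * R ^ (K * n))                                         ∎)
    where
    open ≤-Reasoning
    1≤3k : 1 ≤ 3 * k
    1≤3k = *-mono-≤ {1} {3} (s≤s z≤n) 1≤k
    power : ∀ x → x ^ (K * n) ≡ x ^ (K′ * E) * x ^ (3 * K′) * x ^ n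
    power x = trans (cong (x ^_) (shuffle K′ E)) (trans (^-distribˡ-+-* x (K′ * E + 3 * K′) n) (cong (_* x ^ n) (^-distribˡ-+-* x (K′ * E) (3 * K′))))
      where
      shuffle : ∀ j E → suc j * (E + 3) ≡ j * E + 3 * j + (E + 3)
      shuffle = solve-∀
    e₁ : ∀ a t b x y z → a * (t * t) * (b * (x * y * z)) ≡ b * (a * x) * ((y * t) * (z * t))
    e₁ = solve-∀
    e₂ : ∀ b a t x y z → b * (a * x) * ((t * y) * (t * z)) ≡ a * b * (t * t) * (x * y * z)
    e₂ = solve-∀
    gap : a₁ * b₂ * (suc (3 * k) * suc (3 * k)) ≤ a₂ * (3 * k * (3 * k)) * b₁
    gap = lin (+-mono-≤ (*-monoʳ-≤ (9 * (k * k)) a<b) (*-monoʳ-≤ k 1≤k)) (2 * (k * k)) (identity a₂ k b₁)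
      where
      identity : ∀ a k b → k * (suc (3 * k) * suc (3 * k)) + (9 * (k * k) * (b * a) + k * k) + 2 * (k * k) ≡ a * (3 * k * (3 * k)) * b + (9 * (k * k) * suc k + k * 1)
      identity = solve-∀

  1≤v : 1 ≤ v
  1≤v = ≤-trans (s≤s z≤n) (m≤n+m 4 (8 * M))

  -- Divided by v² R this says 2M (1 + 1/v)² ρ + (2M + 1) / v < 2M + 1. As R exceeds v, the losses
  -- amount to about (8M + 1) / v, which explains `8 * M + 4`.
  margin : 2 * (suc v * suc v * suc R) * M + suc (M + M) * v * R + 1 ≤ v * v * R * suc (M + M)
  margin = lin {0} {0} z≤n (176 * (M * M) + 226 * M + 71 + n * suc (3 * k) * (16 * (M * M) + 30 * M + 12)) (identity M (n * suc (3 * k)))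
    where
    identity : ∀ M e → 2 * (suc (8 * M + 4) * suc (8 * M + 4) * suc (8 * M + 4 + 2 + e)) * M + suc (M + M) * (8 * M + 4) * (8 * M + 4 + 2 + e) + 1 + 0
        + (176 * (M * M) + 226 * M + 71 + e * (16 * (M * M) + 30 * M + 12))
      ≡ (8 * M + 4) * (8 * M + 4) * (8 * M + 4 + 2 + e) * suc (M + M) + 0
    identity = solve-∀

-- Occupied blocks and the contradiction

module Density (m : ℕ) (aniso : ∀ a b → a * a ≡ suc m * (b * b) → b ≡ 0)
  (a₁ a₂ b₁ b₂ : ℕ) (1≤a₁ : 1 ≤ a₁) (1≤b₂ : 1 ≤ b₂) (E v R K : ℕ) {{R≢0 : NonZero R}} {{K≢0 : NonZero K}} (1≤v : 1 ≤ v)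
  (K-above : a₁ * R ^ (K * E) ≤ a₂ * suc R ^ (K * E)) (K-below : b₂ * suc R ^ (K * (E + 3)) ≤ b₁ * R ^ (K * (E + 3)))
  (margin : 2 * (suc v * suc v * suc R) * suc E + suc (suc E + suc E) * v * R + 1 ≤ v * v * R * suc (suc E + suc E)) where
  d M n : ℕ
  d = suc m
  M = suc E
  n = E + 3

  open Logarithm R
  open Cells m R using (InCell; inCell?; cell; cells-bound)
  open InertMass d (s≤s z≤n) aniso R using (inertMass; inertMass-lower)

  Good : ℕ → ℕ → Set
  Good P Q = (Inert d P × Inert d Q) × (a₁ * Q < P * a₂ × P * b₂ < b₁ * Q)

  good? : ∀ P Q → Dec (Good P Q)
  good? P Q = (inert? d P ×-dec inert? d Q) ×-dec ((a₁ * Q <? P * a₂) ×-dec (P * b₂ <? b₁ * Q))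

  inert≥1 : ∀ {P} → Inert d P → 1 ≤ P
  inert≥1 (pp , _) = ≤-trans (s≤s z≤n) (prime≥2 pp)

  -- Primes lying M or M + 1 blocks of K cells apart have their quotient in the interval.
  separated-lower : ∀ {P Q} → 1 ≤ P → K * E + suc (ι Q) ≤ ι P → a₁ * Q < P * a₂
  separated-lower {P} {Q} 1≤P sep = *-cancelˡ-< (R ^ (K * E) * R ^ t) _ _ (begin-strict
    R ^ (K * E) * R ^ t * (a₁ * Q)           ≡⟨ e₁ (R ^ (K * E)) (R ^ t) a₁ Q ⟩
    a₁ * R ^ (K * E) * (Q * R ^ t)           <⟨ *-monoʳ-< (a₁ * R ^ (K * E)) {{>-nonZero (*-mono-≤ 1≤a₁ (R^>0 (K * E)))}} (ι-upper Q t ≤-refl) ⟩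
    a₁ * R ^ (K * E) * A ^ t                 ≤⟨ *-monoˡ-≤ (A ^ t) K-above ⟩
    a₂ * A ^ (K * E) * A ^ t                 ≡⟨ trans (*-assoc a₂ (A ^ (K * E)) (A ^ t)) (cong (a₂ *_) (sym (^-distribˡ-+-* A (K * E) t))) ⟩
    a₂ * A ^ (K * E + t)                     ≤⟨ *-monoʳ-≤ a₂ (ratio-mono P (K * E + t) (ι P) sep (ι-lower P 1≤P)) ⟩
    a₂ * (P * R ^ (K * E + t))               ≡⟨ cong (λ x → a₂ * (P * x)) (^-distribˡ-+-* R (K * E) t) ⟩
    a₂ * (P * (R ^ (K * E) * R ^ t))         ≡⟨ e₂ a₂ P (R ^ (K * E) * R ^ t) ⟩
    R ^ (K * E) * R ^ t * (P * a₂)           ∎)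
    where
    open ≤-Reasoning
    t : ℕ
    t = suc (ι Q)
    e₁ : ∀ x y a q → x * y * (a * q) ≡ a * x * (q * y)
    e₁ = solve-∀
    e₂ : ∀ a p x → a * (p * x) ≡ x * (p * a)
    e₂ = solve-∀

  separated-upper : ∀ {P Q} → 1 ≤ Q → suc (ι P) ≤ K * (E + 3) + ι Q → P * b₂ < b₁ * Q
  separated-upper {P} {Q} 1≤Q sep = *-cancelˡ-< (R ^ (K * n) * R ^ t) _ _ (begin-strict
    R ^ (K * n) * R ^ t * (P * b₂)           ≡⟨ trans (cong (_* (P * b₂)) (sym (^-distribˡ-+-* R (K * n) t))) (e₁ (R ^ (K * n + t)) P b₂) ⟩
    P * R ^ (K * n + t) * b₂                 <⟨ *-monoˡ-< b₂ {{>-nonZero 1≤b₂}} (ι-upper P (K * n + t) sep) ⟩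
    A ^ (K * n + t) * b₂                     ≡⟨ trans (cong (_* b₂) (^-distribˡ-+-* A (K * n) t)) (e₂ (A ^ (K * n)) (A ^ t) b₂) ⟩
    b₂ * A ^ (K * n) * A ^ t                 ≤⟨ *-mono-≤ K-below (ι-lower Q 1≤Q) ⟩
    b₁ * R ^ (K * n) * (Q * R ^ t)           ≡⟨ e₃ b₁ (R ^ (K * n)) Q (R ^ t) ⟩
    R ^ (K * n) * R ^ t * (b₁ * Q)           ∎)
    where
    open ≤-Reasoning
    t : ℕ
    t = ι Q
    e₁ : ∀ x p b → x * (p * b) ≡ p * x * b
    e₁ = solve-∀
    e₂ : ∀ x y b → x * y * b ≡ b * x * y
    e₂ = solve-∀
    e₃ : ∀ b x q y → b * x * (q * y) ≡ x * y * (b * q)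
    e₃ = solve-∀

  block : ℕ → ℕ
  block P = ι P / K

  block-lower : ∀ P → block P * K ≤ ι P
  block-lower P = m/n*n≤m (ι P) K

  block-upper : ∀ P → suc (ι P) ≤ suc (block P) * K
  block-upper P = ≤-trans (≤-reflexive (cong suc (m≡m%n+[m/n]*n (ι P) K))) (+-monoˡ-≤ (block P * K) (m%n<n (ι P) K))

  -- At block distance M + δ the logarithms differ by more than M + δ - 1 and less than M + δ + 1
  -- blocks, hence by more than E and less than E + 3 blocks.
  blocks-good : ∀ {P Q} δ → δ ≤ 1 → Inert d P → Inert d Q → block P ≡ δ + M + block Q → Good P Q
  blocks-good {P} {Q} δ δ≤1 iP iQ eq = (iP , iQ) , separated-lower (inert≥1 iP) lower , separated-upper (inert≥1 iQ) upper
    where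
    lower : K * E + suc (ι Q) ≤ ι P
    lower = lin (+-mono-≤ (block-upper Q) (subst (λ t → t * K ≤ ι P) eq (block-lower P))) (δ * K) (identity K E (ι Q) (ι P) δ (block Q))
      where
      identity : ∀ K E lQ lP δ β → K * E + suc lQ + (suc β * K + lP) + δ * K ≡ lP + (suc lQ + (δ + suc E + β) * K)
      identity = solve-∀
    upper : suc (ι P) ≤ K * (E + 3) + ι Q
    upper = lin (+-mono-≤ (subst (λ t → suc (ι P) ≤ suc t * K) eq (block-upper P)) (+-mono-≤ (block-lower Q) (*-monoˡ-≤ K δ≤1))) 0 (identity K E (ι Q) (ι P) δ (block Q))
      where
      identity : ∀ K E lQ lP δ β → suc lP + (suc (δ + suc E + β) * K + (lQ + 1 * K)) + 0 ≡ K * (E + 3) + lQ + (suc lP + (β * K + δ * K))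
      identity = solve-∀

  module Search (X : ℕ) where
    N : ℕ
    N = ι X

    Occupied : ℕ → Set
    Occupied j = ∃ λ P → P < suc X × (Inert d P × block P ≡ j)

    occupied? : ∀ j → Dec (Occupied j)
    occupied? j = anyUpTo? (λ P → inert? d P ×-dec (block P ≟ j)) (suc X)

    u : ℕ → ℕ
    u j = ⟦ occupied? j ⟧

    cellMass : ℕ → ℕ
    cellMass i = ∑ (suc X) λ P → ⟦ inCell? i P ⟧ * (suc i * vals X P)

    inertMass≤ : inertMass X ≤ ∑ (suc N) cellMass
    inertMass≤ = ≤-trans (∑-mono (suc X) λ P P≤X → pointwise P (s≤s⁻¹ P≤X)) (≤-reflexive (∑-swap (suc X) (suc N) _))
      where
      pointwise : ∀ P → P ≤ X → ⟦ inert? d P ⟧ * (suc (ι P) * vals X P) ≤ ∑ (suc N) (λ i → ⟦ inCell? i P ⟧ * (suc i * vals X P))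
      pointwise P P≤X = go (inert? d P)
        where
        go : (i? : Dec (Inert d P)) → ⟦ i? ⟧ * (suc (ι P) * vals X P) ≤ ∑ (suc N) (λ i → ⟦ inCell? i P ⟧ * (suc i * vals X P))
        go (no _)   = z≤n
        go (yes iP) = ≤-trans (≤-reflexive (cong (_* (suc (ι P) * vals X P)) (sym (⟦⟧-yes (inCell? (ι P) P) (iP , refl)))))
          (∑-term (suc N) (ι P) (λ i → ⟦ inCell? i P ⟧ * (suc i * vals X P)) (s≤s (ι-mono (inert≥1 iP) P≤X)))

    module Estimate (i₁ : ℕ) (i₁-large : suc (ι (suc v)) ≤ i₁) (cells : ∀ i → i₁ ≤ i → ∀ N → v * (cell i N * suc i) * (R * R ^ i) ≤ suc v * (A * A ^ i)) where
      c₁ c₂ : ℕ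
      c₁ = suc i₁ * suc (A ^ suc i₁)
      c₂ = suc v * suc v * A

      -- The primes of these cells lie below a bound independent of X, and each has weight at most
      -- (i₁ + 1) X; so the early cells matter only as O(X).
      cellMass-early : ∀ i → i ≤ i₁ → cellMass i ≤ c₁ * X
      cellMass-early i i≤i₁ = begin
        cellMass i                                                    ≤⟨ ∑-mono (suc X) (λ P _ → pointwise P (inCell? i P)) ⟩
        ∑ (suc X) (λ P → ⟦ P ≤? A ^ suc i₁ ⟧ * (suc i₁ * X))          ≡⟨ ∑-*ʳ (suc X) (suc i₁ * X) _ ⟩
        ∑ (suc X) (λ P → ⟦ P ≤? A ^ suc i₁ ⟧) * (suc i₁ * X)          ≤⟨ *-monoˡ-≤ (suc i₁ * X) (∑-below (suc X) (A ^ suc i₁)) ⟩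
        suc (A ^ suc i₁) * (suc i₁ * X)                               ≡⟨ shuffle (suc (A ^ suc i₁)) (suc i₁) X ⟩
        c₁ * X                                                        ∎
        where
        open ≤-Reasoning
        shuffle : ∀ a b x → a * (b * x) ≡ b * a * x
        shuffle = solve-∀
        pointwise : ∀ P (c? : Dec (InCell i P)) → ⟦ c? ⟧ * (suc i * vals X P) ≤ ⟦ P ≤? A ^ suc i₁ ⟧ * (suc i₁ * X)
        pointwise P (no _) = z≤n
        pointwise P (yes ((pp , _) , ιP≡i)) = *-mono-≤ (≤-reflexive (sym (⟦⟧-yes (P ≤? A ^ suc i₁) P≤))) (*-mono-≤ (s≤s i≤i₁) (vals≤ X pp))
          where
          P≤ : P ≤ A ^ suc i₁
          P≤ = ≤-trans (≤-trans (m≤m*n P (R ^ suc i) {{>-nonZero (R^>0 (suc i))}}) (<⇒≤ (ι-upper P (suc i) (s≤s (≤-reflexive ιP≡i))))) (^-monoʳ-≤ A (s≤s i≤i₁))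

      -- One factor (v + 1) / v comes from the bound for the cell, the other from P / (P - 1), as
      -- `vals X P` is at most X / (P - 1) and P exceeds v.
      cellMass-late : ∀ i → i₁ ≤ i → v * v * R * cellMass i ≤ c₂ * X
      cellMass-late i i₁≤i = *-cancelʳ-≤ (v * v * R * cellMass i) (c₂ * X) (A ^ i) {{>-nonZero (A^>0 i)}} (begin
        v * v * R * cellMass i * A ^ i                                        ≡⟨ e₁ v R (cellMass i) (A ^ i) ⟩
        v * R * (cellMass i * (v * A ^ i))                                    ≡⟨ cong (v * R *_) (∑-*ʳ (suc X) (v * A ^ i) _) ⟨
        v * R * ∑ (suc X) (λ P → ⟦ inCell? i P ⟧ * (suc i * vals X P) * (v * A ^ i)) ≤⟨ *-monoʳ-≤ (v * R) (∑-mono (suc X) λ P _ → pointwise P (inCell? i P)) ⟩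
        v * R * ∑ (suc X) (λ P → ⟦ inCell? i P ⟧ * (suc i * (suc v * X * R ^ i))) ≡⟨ cong (v * R *_) (∑-*ʳ (suc X) _ _) ⟩
        v * R * (cell i (suc X) * (suc i * (suc v * X * R ^ i)))              ≡⟨ e₂ v R (cell i (suc X)) (suc i) (suc v) X (R ^ i) ⟩
        suc v * X * (v * (cell i (suc X) * suc i) * (R * R ^ i))              ≤⟨ *-monoʳ-≤ (suc v * X) (cells i i₁≤i (suc X)) ⟩
        suc v * X * (suc v * (A * A ^ i))                                     ≡⟨ e₃ (suc v) X A (A ^ i) ⟩
        c₂ * X * A ^ i                                                        ∎)
        where
        open ≤-Reasoning
        e₁ : ∀ v R c u → v * v * R * c * u ≡ v * R * (c * (v * u))
        e₁ = solve-∀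
        e₂ : ∀ v R c i w X r → v * R * (c * (i * (w * X * r))) ≡ w * X * (v * (c * i) * (R * r))
        e₂ = solve-∀
        e₃ : ∀ w X A u → w * X * (w * (A * u)) ≡ w * w * A * X * u
        e₃ = solve-∀
        pointwise : ∀ P (c? : Dec (InCell i P)) → ⟦ c? ⟧ * (suc i * vals X P) * (v * A ^ i) ≤ ⟦ c? ⟧ * (suc i * (suc v * X * R ^ i))
        pointwise P (no _) = z≤n
        pointwise zero (yes ((pp , _) , _)) = ⊥-elim (<⇒≱ (prime≥2 pp) z≤n)
        pointwise (suc p) (yes ((pp , _) , ιP≡i)) = ≤-trans (≤-reflexive (e₄ (suc i) (vals X (suc p)) v (A ^ i))) (*-monoʳ-≤ 1 (*-monoʳ-≤ (suc i) bound))
          where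
          e₄ : ∀ i w v u → 1 * (i * w) * (v * u) ≡ 1 * (i * (w * v * u))
          e₄ = solve-∀
          v<P : suc v ≤ suc p
          v<P = ≮⇒≥ λ P<v → <⇒≱ (≤-trans i₁-large i₁≤i) (≤-trans (≤-reflexive (sym ιP≡i)) (ι-mono (s≤s z≤n) (<⇒≤ P<v)))
          bound : vals X (suc p) * v * A ^ i ≤ suc v * X * R ^ i
          bound = begin
            vals X (suc p) * v * A ^ i                ≤⟨ *-monoʳ-≤ (vals X (suc p) * v) (subst (λ j → A ^ j ≤ suc p * R ^ j) ιP≡i (ι-lower (suc p) (s≤s z≤n))) ⟩
            vals X (suc p) * v * (suc p * R ^ i)      ≡⟨ e₅ (vals X (suc p)) v (suc p) (R ^ i) ⟩
            v * suc p * vals X (suc p) * R ^ i        ≤⟨ *-monoˡ-≤ (R ^ i) (*-monoˡ-≤ (vals X (suc p)) (lin (s≤s⁻¹ v<P) 0 (e₆ v p))) ⟩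
            suc v * p * vals X (suc p) * R ^ i        ≡⟨ cong (_* R ^ i) (*-assoc (suc v) p (vals X (suc p))) ⟩
            suc v * (p * vals X (suc p)) * R ^ i      ≤⟨ *-monoˡ-≤ (R ^ i) (*-monoʳ-≤ (suc v) (vals-bound X p (prime≥2 pp))) ⟩
            suc v * X * R ^ i                         ∎
            where
            e₅ : ∀ w v p r → w * v * (p * r) ≡ v * p * w * r
            e₅ = solve-∀
            e₆ : ∀ v p → v * suc p + p + 0 ≡ suc v * p + v
            e₆ = solve-∀

      cellMass-bound : ∀ i → v * v * R * cellMass i ≤ ⟦ i ≤? i₁ ⟧ * (v * v * R * (c₁ * X)) + c₂ * X * u (i / K)
      cellMass-bound i = go (i ≤? i₁) (occupied? (i / K))
        where
        go : (e? : Dec (i ≤ i₁)) (o? : Dec (Occupied (i / K))) → v * v * R * cellMass i ≤ ⟦ e? ⟧ * (v * v * R * (c₁ * X)) + c₂ * X * ⟦ o? ⟧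
        go (yes i≤) o? = ≤-trans (*-monoʳ-≤ (v * v * R) (cellMass-early i i≤)) (≤-trans (≤-reflexive (sym (*-identityˡ _))) (m≤m+n _ _))
        go (no i≰) (yes _) = ≤-trans (cellMass-late i (<⇒≤ (≰⇒> i≰))) (≤-reflexive (sym (*-identityʳ (c₂ * X))))
        go (no i≰) (no ¬o) = ≤-trans (≤-reflexive (trans (cong (v * v * R *_) (∑-zero (suc X) λ P P≤X → cong (_* (suc i * vals X P))
          (⟦⟧-no (inCell? i P) λ { (iP , ιP≡i) → ¬o (P , P≤X , iP , cong (_/ K) ιP≡i) }))) (*-zeroʳ (v * v * R)))) z≤n

      occupiedCells : ℕ
      occupiedCells = ∑ (suc N) λ i → u (i / K)

      inertMass-upper : v * v * R * inertMass X ≤ suc i₁ * (v * v * R * (c₁ * X)) + c₂ * X * occupiedCells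
      inertMass-upper = begin
        v * v * R * inertMass X                 ≤⟨ *-monoʳ-≤ (v * v * R) inertMass≤ ⟩
        v * v * R * ∑ (suc N) cellMass          ≡⟨ ∑-*ˡ (suc N) (v * v * R) cellMass ⟨
        ∑ (suc N) (λ i → v * v * R * cellMass i) ≤⟨ ∑-mono (suc N) (λ i _ → cellMass-bound i) ⟩
        ∑ (suc N) (λ i → ⟦ i ≤? i₁ ⟧ * (v * v * R * (c₁ * X)) + c₂ * X * u (i / K)) ≡⟨ trans (∑-+ (suc N) _ _) (cong₂ _+_ (∑-*ʳ (suc N) _ _) (∑-*ˡ (suc N) (c₂ * X) _)) ⟩
        ∑ (suc N) (λ i → ⟦ i ≤? i₁ ⟧) * (v * v * R * (c₁ * X)) + c₂ * X * occupiedCells ≤⟨ +-monoˡ-≤ _ (*-monoˡ-≤ _ (∑-below (suc N) i₁)) ⟩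
        suc i₁ * (v * v * R * (c₁ * X)) + c₂ * X * occupiedCells ∎
        where open ≤-Reasoning

      module NoPair (none : ¬ (∃ λ P → P < suc X × ∃ λ Q → Q < suc X × Good P Q)) where
        disjoint : ∀ δ → δ ≤ 1 → ∀ j → u j + u (δ + M + j) ≤ 1
        disjoint δ δ≤1 j = go (occupied? j) (occupied? (δ + M + j))
          where
          go : (o? : Dec (Occupied j)) (o′? : Dec (Occupied (δ + M + j))) → ⟦ o? ⟧ + ⟦ o′? ⟧ ≤ 1
          go (no _)  o′?    = ⟦⟧≤1 o′?
          go (yes _) (no _) = ≤-refl
          go (yes (Q , Q≤X , iQ , bQ)) (yes (P , P≤X , iP , bP)) = ⊥-elim (none (P , P≤X , Q , Q≤X , blocks-good δ δ≤1 iP iQ (trans bP (cong (δ + M +_) (sym bQ)))))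

        L : ℕ
        L = suc (M + M)

        instance
          LK≢0 : NonZero (L * K)
          LK≢0 = m*n≢0 L K

        -- W windows of L blocks cover all cells, and each has at most M occupied blocks of K cells.
        -- Rounding W up costs at most one window, hence the term M L K.
        occupied-density : L * occupiedCells ≤ M * N + M * L * K
        occupied-density = ≤-trans (*-monoʳ-≤ L (≤-trans (∑-extend (λ i → u (i / K)) cover) (≤-trans (≤-reflexive (∑-blocks (W * L) K u))
            (*-monoʳ-≤ K (window-density M W u (λ j → ⟦⟧≤1 (occupied? j)) (disjoint 0 z≤n) (disjoint 1 ≤-refl))))))
          (lin (*-monoʳ-≤ M (m/n*n≤m N (L * K))) 0 (identity L K (N / (L * K)) M N))
          where
          W : ℕ
          W = suc (N / (L * K))
          cover : suc N ≤ W * L * K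
          cover = ≤-trans (≤-reflexive (cong suc (m≡m%n+[m/n]*n N (L * K)))) (≤-trans (+-monoˡ-≤ (N / (L * K) * (L * K)) (m%n<n N (L * K))) (≤-reflexive (sym (*-assoc W L K))))
          identity : ∀ L K t M N → L * (K * (suc t * M)) + M * N + 0 ≡ M * N + M * L * K + M * (t * (L * K))
          identity = solve-∀

        -- Twice the inert mass is at least (1 - 1/v) X N and at most 2 (1 + 1/v)² ρ X (M / L) N, up
        -- to O(X). By `margin` the first coefficient is the larger one, so N is bounded
        -- independently of X.
        contradiction : ∀ C → 1 ≤ X → v * (X * N) ≤ 2 * v * inertMass X + (X * N + C * X) →
          N ≤ 2 * (L * (suc i₁ * (v * v * R * c₁))) + 2 * c₂ * (M * L * K) + L * v * R * C
        contradiction C 1≤X mass = *-cancelʳ-≤ N _ X {{>-nonZero 1≤X}} (lin (+-mono-≤ (+-mono-≤ (*-monoʳ-≤ (L * v * R) mass) (*-monoʳ-≤ (2 * L) inertMass-upper))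
            (+-mono-≤ (*-monoʳ-≤ (2 * c₂ * X) occupied-density) (*-monoʳ-≤ (X * N) margin))) 0
          (identity v R X N C L (inertMass X) (suc i₁) c₁ c₂ occupiedCells M K))
          where
          identity : ∀ v R X N C L I i c₁ c₂ h M K →
            N * X + (L * v * R * (2 * v * I + (X * N + C * X)) + 2 * L * (i * (v * v * R * (c₁ * X)) + c₂ * X * h)
              + (2 * c₂ * X * (M * N + M * L * K) + X * N * (v * v * R * L))) + 0
            ≡ (2 * (L * (i * (v * v * R * c₁))) + 2 * c₂ * (M * L * K) + L * v * R * C) * X
              + (L * v * R * (v * (X * N)) + 2 * L * (v * v * R * I) + (2 * c₂ * X * (L * h) + X * N * (2 * c₂ * M + L * v * R + 1)))
          identity = solve-∀

  inert-pair : ∃ λ P → ∃ λ Q → Good P Q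
  inert-pair = from-cells (cells-bound v 1≤v) (inertMass-lower v 1≤v)
    where
    from-cells : (∃ λ i₀ → ∀ i → i₀ ≤ i → ∀ N → v * (cell i N * suc i) * (R * R ^ i) ≤ suc v * (A * A ^ i)) →
      (∃ λ C → ∀ X₀ → ∃ λ X → X₀ ≤ X × 1 ≤ X × v * (X * ι X) ≤ 2 * v * inertMass X + (X * ι X + C * X)) → ∃ λ P → ∃ λ Q → Good P Q
    from-cells (i₀ , cells) (C , masses) = from-mass (masses (A ^ suc bound))
      where
      i₁ bound : ℕ
      -- From here on the bound for cells holds and every prime of the cell exceeds v.
      i₁ = i₀ + suc (ι (suc v))
      bound = 2 * (suc (M + M) * (suc i₁ * (v * v * R * (suc i₁ * suc (A ^ suc i₁))))) + 2 * (suc v * suc v * A) * (M * suc (M + M) * K) + suc (M + M) * v * R * C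
      from-mass : (∃ λ X → A ^ suc bound ≤ X × 1 ≤ X × v * (X * ι X) ≤ 2 * v * inertMass X + (X * ι X + C * X)) → ∃ λ P → ∃ λ Q → Good P Q
      from-mass (X , large , 1≤X , mass) = search (anyUpTo? (λ P → anyUpTo? (good? P) (suc X)) (suc X))
        where
        search : Dec (∃ λ P → P < suc X × ∃ λ Q → Q < suc X × Good P Q) → ∃ λ P → ∃ λ Q → Good P Q
        search (yes (P , _ , Q , _ , good)) = P , Q , good
        search (no none) = ⊥-elim (<⇒≱ (ι-large (suc bound) X large)
          (Search.Estimate.NoPair.contradiction X i₁ (m≤n+m (suc (ι (suc v))) i₀) (λ i i₁≤i → cells i (≤-trans (m≤m+n i₀ _) i₁≤i)) none C 1≤X mass))

-- Prime elements

-- In lowest terms b′ divides a′², hence b′ = 1 and d = a′² is a square; being square-free it is 1.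
squareFree-anisotropic : ∀ d → 1 < d → SquareFree d → ∀ a b → a * a ≡ d * (b * b) → b ≡ 0
squareFree-anisotropic d 1<d sf a zero    e = refl
squareFree-anisotropic d 1<d sf a b@(suc _) e = ⊥-elim (<-irrefl (sym d≡1) 1<d)
  where
  g a′ b′ : ℕ
  instance
    g≢0 : NonZero (gcd a b)
    g≢0 = ≢-nonZero (gcd[m,n]≢0 a b (inj₂ λ ()))
  g = gcd a b
  a′ = a / g
  b′ = b / g
  a≡ : a ≡ a′ * g
  a≡ = sym (m/n*n≡m (gcd[m,n]∣m a b))
  b≡ : b ≡ b′ * g
  b≡ = sym (m/n*n≡m (gcd[m,n]∣n a b))
  reduced : a′ * a′ ≡ d * (b′ * b′)
  reduced = *-cancelʳ-≡ (a′ * a′) (d * (b′ * b′)) (g * g) {{m*n≢0 g g}} (trans (e₁ a′ g) (trans (sym (cong₂ _*_ a≡ a≡)) (trans e (trans (cong₂ (λ x y → d * (x * y)) b≡ b≡) (e₂ d b′ g)))))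
    where
    e₁ : ∀ a g → a * a * (g * g) ≡ a * g * (a * g)
    e₁ = solve-∀
    e₂ : ∀ d b g → d * (b * g * (b * g)) ≡ d * (b * b) * (g * g)
    e₂ = solve-∀
  coprime : Coprime b′ a′
  coprime = Coprimality.sym (Coprimality.coprime-/gcd a b)
  b′≡1 : b′ ≡ 1
  b′≡1 = coprime (∣-refl , Coprimality.coprime-divisor coprime (subst (b′ ∣_) (sym reduced) (∣n⇒∣m*n d (m∣m*n b′))))
  a′²≡d : a′ * a′ ≡ d
  a′²≡d = trans reduced (trans (cong (λ x → d * (x * x)) b′≡1) (*-identityʳ d))
  d≡1 : d ≡ 1
  d≡1 = trans (sym a′²≡d) (cong (λ x → x * x) (sf a′ (∣-reflexive a′²≡d)))

-- If P did not divide y, then x / y would be a square root of d modulo P.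
inert-norm : ∀ d P → Inert d P → ∀ x y → (ℤ.+ P) ∣ℤ norm (ℤ.+ d) x y → (ℤ.+ P) ∣ℤ x × (ℤ.+ P) ∣ℤ y
inert-norm d P (pp , nonsplit) x y div = P∣x , P∣y
  where
  instance
    P≢0 : NonZero P
    P≢0 = prime⇒nonZero pp
  open Modular P
  a b : ℕ
  a = ℤ.∣ x ∣
  b = ℤ.∣ y ∣
  a²≈db² : a * a ≈ d * (b * b)
  a²≈db² = ∣ℤ⇒%≡ (a * a) (d * (b * b)) P (subst ((ℤ.+ P) ∣ℤ_) (trans (norm≡ d x y) (sym (ℤₚ.[+m]-[+n]≡m⊖n (a * a) (d * (b * b))))) div)
  P∣b : P ∣ b
  P∣b = decidable-stable (P ∣? b) λ P∤b → let
      coprime : Coprime b P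
      coprime {i} (i∣b , i∣P) = [ id , (λ i≡P → ⊥-elim (P∤b (subst (_∣ b) i≡P i∣b))) ]′ (prime⇒irreducible pp i∣P)
      v = proj₁ (inverse b coprime)
      bv≈1 = proj₂ (inverse b coprime)
    in nonsplit ((a * v) % P , m%n<n (a * v) P , ℤ∣.∣⇒∣ᵤ (subst (λ z → (ℤ.+ P) ∣ℤ (z ℤ.- ℤ.+ d)) (ℤₚ.pos-* ((a * v) % P) ((a * v) % P))
      (%≡⇒∣ℤ ((a * v) % P * ((a * v) % P)) d P (root v bv≈1))))
    where
    root : ∀ v → b * v ≈ 1 → (a * v) % P * ((a * v) % P) ≈ d
    root v bv≈1 = begin
      ((a * v) % P * ((a * v) % P)) % P   ≡⟨ ≈-* ((a * v) % P) (a * v) ((a * v) % P) (a * v) (≈-% (a * v)) (≈-% (a * v)) ⟩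
      (a * v * (a * v)) % P               ≡⟨ cong (_% P) (e₁ a v) ⟩
      (a * a * (v * v)) % P               ≡⟨ ≈-* (a * a) (d * (b * b)) (v * v) (v * v) a²≈db² refl ⟩
      (d * (b * b) * (v * v)) % P         ≡⟨ cong (_% P) (e₂ d b v) ⟩
      (d * (b * v * (b * v))) % P         ≡⟨ ≈-* d d (b * v * (b * v)) 1 refl (≈-* (b * v) 1 (b * v) 1 bv≈1 bv≈1) ⟩
      (d * 1) % P                         ≡⟨ cong (_% P) (*-identityʳ d) ⟩
      d % P                               ∎
      where
      open ≡-Reasoning
      e₁ : ∀ a v → a * v * (a * v) ≡ a * a * (v * v)
      e₁ = solve-∀
      e₂ : ∀ d b v → d * (b * b) * (v * v) ≡ d * (b * v * (b * v))
      e₂ = solve-∀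
  P∣a : P ∣ a
  P∣a = [ id , id ]′ (euclidsLemma a a pp (≈0⇒∣ {a * a} (trans a²≈db² (∣⇒≈0 {d * (b * b)} (∣n⇒∣m*n d (∣m⇒∣m*n b P∣b))))))
  P∣x : (ℤ.+ P) ∣ℤ x
  P∣x = ℤ∣.∣ᵤ⇒∣ P∣a
  P∣y : (ℤ.+ P) ∣ℤ y
  P∣y = ℤ∣.∣ᵤ⇒∣ P∣b

inert-odd : ∀ d P → Inert d P → ¬ ((ℤ.+ P) ∣ℤ (ℤ.+ 2))
inert-odd d P (pp , nonsplit) P∣2 = nonsplit (d % 2 , subst (d % 2 <_) (sym P≡2) (m%n<n d 2) , subst (_∣ ℤ.∣ ℤ.+ (d % 2) ℤ.* ℤ.+ (d % 2) ℤ.- ℤ.+ d ∣) (sym P≡2)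
    (ℤ∣.∣⇒∣ᵤ (subst (λ z → (ℤ.+ 2) ∣ℤ (z ℤ.- ℤ.+ d)) (ℤₚ.pos-* (d % 2) (d % 2)) (%≡⇒∣ℤ (d % 2 * (d % 2)) d 2 (square (d % 2) (m%n<n d 2) (m%n%n≡m%n d 2))))))
  where
  P≡2 : P ≡ 2
  P≡2 = ≤-antisym (∣⇒≤ (ℤ∣.∣⇒∣ᵤ {ℤ.+ P} {ℤ.+ 2} P∣2)) (prime≥2 pp)
  square : ∀ r → r < 2 → r % 2 ≡ d % 2 → (r * r) % 2 ≡ d % 2
  square 0 _ e = e
  square 1 _ e = e
  square (suc (suc r)) (s≤s (s≤s ())) _

ring-cases : ∀ d → (tr d ≡ ℤ.0ℤ × nm d ≡ ℤ.+ d) ⊎ (tr d ≡ ℤ.1ℤ × ℤ.1ℤ ℤ.+ ℤ.+ 4 ℤ.* nm d ≡ ℤ.+ d)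
ring-cases d = go ((d % 4) ≡ᵇ 1) refl
  where
  go : ∀ c → ((d % 4) ≡ᵇ 1) ≡ c → ((if c then ℤ.1ℤ else ℤ.0ℤ) ≡ ℤ.0ℤ × (if c then ℤ.+ ((d ∸ 1) / 4) else ℤ.+ d) ≡ ℤ.+ d)
    ⊎ ((if c then ℤ.1ℤ else ℤ.0ℤ) ≡ ℤ.1ℤ × ℤ.1ℤ ℤ.+ ℤ.+ 4 ℤ.* (if c then ℤ.+ ((d ∸ 1) / 4) else ℤ.+ d) ≡ ℤ.+ d)
  go false _  = inj₁ (refl , refl)
  go true  eq = inj₂ (refl , trans (cong (ℤ._+_ ℤ.1ℤ) (sym (ℤₚ.pos-* 4 ((d ∸ 1) / 4)))) (cong ℤ.+_ (sym (trans d≡ (cong suc (trans (cong (_* 4) (sym quarter)) (*-comm ((d ∸ 1) / 4) 4)))))))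
    where
    d≡ : d ≡ 1 + d / 4 * 4
    d≡ = trans (m≡m%n+[m/n]*n d 4) (cong (_+ d / 4 * 4) (≡ᵇ⇒≡ (d % 4) 1 (subst Bool.T (sym eq) tt)))
    quarter : (d ∸ 1) / 4 ≡ d / 4
    quarter = trans (cong (λ x → (x ∸ 1) / 4) d≡) (m*n/n≡m (d / 4) 4)

normO : ℕ → O → ℤ
normO d (a , b) = a ℤ.* a ℤ.+ tr d ℤ.* (a ℤ.* b) ℤ.- nm d ℤ.* (b ℤ.* b)

normO-* : ∀ d α β → normO d (mulO d α β) ≡ normO d α ℤ.* normO d β
normO-* d (a , b) (c , e) = identity a b c e (tr d) (nm d)
  where
  identity : ∀ a b c e t N → let x = a ℤ.* c ℤ.+ N ℤ.* (b ℤ.* e); y = a ℤ.* e ℤ.+ b ℤ.* c ℤ.+ t ℤ.* (b ℤ.* e) in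
    x ℤ.* x ℤ.+ t ℤ.* (x ℤ.* y) ℤ.- N ℤ.* (y ℤ.* y) ≡ (a ℤ.* a ℤ.+ t ℤ.* (a ℤ.* b) ℤ.- N ℤ.* (b ℤ.* b)) ℤ.* (c ℤ.* c ℤ.+ t ℤ.* (c ℤ.* e) ℤ.- N ℤ.* (e ℤ.* e))
  identity = ℤ-solver.solve-∀

-- In the half-integral case 4 times the norm is (2a + b)² - d b², so P divides 2a + b and b, and
-- then a because P is odd.
inert-normO : ∀ d P → Inert d P → ∀ a b → (ℤ.+ P) ∣ℤ normO d (a , b) → (ℤ.+ P) ∣ℤ a × (ℤ.+ P) ∣ℤ b
inert-normO d P inert a b div = [ ramified , unramified ]′ (ring-cases d)
  where
  ramified : tr d ≡ ℤ.0ℤ × nm d ≡ ℤ.+ d → (ℤ.+ P) ∣ℤ a × (ℤ.+ P) ∣ℤ b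
  ramified (t≡0 , N≡d) = inert-norm d P inert a b (subst ((ℤ.+ P) ∣ℤ_) (trans (cong₂ (λ t N → a ℤ.* a ℤ.+ t ℤ.* (a ℤ.* b) ℤ.- N ℤ.* (b ℤ.* b)) t≡0 N≡d) (identity a b (ℤ.+ d))) div)
    where
    identity : ∀ a b d → a ℤ.* a ℤ.+ ℤ.0ℤ ℤ.* (a ℤ.* b) ℤ.- d ℤ.* (b ℤ.* b) ≡ a ℤ.* a ℤ.- d ℤ.* (b ℤ.* b)
    identity = ℤ-solver.solve-∀
  unramified : tr d ≡ ℤ.1ℤ × ℤ.1ℤ ℤ.+ ℤ.+ 4 ℤ.* nm d ≡ ℤ.+ d → (ℤ.+ P) ∣ℤ a × (ℤ.+ P) ∣ℤ b
  unramified (t≡1 , N≡) = P∣a , proj₂ both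
    where
    identity : ∀ a b N → ℤ.+ 4 ℤ.* (a ℤ.* a ℤ.+ ℤ.1ℤ ℤ.* (a ℤ.* b) ℤ.- N ℤ.* (b ℤ.* b)) ≡ (ℤ.+ 2 ℤ.* a ℤ.+ b) ℤ.* (ℤ.+ 2 ℤ.* a ℤ.+ b) ℤ.- (ℤ.1ℤ ℤ.+ ℤ.+ 4 ℤ.* N) ℤ.* (b ℤ.* b)
    identity = ℤ-solver.solve-∀
    both : (ℤ.+ P) ∣ℤ (ℤ.+ 2 ℤ.* a ℤ.+ b) × (ℤ.+ P) ∣ℤ b
    both = inert-norm d P inert (ℤ.+ 2 ℤ.* a ℤ.+ b) b (subst ((ℤ.+ P) ∣ℤ_) (trans (cong (λ t → ℤ.+ 4 ℤ.* (a ℤ.* a ℤ.+ t ℤ.* (a ℤ.* b) ℤ.- nm d ℤ.* (b ℤ.* b))) t≡1)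
      (trans (identity a b (nm d)) (cong (λ δ → (ℤ.+ 2 ℤ.* a ℤ.+ b) ℤ.* (ℤ.+ 2 ℤ.* a ℤ.+ b) ℤ.- δ ℤ.* (b ℤ.* b)) N≡))) (ℤ∣.∣n⇒∣m*n (ℤ.+ 4) div))
    P∣a : (ℤ.+ P) ∣ℤ a
    P∣a = [ ⊥-elim ∘ inert-odd d P inert , id ]′ (euclidℤ (ℤ.+ 2) a (proj₁ inert) (ℤ∣.∣m+n∣n⇒∣m (proj₁ both) (proj₂ both)))

inert-prime : ∀ d π → Inert d ℤ.∣ π ∣ → PrimeO d (π , ℤ.0ℤ)
inert-prime d π inert@(pp , _) = nonzero , nonunit , divides-factor
  where
  P : ℤ
  P = ℤ.+ ℤ.∣ π ∣
  first : ∀ x y → π ℤ.* x ℤ.+ nm d ℤ.* (ℤ.0ℤ ℤ.* y) ≡ x ℤ.* π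
  first x y = identity π x y (nm d)
    where
    identity : ∀ p x y N → p ℤ.* x ℤ.+ N ℤ.* (ℤ.0ℤ ℤ.* y) ≡ x ℤ.* p
    identity = ℤ-solver.solve-∀
  second : ∀ x y → π ℤ.* y ℤ.+ ℤ.0ℤ ℤ.* x ℤ.+ tr d ℤ.* (ℤ.0ℤ ℤ.* y) ≡ y ℤ.* π
  second x y = identity π x y (tr d)
    where
    identity : ∀ p x y t → p ℤ.* y ℤ.+ ℤ.0ℤ ℤ.* x ℤ.+ t ℤ.* (ℤ.0ℤ ℤ.* y) ≡ y ℤ.* p
    identity = ℤ-solver.solve-∀
  nonzero : ¬ ((π , ℤ.0ℤ) ≡ zeroO)
  nonzero e = <⇒≱ (prime≥2 pp) (≤-trans (≤-reflexive (cong (λ α → ℤ.∣ proj₁ α ∣) e)) z≤n)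
  nonunit : ¬ UnitO d (π , ℤ.0ℤ)
  nonunit ((x , y) , e) = <⇒≱ (prime≥2 pp) (∣⇒≤ (ℤ∣.∣⇒∣ᵤ {π} {ℤ.1ℤ} (ℤ∣.divides x (trans (sym (cong proj₁ e)) (first x y)))))
  divides-π : ∀ a b → P ∣ℤ a × P ∣ℤ b → DividesO d (π , ℤ.0ℤ) (a , b)
  divides-π a b (P∣a , P∣b) = combine (ℤ∣.∣-trans ℤ∣.m∣∣m∣ P∣a) (ℤ∣.∣-trans ℤ∣.m∣∣m∣ P∣b)
    where
    combine : π ∣ℤ a → π ∣ℤ b → DividesO d (π , ℤ.0ℤ) (a , b)
    combine (ℤ∣.divides x ex) (ℤ∣.divides y ey) = (x , y) , cong₂ _,_ (trans ex (sym (first x y))) (trans ey (sym (second x y)))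
  normO-π : normO d (π , ℤ.0ℤ) ≡ π ℤ.* π
  normO-π = identity π (tr d) (nm d)
    where
    identity : ∀ p t N → p ℤ.* p ℤ.+ t ℤ.* (p ℤ.* ℤ.0ℤ) ℤ.- N ℤ.* (ℤ.0ℤ ℤ.* ℤ.0ℤ) ≡ p ℤ.* p
    identity = ℤ-solver.solve-∀
  divides-factor : ∀ α β → DividesO d (π , ℤ.0ℤ) (mulO d α β) → DividesO d (π , ℤ.0ℤ) α ⊎ DividesO d (π , ℤ.0ℤ) β
  divides-factor α@(a , b) β@(c , e) (γ , eq) = [ (λ u → inj₁ (divides-π a b (inert-normO d ℤ.∣ π ∣ inert a b u))) , (λ u → inj₂ (divides-π c e (inert-normO d ℤ.∣ π ∣ inert c e u))) ]′
    (euclidℤ (normO d α) (normO d β) pp (ℤ∣.∣-trans ℤ∣.∣m∣∣m (subst (π ∣ℤ_) (sym norms) (ℤ∣.∣m⇒∣m*n (normO d γ) (ℤ∣.∣m⇒∣m*n π ℤ∣.∣-refl)))))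
    where
    norms : normO d α ℤ.* normO d β ≡ π ℤ.* π ℤ.* normO d γ
    norms = trans (sym (normO-* d α β)) (trans (cong (normO d) eq) (trans (normO-* d (π , ℤ.0ℤ) γ) (cong (ℤ._* normO d γ) normO-π)))

PosO-rational : ∀ d w z → ℤ.0ℤ ℤ.< w → z ≡ ℤ.0ℤ → PosO d (w , z)
PosO-rational d w z 0<w refl = inj₁ (ℤₚ.<⇒≤ 0<u , ℤₚ.≤-reflexive (sym (ℤₚ.*-zeroʳ (ℤ.+ 2 ℤ.- tr d))) , λ (u≡0 , _) → ℤₚ.<-irrefl (sym u≡0) 0<u)
  where
  0<u : ℤ.0ℤ ℤ.< ℤ.+ 2 ℤ.* w ℤ.+ tr d ℤ.* ℤ.0ℤ
  0<u = subst (ℤ.0ℤ ℤ.<_) (sym (trans (cong (ℤ._+_ (ℤ.+ 2 ℤ.* w)) (ℤₚ.*-zeroʳ (tr d))) (ℤₚ.+-identityʳ (ℤ.+ 2 ℤ.* w)))) (ℤₚ.*-monoˡ-<-pos (ℤ.+ 2) 0<w)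

PosO-difference : ∀ d m n x y w → ℤ.0ℤ ℤ.< (m ℤ.* x ℤ.- n ℤ.* y) ℤ.* w → PosO d (mulO d (subO (scaleO m (x , ℤ.0ℤ)) (scaleO n (y , ℤ.0ℤ))) (w , ℤ.0ℤ))
PosO-difference d m n x y w pos = PosO-rational d _ _ (subst (ℤ.0ℤ ℤ.<_) (sym (identity₁ m n x y w (nm d))) pos) (identity₂ m n x y w (tr d))
  where
  identity₁ : ∀ m n x y w N → (m ℤ.* x ℤ.- n ℤ.* y) ℤ.* w ℤ.+ N ℤ.* ((m ℤ.* ℤ.0ℤ ℤ.- n ℤ.* ℤ.0ℤ) ℤ.* ℤ.0ℤ) ≡ (m ℤ.* x ℤ.- n ℤ.* y) ℤ.* w
  identity₁ = ℤ-solver.solve-∀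
  identity₂ : ∀ m n x y w t → (m ℤ.* x ℤ.- n ℤ.* y) ℤ.* ℤ.0ℤ ℤ.+ (m ℤ.* ℤ.0ℤ ℤ.- n ℤ.* ℤ.0ℤ) ℤ.* w ℤ.+ t ℤ.* ((m ℤ.* ℤ.0ℤ ℤ.- n ℤ.* ℤ.0ℤ) ℤ.* ℤ.0ℤ) ≡ ℤ.0ℤ
  identity₂ = ℤ-solver.solve-∀

-- Quotients of inert primes in arbitrary rational intervals

module Quotients (m : ℕ) (1<d : 1 < suc m) (sf : SquareFree (suc m)) where
  d : ℕ
  d = suc m

  Between : ℕ → ℕ → ℕ → ℕ → Set
  Between x₁ x₂ y₁ y₂ = ∃ λ P → ∃ λ Q → Inert d P × Inert d Q × x₁ * Q < P * x₂ × P * y₂ < y₁ * Q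

  between>1 : ∀ a₁ a₂ b₁ b₂ → 1 ≤ a₂ → 1 ≤ b₂ → a₂ < a₁ → a₁ * b₂ < b₁ * a₂ → Between a₁ a₂ b₁ b₂
  between>1 a₁ a₂ b₁ b₂ 1≤a₂ 1≤b₂ 1<a a<b = regroup (Density.inert-pair m (squareFree-anisotropic d 1<d sf) a₁ a₂ b₁ b₂ 1≤a₁ 1≤b₂ E v R K 1≤v K-above K-below margin)
    where
    open Choice a₁ a₂ b₁ b₂ 1≤a₂ 1≤b₂ 1<a a<b
    regroup : (∃ λ P → ∃ λ Q → (Inert d P × Inert d Q) × (a₁ * Q < P * a₂ × P * b₂ < b₁ * Q)) → Between a₁ a₂ b₁ b₂
    regroup (P , Q , (iP , iQ) , lo , hi) = P , Q , iP , iQ , lo , hi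

  weaken-lower : ∀ a₁ a₂ x₁ x₂ P Q → 1 ≤ x₂ → x₁ * a₂ ≤ a₁ * x₂ → a₁ * Q < P * a₂ → x₁ * Q < P * x₂
  weaken-lower a₁ a₂ x₁ x₂ P Q 1≤x₂ x≤a lo = *-cancelʳ-< a₂ (x₁ * Q) (P * x₂) (begin-strict
    x₁ * Q * a₂    ≡⟨ e₁ x₁ Q a₂ ⟩
    x₁ * a₂ * Q    ≤⟨ *-monoˡ-≤ Q x≤a ⟩
    a₁ * x₂ * Q    ≡⟨ e₁ a₁ x₂ Q ⟩
    a₁ * Q * x₂    <⟨ *-monoˡ-< x₂ {{>-nonZero 1≤x₂}} lo ⟩
    P * a₂ * x₂    ≡⟨ e₁ P a₂ x₂ ⟩
    P * x₂ * a₂    ∎)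
    where
    open ≤-Reasoning
    e₁ : ∀ a b c → a * b * c ≡ a * c * b
    e₁ = solve-∀

  -- `between>1` requires a lower endpoint strictly above 1. If y > 1, the mediant of y and the
  -- larger of x and 1 is such an endpoint; if y ≤ 1, the mediant of 1/y and 1/x is one for the
  -- reciprocal interval, and P and Q change places.
  between-positive : ∀ x₁ x₂ y₁ y₂ → 1 ≤ x₁ → 1 ≤ x₂ → 1 ≤ y₂ → x₁ * y₂ < y₁ * x₂ → Between x₁ x₂ y₁ y₂
  between-positive x₁ x₂ y₁ y₂ 1≤x₁ 1≤x₂ 1≤y₂ x<y = [ small , big ]′ (≤-<-connex y₁ y₂)
    where
    big : y₂ < y₁ → Between x₁ x₂ y₁ y₂
    big y>1 = [ (λ x≥1 → from (x₁ + y₁) (x₂ + y₂) (≤-trans 1≤x₂ (m≤m+n x₂ y₂)) (+-mono-≤-< x≥1 y>1) (mediant x₁ x₂ x<y) (lin (<⇒≤ x<y) 0 (lower x₁ x₂ y₁ y₂)))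
                , (λ x<1 → from (1 + y₁) (1 + y₂) (s≤s z≤n) (s≤s y>1) (mediant 1 1 (subst₂ _<_ (sym (*-identityˡ y₂)) (sym (*-identityʳ y₁)) y>1))
                     (lin (+-mono-≤ (<⇒≤ x<1) (<⇒≤ x<y)) 0 (lower′ x₁ x₂ y₁ y₂))) ]′ (≤-<-connex x₂ x₁)
      where
      lower : ∀ x₁ x₂ y₁ y₂ → x₁ * (x₂ + y₂) + y₁ * x₂ + 0 ≡ (x₁ + y₁) * x₂ + x₁ * y₂
      lower = solve-∀
      lower′ : ∀ x₁ x₂ y₁ y₂ → x₁ * (1 + y₂) + (x₂ + y₁ * x₂) + 0 ≡ (1 + y₁) * x₂ + (x₁ + x₁ * y₂)
      lower′ = solve-∀
      mediant : ∀ z₁ z₂ → z₁ * y₂ < y₁ * z₂ → (z₁ + y₁) * y₂ < y₁ * (z₂ + y₂)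
      mediant z₁ z₂ lt = subst₂ _<_ (sym (*-distribʳ-+ y₂ z₁ y₁)) (sym (*-distribˡ-+ y₁ z₂ y₂)) (+-monoˡ-< (y₁ * y₂) lt)
      from : ∀ a₁ a₂ → 1 ≤ a₂ → a₂ < a₁ → a₁ * y₂ < y₁ * a₂ → x₁ * a₂ ≤ a₁ * x₂ → Between x₁ x₂ y₁ y₂
      from a₁ a₂ 1≤a₂ 1<a a<y x≤a = go (between>1 a₁ a₂ y₁ y₂ 1≤a₂ 1≤y₂ 1<a a<y)
        where
        go : Between a₁ a₂ y₁ y₂ → Between x₁ x₂ y₁ y₂
        go (P , Q , iP , iQ , lo , hi) = P , Q , iP , iQ , weaken-lower a₁ a₂ x₁ x₂ P Q 1≤x₂ x≤a lo , hi
    small : y₁ ≤ y₂ → Between x₁ x₂ y₁ y₂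
    small y≤1 = go (between>1 (y₂ + x₂) (y₁ + x₁) x₂ x₁ (≤-trans 1≤x₁ (m≤n+m x₁ y₁)) 1≤x₁ (+-mono-≤-< y≤1 x₁<x₂)
        (subst₂ _<_ (sym (*-distribʳ-+ x₁ y₂ x₂)) (sym (*-distribˡ-+ x₂ y₁ x₁)) (+-monoˡ-< (x₂ * x₁) (subst₂ _<_ (*-comm x₁ y₂) (*-comm y₁ x₂) x<y))))
      where
      x₁<x₂ : x₁ < x₂
      x₁<x₂ = *-cancelˡ-< y₂ x₁ x₂ (≤-trans (subst (_< y₁ * x₂) (*-comm x₁ y₂) x<y) (*-monoˡ-≤ x₂ y≤1))
      1≤y₁ : 1 ≤ y₁
      1≤y₁ = n≢0⇒n>0 λ y₁≡0 → <⇒≱ x<y (≤-trans (≤-reflexive (cong (_* x₂) y₁≡0)) z≤n)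
      lower : ∀ x₁ x₂ y₁ y₂ → y₂ * (y₁ + x₁) + y₁ * x₂ + 0 ≡ (y₂ + x₂) * y₁ + x₁ * y₂
      lower = solve-∀
      go : Between (y₂ + x₂) (y₁ + x₁) x₂ x₁ → Between x₁ x₂ y₁ y₂
      go (P , Q , iP , iQ , lo , hi) = Q , P , iQ , iP , subst₂ _<_ (*-comm P x₁) (*-comm x₂ Q) hi ,
        subst₂ _<_ (*-comm y₂ Q) (*-comm P y₁) (weaken-lower (y₂ + x₂) (y₁ + x₁) y₂ y₁ P Q 1≤y₁ (lin (<⇒≤ x<y) 0 (lower x₁ x₂ y₁ y₂)) lo)

  -- The lower endpoint may be 0; its mediant with y is positive and still below y.
  between : ∀ x₁ x₂ y₁ y₂ → 1 ≤ x₂ → 1 ≤ y₂ → x₁ * y₂ < y₁ * x₂ → Between x₁ x₂ y₁ y₂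
  between x₁ x₂ y₁ y₂ 1≤x₂ 1≤y₂ x<y = go (between-positive (x₁ + y₁) (x₂ + y₂) y₁ y₂ (≤-trans 1≤y₁ (m≤n+m y₁ x₁)) (≤-trans 1≤x₂ (m≤m+n x₂ y₂)) 1≤y₂
      (subst₂ _<_ (sym (*-distribʳ-+ y₂ x₁ y₁)) (sym (*-distribˡ-+ y₁ x₂ y₂)) (+-monoˡ-< (y₁ * y₂) x<y)))
    where
    1≤y₁ : 1 ≤ y₁
    1≤y₁ = n≢0⇒n>0 λ y₁≡0 → <⇒≱ x<y (≤-trans (≤-reflexive (cong (_* x₂) y₁≡0)) z≤n)
    lower : ∀ x₁ x₂ y₁ y₂ → x₁ * (x₂ + y₂) + y₁ * x₂ + 0 ≡ (x₁ + y₁) * x₂ + x₁ * y₂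
    lower = solve-∀
    go : Between (x₁ + y₁) (x₂ + y₂) y₁ y₂ → Between x₁ x₂ y₁ y₂
    go (P , Q , iP , iQ , lo , hi) = P , Q , iP , iQ , weaken-lower (x₁ + y₁) (x₂ + y₂) x₁ x₂ P Q 1≤x₂ (lin (<⇒≤ x<y) 0 (lower x₁ x₂ y₁ y₂)) lo , hi

  0<difference : ∀ {i j} Q → i ℤ.< j → 1 ≤ Q → ℤ.0ℤ ℤ.< (j ℤ.- i) ℤ.* ℤ.+ Q
  0<difference {i} {j} (suc Q) i<j _ = ℤₚ.*-monoʳ-<-pos (ℤ.+ suc Q) (subst (ℤ._< j ℤ.- i) (ℤₚ.+-inverseʳ i) (ℤₚ.+-monoˡ-< (ℤ.- i) i<j))

  Witness : ℚ → ℚ → Set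
  Witness p q = Σ O (λ π₁ → Σ O (λ π₂ → PrimeO d π₁ × PrimeO d π₂ × RatLtQuot d p π₁ π₂ × QuotLtRat d π₁ π₂ q))

  inert≥1 : ∀ {P} → Inert d P → 1 ≤ P
  inert≥1 (pp , _) = ≤-trans (s≤s z≤n) (prime≥2 pp)

  witness : ∀ p q π Q → Inert d ℤ.∣ π ∣ → Inert d Q → ↥ p ℤ.* ℤ.+ Q ℤ.< ↧ p ℤ.* π → ↧ q ℤ.* π ℤ.< ↥ q ℤ.* ℤ.+ Q → Witness p q
  witness p q π Q iπ iQ lo hi = (π , ℤ.0ℤ) , (ℤ.+ Q , ℤ.0ℤ) , inert-prime d π iπ , inert-prime d (ℤ.+ Q) iQ ,
    PosO-difference d (↧ p) (↥ p) π (ℤ.+ Q) (ℤ.+ Q) (0<difference Q lo (inert≥1 iQ)) , PosO-difference d (↥ q) (↧ q) (ℤ.+ Q) π (ℤ.+ Q) (0<difference Q hi (inert≥1 iQ))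

  pos-< : ∀ {a b c e} → a * b < c * e → ℤ.+ a ℤ.* ℤ.+ b ℤ.< ℤ.+ c ℤ.* ℤ.+ e
  pos-< {a} {b} {c} {e} lt = subst₂ ℤ._<_ (ℤₚ.pos-* a b) (ℤₚ.pos-* c e) (ℤ.+<+ lt)

  pos-<⁻ : ∀ {a b c e} → ℤ.+ a ℤ.* ℤ.+ b ℤ.< ℤ.+ c ℤ.* ℤ.+ e → a * b < c * e
  pos-<⁻ {a} {b} {c} {e} lt = ℤₚ.drop‿+<+ (subst₂ ℤ._<_ (sym (ℤₚ.pos-* a b)) (sym (ℤₚ.pos-* c e)) lt)

  neg-<⁻ : ∀ {a b c e} → ℤ.- (ℤ.+ a) ℤ.* ℤ.+ b ℤ.< ℤ.- (ℤ.+ c) ℤ.* ℤ.+ e → c * e < a * b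
  neg-<⁻ {a} {b} {c} {e} lt = pos-<⁻ {c} {e} {a} {b} (ℤₚ.neg-cancel-< (subst₂ ℤ._<_ (sym (ℤₚ.neg-distribˡ-* (ℤ.+ a) (ℤ.+ b))) (sym (ℤₚ.neg-distribˡ-* (ℤ.+ c) (ℤ.+ e))) lt))

  dense-positive : ∀ x₁ p y₁ q → ↥ p ℤ.≤ ℤ.+ x₁ → ↥ q ≡ ℤ.+ y₁ → x₁ * ↧ₙ q < y₁ * ↧ₙ p → Witness p q
  dense-positive x₁ p y₁ q p≤x q≡y x<y = go (between x₁ (↧ₙ p) y₁ (↧ₙ q) (s≤s z≤n) (s≤s z≤n) x<y)
    where
    go : Between x₁ (↧ₙ p) y₁ (↧ₙ q) → Witness p q
    go (P , Q , iP , iQ , lo , hi) = witness p q (ℤ.+ P) Q iP iQ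
      (ℤₚ.≤-<-trans (ℤₚ.*-monoʳ-≤-nonNeg (ℤ.+ Q) p≤x) (subst (ℤ.+ x₁ ℤ.* ℤ.+ Q ℤ.<_) (ℤₚ.*-comm (ℤ.+ P) (↧ p)) (pos-< {x₁} {Q} {P} {↧ₙ p} lo)))
      (subst₂ ℤ._<_ (ℤₚ.*-comm (ℤ.+ P) (↧ q)) (cong (ℤ._* ℤ.+ Q) (sym q≡y)) (pos-< {P} {↧ₙ q} {y₁} {Q} hi))

  dense-negative : ∀ x₁ p y₁ q → ↥ p ≡ ℤ.- (ℤ.+ y₁) → ↥ q ≡ ℤ.- (ℤ.+ x₁) → x₁ * ↧ₙ p < y₁ * ↧ₙ q → Witness p q
  dense-negative x₁ p y₁ q p≡ q≡ x<y = go (between x₁ (↧ₙ q) y₁ (↧ₙ p) (s≤s z≤n) (s≤s z≤n) x<y)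
    where
    go : Between x₁ (↧ₙ q) y₁ (↧ₙ p) → Witness p q
    go (P , Q , iP , iQ , lo , hi) = witness p q (ℤ.- (ℤ.+ P)) Q (subst (Inert d) (sym (ℤₚ.∣-i∣≡∣i∣ (ℤ.+ P))) iP) iQ
      (subst₂ ℤ._<_ (trans (ℤₚ.neg-distribˡ-* (ℤ.+ y₁) (ℤ.+ Q)) (cong (ℤ._* ℤ.+ Q) (sym p≡))) (flip P (↧ p)) (ℤₚ.neg-mono-< (pos-< {P} {↧ₙ p} {y₁} {Q} hi)))
      (subst₂ ℤ._<_ (flip P (↧ q)) (trans (ℤₚ.neg-distribˡ-* (ℤ.+ x₁) (ℤ.+ Q)) (cong (ℤ._* ℤ.+ Q) (sym q≡))) (ℤₚ.neg-mono-< (pos-< {x₁} {Q} {P} {↧ₙ q} lo)))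
      where
      flip : ∀ P δ → ℤ.- (ℤ.+ P ℤ.* δ) ≡ δ ℤ.* ℤ.- (ℤ.+ P)
      flip P δ = trans (ℤₚ.neg-distribˡ-* (ℤ.+ P) δ) (ℤₚ.*-comm (ℤ.- (ℤ.+ P)) δ)

  -- An interval that contains 0 is shortened to its positive part. One without positive points is
  -- reflected, and the sign is given to the first prime element.
  dense : ∀ p q → p ℚ.< q → Witness p q
  dense p@(ℚ.mkℚ (ℤ.+ x) _ _)    q@(ℚ.mkℚ (ℤ.+ y) _ _)      (ℚ.*<* lt) = dense-positive x p y q ℤₚ.≤-refl refl (pos-<⁻ {x} {↧ₙ q} {y} {↧ₙ p} lt)
  dense p@(ℚ.mkℚ ℤ.-[1+ x ] _ _) q@(ℚ.mkℚ (ℤ.+ suc y) _ _)  (ℚ.*<* lt) = dense-positive 0 p (suc y) q ℤ.-≤+ refl (s≤s z≤n)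
  dense p@(ℚ.mkℚ ℤ.-[1+ x ] _ _) q@(ℚ.mkℚ (ℤ.+ zero) _ _)   (ℚ.*<* lt) = dense-negative 0 p (suc x) q refl refl (s≤s z≤n)
  dense p@(ℚ.mkℚ ℤ.-[1+ x ] _ _) q@(ℚ.mkℚ ℤ.-[1+ y ] _ _)   (ℚ.*<* lt) = dense-negative (suc y) p (suc x) q refl refl (neg-<⁻ {suc x} {↧ₙ q} {suc y} {↧ₙ p} lt)
  dense p@(ℚ.mkℚ (ℤ.+ x) _ _)    q@(ℚ.mkℚ ℤ.-[1+ y ] _ _)   (ℚ.*<* lt) = ⊥-elim (ℤₚ.<⇒≱ lt
    (ℤₚ.≤-trans (ℤ.-≤+ {n = 0}) (subst (ℤ.0ℤ ℤ.≤_) (ℤₚ.pos-* x (↧ₙ q)) (ℤ.+≤+ z≤n))))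

theorem5p2 : (d : ℕ) → 1 < d → SquareFree d →
    (p q : ℚ) → p ℚ.< q →
    Σ O (λ π₁ → Σ O (λ π₂ → PrimeO d π₁ × PrimeO d π₂ ×
    RatLtQuot d p π₁ π₂ × QuotLtRat d π₁ π₂ q))
theorem5p2 (suc m) 1<d sf p q p<q = Quotients.dense m 1<d sf p q p<q
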